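{- The decision problem BSP-Strong-Dir can be solved in polynomial time on directed acyclic graphs.
   Context: An instance of Bilevel Shortest Path is $I=(G,E^\ell,E^f,s,t,c,d)$: $G=(V,E)$ a simple directed graph, $E=E^\ell\cup E^f$ a partition into leader's and follower's edges, $s,t\in V$, $c,d:E\to\mathbb{R}_{\ge0}$; $f(Z)=\sum_{e\in Z}f(e)$. Paths are simple, identified with edge sets; the set $\mathcal P_{st}$ of $s$-$t$-paths is nonempty. Strong path completion: $\mathrm{OPT}_{\mathrm{str}}(I)=\min c(X\cup Y)$ over $X\subseteq E^\ell$ and $Y\in\arg\min\{d(Y'):Y'\subseteq E^f,\ X\cup Y'\in\mathcal P_{st}\}$; leader choices making the follower's problem infeasible are infeasible; optimistic setting: among follower-optimal responses the follower picks one minimizing the leader's cost. BSP-Strong-Dir: given $I$ and $T\in\mathbb{R}_{\ge0}$, decide whether $\mathrm{OPT}_{\mathrm{str}}(I)\le T$.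
   Formalization: The edge weights c and d and the threshold T are nonnegative rationals, encoded in binary as numerator and denominator, instead of nonnegative reals. -}

module Defs where

open import Data.Bool.Base using (Bool; true; false; if_then_else_)
open import Data.Digit using (Bit; toDigits)
open import Data.Fin.Base using (Fin; zero; toℕ)
open import Data.Fin.Subset using (Subset; ∁; _∪_; _⊆_) renaming (_∈_ to _∈ₛ_)
open import Data.Integer.Base using (∣_∣)
open import Data.List.Base using (List; []; _∷_; map; foldr; allFin)
open import Data.List.Membership.Propositional using (_∈_)
open import Data.List.Relation.Unary.Unique.Propositional using (Unique)
open import Data.Nat.Base using (ℕ; suc; _+_; _*_) renaming (_≤_ to _≤ℕ_)
open import Data.Product.Base using (Σ; Σ-syntax; ∃-syntax; ∃₂; _×_; _,_; proj₁)
open import Data.Rational.Base using (ℚ; 0ℚ; _≤_; ↥_; ↧ₙ_)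
open import Data.Rational.Properties using (+-0-commutativeMonoid)
open import Data.Vec.Base using (Vec; lookup; _[_]≔_) renaming (replicate to replicateᵛ; _∷_ to _∷ᵛ_)
open import Function.Bundles using (_⇔_)
open import Relation.Binary.PropositionalEquality.Core using (_≡_; _≢_)
open import Relation.Nullary.Reflects using (Reflects)

open import Algebra.Properties.CommutativeMonoid.Sum +-0-commutativeMonoid using (sum)

-- The machine model is the language WHILE of N. D. Jones, "Computability
-- and Complexity from a Programming Perspective" (1997): imperative
-- programs over binary trees, with Jones's running time.  PTIME for WHILE
-- coincides with PTIME for Turing machines (trees are stored as shared
-- pointer structures, which is why copying and cons have unit cost).

infixr 5 _∙_

data Tree : Set where
  nil : Tree
  _∙_ : Tree → Tree → Tree

size : Tree → ℕ
size nil     = 1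
size (l ∙ r) = suc (size l + size r)

hdᵗ tlᵗ : Tree → Tree
hdᵗ nil     = nil
hdᵗ (l ∙ _) = l
tlᵗ nil     = nil
tlᵗ (_ ∙ r) = r

-- k is the number of program variables.
data Expr (k : ℕ) : Set where
  var   : Fin k → Expr k
  nil   : Expr k
  cons  : Expr k → Expr k → Expr k
  hd tl : Expr k → Expr k

infix  6 _:=_
infixr 5 _⨾_

data Cmd (k : ℕ) : Set where
  _:=_  : Fin k → Expr k → Cmd k
  _⨾_   : Cmd k → Cmd k → Cmd k
  ifᶜ   : Expr k → Cmd k → Cmd k → Cmd k
  while : Expr k → Cmd k → Cmd k

Store : ℕ → Set
Store k = Vec Tree k

eval : ∀ {k} → Expr k → Store k → Tree
eval (var x)    σ = lookup σ x
eval nil        σ = nil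
eval (cons e f) σ = eval e σ ∙ eval f σ
eval (hd e)     σ = hdᵗ (eval e σ)
eval (tl e)     σ = tlᵗ (eval e σ)

evalTime : ∀ {k} → Expr k → ℕ
evalTime (var _)    = 1
evalTime nil        = 1
evalTime (cons e f) = suc (evalTime e + evalTime f)
evalTime (hd e)     = suc (evalTime e)
evalTime (tl e)     = suc (evalTime e)

infix 4 ⟨_,_⟩⇓_inTime_

-- ⟨ C , σ ⟩⇓ σ′ inTime τ: started in store σ, C halts in store σ′ after
-- exactly τ time units.  Tests succeed on every tree other than nil.
data ⟨_,_⟩⇓_inTime_ {k : ℕ} : Cmd k → Store k → Store k → ℕ → Set where
  assign : ∀ {x e σ} →
    ⟨ x := e , σ ⟩⇓ (σ [ x ]≔ eval e σ) inTime suc (evalTime e)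
  seq : ∀ {C D σ σ′ σ″ τ υ} →
    ⟨ C , σ ⟩⇓ σ′ inTime τ → ⟨ D , σ′ ⟩⇓ σ″ inTime υ →
    ⟨ C ⨾ D , σ ⟩⇓ σ″ inTime (τ + υ)
  if-true : ∀ {e C D σ σ′ τ} → eval e σ ≢ nil →
    ⟨ C , σ ⟩⇓ σ′ inTime τ →
    ⟨ ifᶜ e C D , σ ⟩⇓ σ′ inTime (suc (evalTime e) + τ)
  if-false : ∀ {e C D σ σ′ τ} → eval e σ ≡ nil →
    ⟨ D , σ ⟩⇓ σ′ inTime τ →
    ⟨ ifᶜ e C D , σ ⟩⇓ σ′ inTime (suc (evalTime e) + τ)
  while-true : ∀ {e C σ σ′ σ″ τ υ} → eval e σ ≢ nil →
    ⟨ C , σ ⟩⇓ σ′ inTime τ → ⟨ while e C , σ′ ⟩⇓ σ″ inTime υ →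
    ⟨ while e C , σ ⟩⇓ σ″ inTime (suc (evalTime e) + (τ + υ))
  while-false : ∀ {e C σ} → eval e σ ≡ nil →
    ⟨ while e C , σ ⟩⇓ σ inTime suc (evalTime e)

-- Variable 0 carries the input and the output; all others start as nil.
record Program : Set where
  field
    {extraVars} : ℕ
    body        : Cmd (suc extraVars)

Runs : Program → Tree → Tree → ℕ → Set
Runs P input output τ =
  ∃[ σ ] ⟨ body , input ∷ᵛ replicateᵛ extraVars nil ⟩⇓ σ inTime τ
       × lookup σ zero ≡ output
  where open Program P

-- Polynomials with coefficients in ℕ, constant term first.
Polynomial : Set
Polynomial = List ℕ

evalPoly : Polynomial → ℕ → ℕ
evalPoly p n = foldr (λ a r → a + n * r) 0 p

encodeBool : Bool → Tree
encodeBool false = nil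
encodeBool true  = nil ∙ nil

record DecisionProblem : Set₁ where
  field
    Input  : Set
    encode : Input → Tree
    Yes    : Input → Set

_restrictedTo_ : (Π : DecisionProblem) → (DecisionProblem.Input Π → Set) → DecisionProblem
Π restrictedTo Q = record
  { Input  = Σ Input Q
  ; encode = λ x → encode (proj₁ x)
  ; Yes    = λ x → Yes (proj₁ x)
  }
  where open DecisionProblem Π

SolvableInPolynomialTime : DecisionProblem → Set
SolvableInPolynomialTime Π =
  Σ[ P ∈ Program ] Σ[ p ∈ Polynomial ] ((x : Input) →
    Σ[ b ∈ Bool ] Σ[ τ ∈ ℕ ]
      Runs P (encode x) (encodeBool b) τ
      × τ ≤ℕ evalPoly p (size (encode x))
      × Reflects (Yes x) b)
  where open DecisionProblem Π

record Digraph : Set where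
  field
    #V #E       : ℕ
    source      : Fin #E → Fin #V
    target      : Fin #E → Fin #V
    noLoops     : ∀ e → source e ≢ target e
    noParallels : ∀ e e′ → source e ≡ source e′ → target e ≡ target e′ → e ≡ e′

  V E : Set
  V = Fin #V
  E = Fin #E

  data IsWalk : V → List E → V → Set where
    stop : ∀ {u} → IsWalk u [] u
    step : ∀ {e es v} → IsWalk (target e) es v → IsWalk (source e) (e ∷ es) v

  -- Z is the edge set of a simple path from u to v; the path visits the
  -- vertices u ∷ map target es.
  IsPath : V → V → Subset #E → Set
  IsPath u v Z = ∃[ es ] IsWalk u es v
                       × Unique (u ∷ map target es)
                       × (∀ e → e ∈ₛ Z ⇔ e ∈ es)

  Acyclic : Set
  Acyclic = ∀ v es → IsWalk v es v → es ≡ []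

-- Weights are rational, so that an instance has a finite encoding.
record Instance : Set where
  field
    graph : Digraph
  open Digraph graph public
  field
    Eˡ  : Subset #E
    s t : V
    c d : E → ℚ
    c≥0 : ∀ e → 0ℚ ≤ c e
    d≥0 : ∀ e → 0ℚ ≤ d e
    hasPath : ∃[ Z ] IsPath s t Z

  Eᶠ : Subset #E
  Eᶠ = ∁ Eˡ

  weight : (E → ℚ) → Subset #E → ℚ
  weight f Z = sum (λ e → if lookup Z e then f e else 0ℚ)

  FollowerFeasible : Subset #E → Subset #E → Set
  FollowerFeasible X Y = Y ⊆ Eᶠ × IsPath s t (X ∪ Y)

  FollowerOptimal : Subset #E → Subset #E → Set
  FollowerOptimal X Y = FollowerFeasible X Y
                      × (∀ Y′ → FollowerFeasible X Y′ → weight d Y ≤ weight d Y′)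

  Feasible : Subset #E → Subset #E → Set
  Feasible X Y = X ⊆ Eˡ × FollowerOptimal X Y

  -- v = OPT_str; minimizing over X and Y jointly is the optimistic setting.
  IsOPTstr : ℚ → Set
  IsOPTstr v = (∃₂ λ X Y → Feasible X Y × weight c (X ∪ Y) ≡ v)
             × (∀ X Y → Feasible X Y → v ≤ weight c (X ∪ Y))

record Threshold : Set where
  field
    value : ℚ
    value≥0 : 0ℚ ≤ value

encodeList : ∀ {A : Set} → (A → Tree) → List A → Tree
encodeList enc = foldr (λ a r → enc a ∙ r) nil

-- Vertices are numbered in unary.  The number of vertices is itself part
-- of the input in unary, so this affects lengths only polynomially.
encodeUnary : ℕ → Tree
encodeUnary 0       = nil
encodeUnary (suc n) = nil ∙ encodeUnary n

encodeVertex : ∀ {n} → Fin n → Tree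
encodeVertex v = encodeUnary (toℕ v)

encodeBit : Bit → Tree
encodeBit zero = nil
encodeBit _    = nil ∙ nil

-- Binary, least significant bit first.
encodeBinary : ℕ → Tree
encodeBinary n = encodeList encodeBit (proj₁ (toDigits 2 n))

-- Numerator and denominator in lowest terms; only used for q ≥ 0, so no
-- sign is recorded.
encodeℚ≥0 : ℚ → Tree
encodeℚ≥0 q = encodeBinary ∣ ↥ q ∣ ∙ encodeBinary (↧ₙ q)

encodeInstance : Instance → Tree
encodeInstance I =
  encodeUnary #V ∙ encodeList encodeEdge (allFin #E) ∙ encodeVertex s ∙ encodeVertex t
  where
  open Instance I
  encodeEdge : E → Tree
  encodeEdge e = encodeVertex (source e) ∙ encodeVertex (target e)
               ∙ encodeBool (lookup Eˡ e) ∙ encodeℚ≥0 (c e) ∙ encodeℚ≥0 (d e)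

BSP-Strong-Dir : DecisionProblem
BSP-Strong-Dir = record
  { Input  = Instance × Threshold
  ; encode = λ (I , T) → encodeInstance I ∙ encodeℚ≥0 (Threshold.value T)
  ; Yes    = λ (I , T) → ∃[ v ] Instance.IsOPTstr I v × v ≤ Threshold.value T
  }

OnDAG : DecisionProblem.Input BSP-Strong-Dir → Set
OnDAG (I , _) = Instance.Acyclic I

{-# OPTIONS --safe #-}

module Submission where

-- In an acyclic digraph the edges of a walk come in a fixed order and every walk
-- is simple.  Hence the leader's edges X determine the endpoints of all follower
-- segments of an s-t-path through X, and a response is optimal if and only if each
-- of its segments is d-shortest; in the optimistic setting the segments may be
-- taken lexicographically shortest for (d , c).  So OPT is the length of a shortest
-- path in the graph whose arcs consist of a lexicographically shortest follower
-- segment and a leader edge, followed by one last segment.  Both kinds of shortest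
-- paths are found by Bellman–Ford, as the number of rounds is bounded by #E.
--
-- After scaling to a common denominator all weights are natural numbers, and all
-- labels are sums of polynomially many of them.  The running time is polynomial
-- because the functions computed in polynomial time by WHILE programs are closed
-- under composition, pairing, branching, and folding over lists as long as the
-- accumulator keeps a polynomially bounded size.

open import Defs

open import Data.Bool.Base using (Bool; true; false; if_then_else_; not; _∨_)
open import Data.Digit using (Bit; fromDigits; toDigits)
open import Data.Fin.Base using (Fin; zero; suc; punchIn; toℕ)
import Data.Fin.Properties as Fin
open import Data.Fin.Subset using (Subset; _∩_; _∪_) renaming (_∈_ to _∈ₛ_; _∉_ to _∉ₛ_)
open import Data.Fin.Subset.Properties using (_∈?_; x∈p∪q⁺; x∈p∪q⁻; x∈p∩q⁺; x∈p∩q⁻; x∈∁p⇒x∉p; x∉p⇒x∈∁p)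
import Data.Integer.Base as ℤ
import Data.Integer.Properties as ℤ
import Data.Integer.Tactic.RingSolver as ℤ
open import Data.List.Base using (List; []; _∷_; _++_; map; foldr; foldl; filter; length; allFin; _ʳ++_)
import Data.List.Base as List
import Data.List.Membership.DecPropositional as DecMembership
open import Data.List.Membership.Propositional using (_∈_)
open import Data.List.Membership.Propositional.Properties using (∈-filter⁺; ∈-filter⁻; ∈-map⁺; ∈-map⁻; ∈-allFin; ∈-lookup)
open import Data.List.Properties using (∷-injective; ∷-injectiveˡ; ∷-injectiveʳ; ++-assoc; ++-identityʳ; filter-++; filter-accept; filter-reject; length-++; length-map; length-replicate; length-tabulate)
open import Data.List.Relation.Unary.All as All using (All; []; _∷_)
open import Data.List.Relation.Unary.AllPairs as AllPairs using (AllPairs; []; _∷_)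
import Data.List.Relation.Unary.AllPairs.Properties as AllPairs
open import Data.List.Relation.Unary.Any using (here; there)
open import Data.List.Relation.Unary.Unique.Propositional using (Unique)
open import Data.Nat.Base using (ℕ; zero; suc; _+_; _*_; _∸_; _≤_; _<_; z≤n; s≤s; pred; >-nonZero)
open import Data.Nat.Properties
open import Data.Nat.Tactic.RingSolver using (solve-∀)
open import Data.Product.Base using (∃-syntax; _×_; _,_; proj₁; proj₂)
open import Data.Rational.Base as ℚ using (ℚ; 0ℚ)
import Data.Rational.Properties as ℚ
open import Data.Rational.Unnormalised.Base as ℚᵘ using (mkℚᵘ; *≡*)
import Data.Rational.Unnormalised.Properties as ℚᵘ
open import Data.Sum.Base using (_⊎_; inj₁; inj₂; [_,_]; map₂)
open import Data.Unit.Base using (⊤; tt)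
open import Data.Vec.Base using (lookup; tabulate) renaming ([] to []ᵛ; _∷_ to _∷ᵛ_)
open import Data.Vec.Properties using ([]=⇒lookup; lookup⇒[]=; lookup-zipWith; lookup∘tabulate)
open import Function.Base using (_∘_; id)
open import Function.Bundles using (Equivalence; mk⇔)
open import Relation.Binary.PropositionalEquality hiding ([_])
open import Relation.Nullary.Decidable using (Dec; yes; no; does; dec-true)
open import Relation.Nullary.Reflects using (Reflects; ofʸ; ofⁿ)
open import Relation.Nullary.Negation using (¬_; contradiction)

open import Algebra.Properties.CommutativeMonoid.Sum ℚ.+-0-commutativeMonoid
  using (sum; sum-remove; ∑-distrib-+; sum-cong-≗; sum-replicate-zero)

-- Functions computed in polynomial time are not closed under iteration: a step may double its
-- accumulator. Every fold therefore needs its own size bound, and this shapes the algorithm.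
-- Bellman-Ford tables are rebuilt in each round with at most one entry per arc besides that of the
-- start, a label only ever grows by the weight of one fixed arc, and multiplication works in a
-- window of fixed width.
--
-- Both kinds of shortest paths come from one procedure on pairs of weights. Composite arcs get
-- first weight 0, which reduces the lexicographic order to the leader's cost.
--
-- A competing response agrees with a given path only in its set of leader edges. The exchange of
-- segments needs the same sequence of leader edges, and this is where their fixed order is used.
--
-- A yes-instance must have an optimum, not merely a cheap feasible pair. After scaling, costs are
-- natural numbers, and the algorithm itself decides for each `n` whether a cost of at most `n` is
-- attainable; the least such `n` yields the optimum.

-- Polynomial bounds

data Poly : Set where
  con     : ℕ → Poly
  𝕏       : Poly
  _⊕_ _⊛_ : Poly → Poly → Poly
  _⊚_     : Poly → Poly → Poly

infixl 6 _⊕_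
infixl 7 _⊛_
infixr 8 _⊚_
infix  9 _at_

-- Bounds are kept as expressions, so that the bound of a composed program unfolds by computation to
-- the composed bounds. Coefficients are extracted only once, for the final program.
_at_ : Poly → ℕ → ℕ
con k   at n = k
𝕏       at n = n
(p ⊕ q) at n = p at n + q at n
(p ⊛ q) at n = p at n * q at n
(p ⊚ q) at n = p at (q at n)

at-mono : ∀ p {m n} → m ≤ n → p at m ≤ p at n
at-mono (con k) m≤n = ≤-refl
at-mono 𝕏       m≤n = m≤n
at-mono (p ⊕ q) m≤n = +-mono-≤ (at-mono p m≤n) (at-mono q m≤n)
at-mono (p ⊛ q) m≤n = *-mono-≤ (at-mono p m≤n) (at-mono q m≤n)
at-mono (p ⊚ q) m≤n = at-mono p (at-mono q m≤n)

addᴾ mulᴾ compᴾ : Polynomial → Polynomial → Polynomial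
addᴾ []      q       = q
addᴾ (a ∷ p) []      = a ∷ p
addᴾ (a ∷ p) (b ∷ q) = a + b ∷ addᴾ p q
mulᴾ []      q = []
mulᴾ (a ∷ p) q = addᴾ (map (a *_) q) (0 ∷ mulᴾ p q)
compᴾ []      q = []
compᴾ (a ∷ p) q = addᴾ (a ∷ []) (mulᴾ q (compᴾ p q))

evalPoly-add : ∀ p q n → evalPoly (addᴾ p q) n ≡ evalPoly p n + evalPoly q n
evalPoly-add []      q       n = refl
evalPoly-add (a ∷ p) []      n = sym (+-identityʳ _)
evalPoly-add (a ∷ p) (b ∷ q) n rewrite evalPoly-add p q n =
  lemma a b n (evalPoly p n) (evalPoly q n)
  where
  lemma : ∀ a b n x y → a + b + n * (x + y) ≡ a + n * x + (b + n * y)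
  lemma = solve-∀

evalPoly-scale : ∀ a q n → evalPoly (map (a *_) q) n ≡ a * evalPoly q n
evalPoly-scale a []      n = sym (*-zeroʳ a)
evalPoly-scale a (b ∷ q) n rewrite evalPoly-scale a q n = lemma a b n (evalPoly q n)
  where
  lemma : ∀ a b n x → a * b + n * (a * x) ≡ a * (b + n * x)
  lemma = solve-∀

evalPoly-mul : ∀ p q n → evalPoly (mulᴾ p q) n ≡ evalPoly p n * evalPoly q n
evalPoly-mul []      q n = refl
evalPoly-mul (a ∷ p) q n
  rewrite evalPoly-add (map (a *_) q) (0 ∷ mulᴾ p q) n
        | evalPoly-scale a q n | evalPoly-mul p q n
  = lemma a n (evalPoly p n) (evalPoly q n)
  where
  lemma : ∀ a n x y → a * y + n * (x * y) ≡ (a + n * x) * y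
  lemma = solve-∀

evalPoly-comp : ∀ p q n → evalPoly (compᴾ p q) n ≡ evalPoly p (evalPoly q n)
evalPoly-comp []      q n = refl
evalPoly-comp (a ∷ p) q n
  rewrite evalPoly-add (a ∷ []) (mulᴾ q (compᴾ p q)) n
        | evalPoly-mul q (compᴾ p q) n | evalPoly-comp p q n
        | *-zeroʳ n | +-identityʳ a = refl

coefficients : Poly → Polynomial
coefficients (con k) = k ∷ []
coefficients 𝕏       = 0 ∷ 1 ∷ []
coefficients (p ⊕ q) = addᴾ (coefficients p) (coefficients q)
coefficients (p ⊛ q) = mulᴾ (coefficients p) (coefficients q)
coefficients (p ⊚ q) = compᴾ (coefficients p) (coefficients q)

evalPoly-coefficients : ∀ p n → evalPoly (coefficients p) n ≡ p at n
evalPoly-coefficients (con k) n = lemma k n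
  where
  lemma : ∀ k n → k + n * 0 ≡ k
  lemma = solve-∀
evalPoly-coefficients 𝕏 n = lemma n
  where
  lemma : ∀ n → 0 + n * (1 + n * 0) ≡ n
  lemma = solve-∀
evalPoly-coefficients (p ⊕ q) n
  rewrite evalPoly-add (coefficients p) (coefficients q) n
        | evalPoly-coefficients p n | evalPoly-coefficients q n = refl
evalPoly-coefficients (p ⊛ q) n
  rewrite evalPoly-mul (coefficients p) (coefficients q) n
        | evalPoly-coefficients p n | evalPoly-coefficients q n = refl
evalPoly-coefficients (p ⊚ q) n
  rewrite evalPoly-comp (coefficients p) (coefficients q) n
        | evalPoly-coefficients q n | evalPoly-coefficients p (q at n) = refl

-- Programs with a single variable suffice, since a tree can hold a whole store.

x₀ : Expr 1
x₀ = var zero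

⟦_⟧ᴱ : Expr 1 → Tree → Tree
⟦ e ⟧ᴱ x = eval e (x ∷ᵛ []ᵛ)

infix 4 ⟨_⟩_↦_within_

⟨_⟩_↦_within_ : Cmd 1 → Tree → Tree → ℕ → Set
⟨ C ⟩ x ↦ y within n =
  ∃[ τ ] ⟨ C , x ∷ᵛ []ᵛ ⟩⇓ (y ∷ᵛ []ᵛ) inTime τ × τ ≤ n

weaken : ∀ {C x y m n} → m ≤ n → ⟨ C ⟩ x ↦ y within m → ⟨ C ⟩ x ↦ y within n
weaken m≤n (τ , run , τ≤m) = τ , run , ≤-trans τ≤m m≤n

set : Expr 1 → Cmd 1
set e = zero := e

set-runs : ∀ e {x} → ⟨ set e ⟩ x ↦ ⟦ e ⟧ᴱ x within suc (evalTime e)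
set-runs e = _ , assign , ≤-refl

⨾-runs : ∀ {C D x y z m n} → ⟨ C ⟩ x ↦ y within m → ⟨ D ⟩ y ↦ z within n →
         ⟨ C ⨾ D ⟩ x ↦ z within m + n
⨾-runs (_ , run , τ≤m) (_ , run′ , υ≤n) = _ , seq run run′ , +-mono-≤ τ≤m υ≤n

if-true-runs : ∀ {e C D x y n} → ⟦ e ⟧ᴱ x ≢ nil → ⟨ C ⟩ x ↦ y within n →
               ⟨ ifᶜ e C D ⟩ x ↦ y within suc (evalTime e) + n
if-true-runs {e} ≢nil (_ , run , τ≤n) = _ , if-true ≢nil run , +-monoʳ-≤ (suc (evalTime e)) τ≤n

if-false-runs : ∀ {e C D x y n} → ⟦ e ⟧ᴱ x ≡ nil → ⟨ D ⟩ x ↦ y within n →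
                ⟨ ifᶜ e C D ⟩ x ↦ y within suc (evalTime e) + n
if-false-runs {e} ≡nil (_ , run , τ≤n) = _ , if-false ≡nil run , +-monoʳ-≤ (suc (evalTime e)) τ≤n

while-true-runs : ∀ {e C x y z m n} → ⟦ e ⟧ᴱ x ≢ nil → ⟨ C ⟩ x ↦ y within m →
                  ⟨ while e C ⟩ y ↦ z within n →
                  ⟨ while e C ⟩ x ↦ z within suc (evalTime e) + (m + n)
while-true-runs {e} ≢nil (_ , run , τ≤m) (_ , run′ , υ≤n) =
  _ , while-true ≢nil run run′ , +-monoʳ-≤ (suc (evalTime e)) (+-mono-≤ τ≤m υ≤n)

while-false-runs : ∀ {e C x} → ⟦ e ⟧ᴱ x ≡ nil →
                   ⟨ while e C ⟩ x ↦ x within suc (evalTime e)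
while-false-runs ≡nil = _ , while-false ≡nil , ≤-refl

atHdᴱ : Expr 1 → Expr 1
atHdᴱ (var x)    = hd (var x)
atHdᴱ nil        = nil
atHdᴱ (cons e f) = cons (atHdᴱ e) (atHdᴱ f)
atHdᴱ (hd e)     = hd (atHdᴱ e)
atHdᴱ (tl e)     = tl (atHdᴱ e)

-- Runs a command on the head of the variable and keeps the tail.
atHd : Cmd 1 → Cmd 1
atHd (x := e)    = x := cons (atHdᴱ e) (tl (var x))
atHd (C ⨾ D)     = atHd C ⨾ atHd D
atHd (ifᶜ e C D) = ifᶜ (atHdᴱ e) (atHd C) (atHd D)
atHd (while e C) = while (atHdᴱ e) (atHd C)

_⊳_ : Store 1 → Tree → Store 1
(x ∷ᵛ []ᵛ) ⊳ r = (x ∙ r) ∷ᵛ []ᵛ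

eval-atHd : ∀ e σ r → eval (atHdᴱ e) (σ ⊳ r) ≡ eval e σ
eval-atHd (var zero) (x ∷ᵛ []ᵛ) r = refl
eval-atHd nil        σ r = refl
eval-atHd (cons e f) σ r = cong₂ _∙_ (eval-atHd e σ r) (eval-atHd f σ r)
eval-atHd (hd e)     σ r = cong hdᵗ (eval-atHd e σ r)
eval-atHd (tl e)     σ r = cong tlᵗ (eval-atHd e σ r)

evalTime-atHd : ∀ e → evalTime (atHdᴱ e) ≤ 2 * evalTime e
evalTime-atHd (var x) = ≤-refl
evalTime-atHd nil     = s≤s z≤n
evalTime-atHd (cons e f) = begin
  suc (evalTime (atHdᴱ e) + evalTime (atHdᴱ f))
    ≤⟨ s≤s (+-mono-≤ (evalTime-atHd e) (evalTime-atHd f)) ⟩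
  suc (2 * evalTime e + 2 * evalTime f)
    ≤⟨ n≤1+n _ ⟩
  2 + (2 * evalTime e + 2 * evalTime f)
    ≡⟨ lemma (evalTime e) (evalTime f) ⟩
  2 * suc (evalTime e + evalTime f) ∎
  where
  open ≤-Reasoning
  lemma : ∀ m n → 2 + (2 * m + 2 * n) ≡ 2 * suc (m + n)
  lemma = solve-∀
evalTime-atHd (hd e) = begin
  suc (evalTime (atHdᴱ e)) ≤⟨ s≤s (evalTime-atHd e) ⟩
  suc (2 * evalTime e)     ≤⟨ n≤1+n _ ⟩
  2 + 2 * evalTime e       ≡⟨ *-suc 2 (evalTime e) ⟨
  2 * suc (evalTime e)     ∎
  where open ≤-Reasoning
evalTime-atHd (tl e) = begin
  suc (evalTime (atHdᴱ e)) ≤⟨ s≤s (evalTime-atHd e) ⟩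
  suc (2 * evalTime e)     ≤⟨ n≤1+n _ ⟩
  2 + 2 * evalTime e       ≡⟨ *-suc 2 (evalTime e) ⟨
  2 * suc (evalTime e)     ∎
  where open ≤-Reasoning

test-atHd : ∀ e → suc (evalTime (atHdᴱ e)) ≤ 4 * suc (evalTime e)
test-atHd e = begin
  suc (evalTime (atHdᴱ e)) ≤⟨ s≤s (evalTime-atHd e) ⟩
  suc (2 * evalTime e)     ≤⟨ n≤1+n _ ⟩
  2 + 2 * evalTime e       ≡⟨ *-suc 2 (evalTime e) ⟨
  2 * suc (evalTime e)     ≤⟨ *-monoˡ-≤ (suc (evalTime e)) {2} {4} (s≤s (s≤s z≤n)) ⟩
  4 * suc (evalTime e)     ∎
  where open ≤-Reasoning

-- Each access to the variable becomes an access to its head, which at most doubles the time of an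
-- expression. The remaining part of the factor 4 pays for rebuilding the pair in an assignment.
atHd-sim : ∀ {C σ σ′ τ} r → ⟨ C , σ ⟩⇓ σ′ inTime τ →
           ∃[ τ′ ] ⟨ atHd C , σ ⊳ r ⟩⇓ (σ′ ⊳ r) inTime τ′ × τ′ ≤ 4 * τ
atHd-sim r (assign {zero} {e} {x ∷ᵛ []ᵛ}) =
  _ , subst (λ y → ⟨ _ , _ ⟩⇓ ((y ∙ r) ∷ᵛ []ᵛ) inTime _) (eval-atHd e (x ∷ᵛ []ᵛ) r) assign , bound
  where
  open ≤-Reasoning
  lemma : ∀ n → suc (suc (2 * n + 2)) ≡ 4 + 2 * n
  lemma = solve-∀
  bound : suc (suc (evalTime (atHdᴱ e) + 2)) ≤ 4 * suc (evalTime e)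
  bound = begin
    suc (suc (evalTime (atHdᴱ e) + 2)) ≤⟨ s≤s (s≤s (+-monoˡ-≤ 2 (evalTime-atHd e))) ⟩
    suc (suc (2 * evalTime e + 2))     ≡⟨ lemma (evalTime e) ⟩
    4 + 2 * evalTime e                 ≤⟨ +-monoʳ-≤ 4 (*-monoˡ-≤ (evalTime e) {2} {4} (s≤s (s≤s z≤n))) ⟩
    4 + 4 * evalTime e                 ≡⟨ *-suc 4 (evalTime e) ⟨
    4 * suc (evalTime e)               ∎
atHd-sim r (seq {τ = τ} {υ} run run′) with atHd-sim r run | atHd-sim r run′
... | _ , sim , τ≤ | _ , sim′ , υ≤ =
  _ , seq sim sim′ , ≤-trans (+-mono-≤ τ≤ υ≤) (≤-reflexive (sym (*-distribˡ-+ 4 τ υ)))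
atHd-sim {σ = σ} r (if-true {e} {τ = τ} ≢nil run) with atHd-sim r run
... | _ , sim , τ≤ =
  _ , if-true (≢nil ∘ trans (sym (eval-atHd e σ r))) sim
    , ≤-trans (+-mono-≤ (test-atHd e) τ≤) (≤-reflexive (sym (*-distribˡ-+ 4 (suc (evalTime e)) τ)))
atHd-sim {σ = σ} r (if-false {e} {τ = τ} ≡nil run) with atHd-sim r run
... | _ , sim , τ≤ =
  _ , if-false (trans (eval-atHd e σ r) ≡nil) sim
    , ≤-trans (+-mono-≤ (test-atHd e) τ≤) (≤-reflexive (sym (*-distribˡ-+ 4 (suc (evalTime e)) τ)))
atHd-sim {σ = σ} r (while-true {e} {τ = τ} {υ} ≢nil run run′) with atHd-sim r run | atHd-sim r run′
... | _ , sim , τ≤ | _ , sim′ , υ≤ =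
  _ , while-true (≢nil ∘ trans (sym (eval-atHd e σ r))) sim sim′
    , ≤-trans (+-mono-≤ (test-atHd e) (+-mono-≤ τ≤ υ≤)) (≤-reflexive (lemma (suc (evalTime e)) τ υ))
  where
  lemma : ∀ l m n → 4 * l + (4 * m + 4 * n) ≡ 4 * (l + (m + n))
  lemma = solve-∀
atHd-sim {σ = σ} r (while-false {e} ≡nil) =
  _ , while-false (trans (eval-atHd e σ r) ≡nil) , test-atHd e

atHd-runs : ∀ {C x y n} r → ⟨ C ⟩ x ↦ y within n → ⟨ atHd C ⟩ x ∙ r ↦ y ∙ r within 4 * n
atHd-runs r (_ , run , τ≤n) with atHd-sim r run
... | _ , sim , ≤4τ = _ , sim , ≤-trans ≤4τ (*-monoʳ-≤ 4 τ≤n)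

-- Encoded data types and functions computed in polynomial time

infixr 6 _⊗_

data Ty : Set where
  unit bool : Ty
  _⊗_       : Ty → Ty → Ty
  list      : Ty → Ty

⟦_⟧ : Ty → Set
⟦ unit ⟧   = ⊤
⟦ bool ⟧   = Bool
⟦ a ⊗ b ⟧  = ⟦ a ⟧ × ⟦ b ⟧
⟦ list a ⟧ = List ⟦ a ⟧

enc : ∀ a → ⟦ a ⟧ → Tree
enc unit     _       = nil
enc bool     b       = encodeBool b
enc (a ⊗ b)  (x , y) = enc a x ∙ enc b y
enc (list a) xs      = encodeList (enc a) xs

∥_∥ : ∀ {a} → ⟦ a ⟧ → ℕ
∥_∥ {a} x = size (enc a x)

size>0 : ∀ t → 0 < size t
size>0 nil     = s≤s z≤n
size>0 (_ ∙ _) = s≤s z≤n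

size-bool≤3 : ∀ b → size (encodeBool b) ≤ 3
size-bool≤3 false = s≤s z≤n
size-bool≤3 true  = ≤-refl

length≤size : ∀ {a} (xs : List ⟦ a ⟧) → length xs ≤ ∥_∥ {list a} xs
length≤size []       = z≤n
length≤size (x ∷ xs) = s≤s (≤-trans (length≤size xs) (m≤n+m _ _))

-- The output size needs a bound of its own: `cons x₀ x₀` doubles a tree at constant cost, so a
-- polynomial `time` does not entail a polynomial `room`. Composition needs `room` because the
-- second program runs on the output of the first.
record PolyTime (a b : Ty) (f : ⟦ a ⟧ → ⟦ b ⟧) : Set where
  field
    code      : Cmd 1
    time room : Poly
    runs      : ∀ x → ⟨ code ⟩ enc a x ↦ enc b (f x) within time at size (enc a x)
    fits      : ∀ x → size (enc b (f x)) ≤ room at size (enc a x)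

open PolyTime

byExpr : ∀ {a b f} e → (∀ x → ⟦ e ⟧ᴱ (enc a x) ≡ enc b (f x)) →
         ∀ q → (∀ x → size (enc b (f x)) ≤ q at size (enc a x)) → PolyTime a b f
byExpr {a} e eq q fit = record
  { code = set e ; time = con (suc (evalTime e)) ; room = q
  ; runs = λ x → subst (λ y → ⟨ set e ⟩ enc a x ↦ y within _) (eq x) (set-runs e)
  ; fits = fit
  }

fstP : ∀ {a b} → PolyTime (a ⊗ b) a proj₁
fstP = byExpr (hd x₀) (λ _ → refl) 𝕏 (λ _ → ≤-trans (m≤m+n _ _) (n≤1+n _))

sndP : ∀ {a b} → PolyTime (a ⊗ b) b proj₂
sndP = byExpr (tl x₀) (λ _ → refl) 𝕏 (λ _ → ≤-trans (m≤n+m _ _) (n≤1+n _))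

ttP : ∀ {a} → PolyTime a unit (λ _ → tt)
ttP = byExpr nil (λ _ → refl) (con 1) (λ _ → ≤-refl)

falseP : ∀ {a} → PolyTime a bool (λ _ → false)
falseP = byExpr nil (λ _ → refl) (con 1) (λ _ → ≤-refl)

trueP : ∀ {a} → PolyTime a bool (λ _ → true)
trueP = byExpr (cons nil nil) (λ _ → refl) (con 3) (λ _ → ≤-refl)

[]P : ∀ {a b} → PolyTime a (list b) (λ _ → [])
[]P = byExpr nil (λ _ → refl) (con 1) (λ _ → ≤-refl)

-- The default matches `hdᵗ nil = nil`, the encoding of `false`. It also pads a binary number with
-- zeros beyond its most significant bit.
headBit : List Bool → Bool
headBit []      = false
headBit (b ∷ _) = b

headBitP : PolyTime (list bool) bool headBit
headBitP = byExpr (hd x₀) eq 𝕏 fit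
  where
  eq : ∀ bs → hdᵗ (enc (list bool) bs) ≡ encodeBool (headBit bs)
  eq []      = refl
  eq (_ ∷ _) = refl
  fit : ∀ bs → size (encodeBool (headBit bs)) ≤ size (enc (list bool) bs)
  fit []      = ≤-refl
  fit (_ ∷ _) = ≤-trans (m≤m+n _ _) (n≤1+n _)

tail′ : ∀ {A : Set} → List A → List A
tail′ []       = []
tail′ (_ ∷ xs) = xs

tailP : ∀ {a} → PolyTime (list a) (list a) tail′
tailP {a} = byExpr (tl x₀) eq 𝕏 fit
  where
  eq : ∀ xs → tlᵗ (enc (list a) xs) ≡ enc (list a) (tail′ xs)
  eq []      = refl
  eq (_ ∷ _) = refl
  fit : ∀ xs → size (enc (list a) (tail′ xs)) ≤ size (enc (list a) xs)
  fit []      = ≤-refl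
  fit (_ ∷ _) = ≤-trans (m≤n+m _ _) (n≤1+n _)

nonempty : ∀ {A : Set} → List A → Bool
nonempty []      = false
nonempty (_ ∷ _) = true

nonemptyP : ∀ {a} → PolyTime (list a) bool nonempty
nonemptyP {a} = record
  { code = ifᶜ x₀ (set (cons nil nil)) (set nil)
  ; time = con 6 ; room = con 3 ; runs = run ; fits = fit
  }
  where
  run : ∀ xs → ⟨ _ ⟩ enc (list a) xs ↦ encodeBool (nonempty xs) within 6
  run []      = weaken (s≤s (s≤s (s≤s (s≤s z≤n)))) (if-false-runs {e = x₀} refl (set-runs nil))
  run (_ ∷ _) = if-true-runs {e = x₀} (λ ()) (set-runs (cons nil nil))
  fit : ∀ (xs : List ⟦ a ⟧) → size (encodeBool (nonempty xs)) ≤ 3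
  fit []      = s≤s z≤n
  fit (_ ∷ _) = ≤-refl

-- Composition, pairing and branching

infixr 9 _∘P_

_∘P_ : ∀ {a b c f g} → PolyTime b c g → PolyTime a b f → PolyTime a c (λ x → g (f x))
_∘P_ {f = f} G F = record
  { code = code F ⨾ code G
  ; time = time F ⊕ time G ⊚ room F
  ; room = room G ⊚ room F
  ; runs = λ x → ⨾-runs (runs F x) (weaken (at-mono (time G) (fits F x)) (runs G (f x)))
  ; fits = λ x → ≤-trans (fits G (f x)) (at-mono (room G) (fits F x))
  }

⟨_,_⟩P : ∀ {a b c f g} → PolyTime a b f → PolyTime a c g → PolyTime a (b ⊗ c) (λ x → f x , g x)
⟨_,_⟩P {a} {f = f} {g} F G = record
  -- The variable holds in turn `x ∙ x`, `f x ∙ x`, `x ∙ f x`, `g x ∙ f x` and `f x ∙ g x`.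
  { code = set (cons x₀ x₀) ⨾ atHd (code F) ⨾ set swap ⨾ atHd (code G) ⨾ set swap
  ; time = con 4 ⊕ (con 4 ⊛ time F ⊕ (con 6 ⊕ (con 4 ⊛ time G ⊕ con 6)))
  ; room = con 1 ⊕ (room F ⊕ room G)
  ; runs = λ x → ⨾-runs (set-runs (cons x₀ x₀)) (⨾-runs (atHd-runs _ (runs F x))
             (⨾-runs (set-runs swap) (⨾-runs (atHd-runs _ (runs G x)) (set-runs swap))))
  ; fits = λ x → s≤s (+-mono-≤ (fits F x) (fits G x))
  }
  where
  swap : Expr 1
  swap = cons (tl x₀) (hd x₀)

ifP : ∀ {a b p f g} → PolyTime a bool p → PolyTime a b f → PolyTime a b g →
      PolyTime a b (λ x → if p x then f x else g x)
ifP {a} {b} {p} {f} {g} P F G = record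
  { code = set (cons x₀ x₀) ⨾ atHd (code P) ⨾
           ifᶜ (hd x₀) (set (tl x₀) ⨾ code F) (set (tl x₀) ⨾ code G)
  ; time = con 4 ⊕ (con 4 ⊛ time P ⊕ (con 3 ⊕ (con 3 ⊕ (time F ⊕ time G))))
  ; room = room F ⊕ room G
  ; runs = λ x → ⨾-runs (set-runs (cons x₀ x₀)) (⨾-runs (atHd-runs _ (runs P x)) (branch x (p x)))
  ; fits = λ x → fit x (p x)
  }
  where
  branch : ∀ x c → ⟨ ifᶜ (hd x₀) (set (tl x₀) ⨾ code F) (set (tl x₀) ⨾ code G) ⟩
             encodeBool c ∙ enc a x ↦ enc b (if c then f x else g x) within
             3 + (3 + (time F at size (enc a x) + time G at size (enc a x)))
  branch x true  = if-true-runs {e = hd x₀} (λ ()) (⨾-runs (set-runs (tl x₀))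
                     (weaken (m≤m+n _ _) (runs F x)))
  branch x false = if-false-runs {e = hd x₀} refl (⨾-runs (set-runs (tl x₀))
                     (weaken (m≤n+m _ _) (runs G x)))
  fit : ∀ x c → size (enc b (if c then f x else g x)) ≤
                room F at size (enc a x) + room G at size (enc a x)
  fit x true  = ≤-trans (fits F x) (m≤m+n _ _)
  fit x false = ≤-trans (fits G x) (m≤n+m _ _)

infixr 5 _∷P_

_∷P_ : ∀ {a b f g} → PolyTime a b f → PolyTime a (list b) g →
       PolyTime a (list b) (λ x → f x ∷ g x)
_∷P_ {b = b} F G = consP ∘P ⟨ F , G ⟩P
  where
  consP : PolyTime (b ⊗ list b) (list b) (λ p → proj₁ p ∷ proj₂ p)
  consP = byExpr x₀ (λ _ → refl) 𝕏 (λ _ → ≤-refl)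

-- Folds with a bounded accumulator

-- The time of a loop depends on every accumulator that it meets, so a property of the final one
-- would not be enough.
data Along {A B : Set} (f : B → A → B) (P : B → Set) : B → List A → Set where
  []  : ∀ {acc} → P acc → Along f P acc []
  _∷_ : ∀ {acc x xs} → P acc → Along f P (f acc x) xs → Along f P acc (x ∷ xs)

along-last : ∀ {A B : Set} {f : B → A → B} {P acc xs} → Along f P acc xs → P (foldl f acc xs)
along-last ([] p)   = p
along-last (_ ∷ ps) = along-last ps

along-map : ∀ {A B : Set} {f : B → A → B} {P Q : B → Set} → (∀ {x} → P x → Q x) →
            ∀ {acc xs} → Along f P acc xs → Along f Q acc xs
along-map g ([] p)   = [] (g p)
along-map g (p ∷ ps) = g p ∷ along-map g ps

module Fold {Γ a b} {init : ⟦ Γ ⟧ → ⟦ b ⟧} {xs : ⟦ Γ ⟧ → List ⟦ a ⟧}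
            {step : ⟦ (Γ ⊗ b) ⊗ a ⟧ → ⟦ b ⟧}
            (I : PolyTime Γ b init) (L : PolyTime Γ (list a) xs)
            (S : PolyTime ((Γ ⊗ b) ⊗ a) b step) where

  f : ⟦ Γ ⟧ → ⟦ b ⟧ → ⟦ a ⟧ → ⟦ b ⟧
  f γ acc x = step ((γ , acc) , x)

  -- Between two passes the variable holds `ys ∙ acc ∙ γ`. From `(y ∙ ys) ∙ acc ∙ γ`, `load` makes
  -- `((γ ∙ acc) ∙ y) ∙ ys ∙ γ`, whose head is the argument of the step; `save` then restores the
  -- order.
  load save : Expr 1
  load = cons (cons (cons (tl (tl x₀)) (hd (tl x₀))) (hd (hd x₀))) (cons (tl (hd x₀)) (tl (tl x₀)))
  save = cons (hd (tl x₀)) (cons (hd x₀) (tl (tl x₀)))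

  body : Cmd 1
  body = set load ⨾ atHd (code S) ⨾ set save

  pass : ℕ → ℕ
  pass s = 3 + (suc (evalTime load) + (4 * (time S at s) + suc (evalTime save)))

  loop-runs : ∀ γ {l q} ys acc → size (enc (list a) ys) ≤ l →
              Along (f γ) (λ acc → size (enc b acc) ≤ q) acc ys →
              ⟨ while (hd x₀) body ⟩
                enc (list a) ys ∙ enc b acc ∙ enc Γ γ ↦
                nil ∙ enc b (foldl (f γ) acc ys) ∙ enc Γ γ
              within length ys * pass (2 + (size (enc Γ γ) + q + l)) + 3
  loop-runs γ [] acc _ _ = while-false-runs {e = hd x₀} refl
  loop-runs γ {l} {q} (y ∷ ys) acc ys≤l (acc≤q ∷ along) =
    weaken bound (while-true-runs {e = hd x₀} (λ p → cons≢nil p)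
      (⨾-runs (set-runs load)
        (⨾-runs (atHd-runs _ (weaken (at-mono (time S) fit) (runs S ((γ , acc) , y))))
          (set-runs save)))
      (loop-runs γ ys (f γ acc y) (≤-trans (≤-trans (m≤n+m _ _) (n≤1+n _)) ys≤l) along))
    where
    cons≢nil : enc (list a) (y ∷ ys) ≢ nil
    cons≢nil ()
    fit : size (enc ((Γ ⊗ b) ⊗ a) ((γ , acc) , y)) ≤ 2 + (size (enc Γ γ) + q + l)
    fit = s≤s (s≤s (+-mono-≤ (+-monoʳ-≤ (size (enc Γ γ)) acc≤q)
            (≤-trans (≤-trans (m≤m+n _ _) (n≤1+n _)) ys≤l)))
    n = pass (2 + (size (enc Γ γ) + q + l))
    bound : 3 + ((suc (evalTime load) + (4 * (time S at (2 + (size (enc Γ γ) + q + l))) + suc (evalTime save)))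
              + (length ys * n + 3)) ≤ suc (length ys) * n + 3
    bound = ≤-reflexive (sym (+-assoc n (length ys * n) 3))

  -- The bound `q` is demanded along the actual run only. It cannot be derived from `S`, since
  -- iterating a polynomial growth may be exponential.
  foldP : ∀ q →
          (∀ γ → Along (f γ) (λ acc → size (enc b acc) ≤ q at size (enc Γ γ)) (init γ) (xs γ)) →
          PolyTime Γ b (λ γ → foldl (λ acc x → step ((γ , acc) , x)) (init γ) (xs γ))
  foldP q along = record
    -- The variable holds in turn `γ ∙ γ`, `init γ ∙ γ`, `γ ∙ init γ ∙ γ` and `xs γ ∙ init γ ∙ γ`,
    -- from which the loop starts.
    { code = set (cons x₀ x₀) ⨾ atHd (code I) ⨾ set (cons (tl x₀) x₀) ⨾ atHd (code L) ⨾
             while (hd x₀) body ⨾ set (hd (tl x₀))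
    ; time = con 4 ⊕ (con 4 ⊛ time I ⊕ (con 5 ⊕ (con 4 ⊛ time L ⊕
               (room L ⊛ passᴾ ⊕ con 3 ⊕ con 4))))
    ; room = q
    ; runs = λ γ →
        ⨾-runs (set-runs (cons x₀ x₀)) (⨾-runs (atHd-runs _ (runs I γ))
          (⨾-runs (set-runs (cons (tl x₀) x₀)) (⨾-runs (atHd-runs _ (runs L γ))
            (⨾-runs (weaken (+-monoˡ-≤ 3 (*-monoˡ-≤ _ (≤-trans (length≤size {a} (xs γ)) (fits L γ))))
                       (loop-runs γ (xs γ) (init γ) (fits L γ) (along γ)))
              (set-runs (hd (tl x₀)))))))
    ; fits = λ γ → along-last (along γ)
    }
    where
    passᴾ : Poly
    passᴾ = con 3 ⊕ (con (suc (evalTime load)) ⊕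
              (con 4 ⊛ time S ⊚ (con 2 ⊕ (𝕏 ⊕ q ⊕ room L)) ⊕ con (suc (evalTime save))))

open Fold using (foldP)

along-growth : ∀ {A B : Set} (μ : B → ℕ) {f : B → A → B} {k} ys →
               (∀ {x} → x ∈ ys → ∀ acc → μ (f acc x) ≤ μ acc + k) →
               ∀ acc {m} → μ acc ≤ m → Along f (λ acc → μ acc ≤ m + length ys * k) acc ys
along-growth μ []       grow acc μ≤m = [] (≤-trans μ≤m (m≤m+n _ _))
along-growth μ {k = k} (y ∷ ys) grow acc {m} μ≤m =
  ≤-trans μ≤m (m≤m+n _ _) ∷
  along-map (λ le → ≤-trans le (≤-reflexive (+-assoc m k (length ys * k))))
    (along-growth μ ys (grow ∘ there) _ (≤-trans (grow (here refl) acc) (+-monoˡ-≤ k μ≤m)))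

∈⇒size≤ : ∀ {a x} {xs : List ⟦ a ⟧} → x ∈ xs → ∥_∥ {a} x ≤ ∥_∥ {list a} xs
∈⇒size≤ (here refl) = ≤-trans (m≤m+n _ _) (n≤1+n _)
∈⇒size≤ (there x∈)  = ≤-trans (∈⇒size≤ x∈) (≤-trans (m≤n+m _ _) (n≤1+n _))

-- A fold is polynomial if some measure bounding the size of the accumulator
-- grows in each step by an amount that does not depend on the accumulator.
growthFoldP : ∀ {Γ a b init xs step} → PolyTime Γ b init → PolyTime Γ (list a) xs →
  PolyTime ((Γ ⊗ b) ⊗ a) b step →
  (μ : ⟦ b ⟧ → ℕ) (M K P : Poly) →
  (∀ γ → μ (init γ) ≤ M at size (enc Γ γ)) →
  (∀ γ acc x → μ (step ((γ , acc) , x)) ≤ μ acc + K at (size (enc Γ γ) + size (enc a x))) →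
  (∀ acc → size (enc b acc) ≤ P at μ acc) →
  PolyTime Γ b (λ γ → foldl (λ acc x → step ((γ , acc) , x)) (init γ) (xs γ))
growthFoldP {Γ} {a} {b} {init} {xs} I L S μ M K P start grow bound =
  foldP I L S (P ⊚ (M ⊕ room L ⊛ K ⊚ (𝕏 ⊕ room L))) λ γ →
    along-map
      (λ {acc} le → ≤-trans (bound acc) (at-mono P (≤-trans le
        (+-monoʳ-≤ (M at size (enc Γ γ))
          (*-monoˡ-≤ (K at (size (enc Γ γ) + room L at size (enc Γ γ)))
            (≤-trans (length≤size {a} (xs γ)) (fits L γ)))))))
      (along-growth μ (xs γ)
        (λ x∈ acc → ≤-trans (grow γ acc _) (+-monoʳ-≤ (μ acc) (at-mono K
          (+-monoʳ-≤ (size (enc Γ γ)) (≤-trans (∈⇒size≤ {a} x∈) (fits L γ))))))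
        (init γ) (start γ))

sizeFoldP : ∀ {Γ a b init xs step} → PolyTime Γ b init → PolyTime Γ (list a) xs →
  PolyTime ((Γ ⊗ b) ⊗ a) b step → (K : Poly) →
  (∀ γ acc x → size (enc b (step ((γ , acc) , x))) ≤
               size (enc b acc) + K at (size (enc Γ γ) + size (enc a x))) →
  PolyTime Γ b (λ γ → foldl (λ acc x → step ((γ , acc) , x)) (init γ) (xs γ))
sizeFoldP {b = b} I L S K grow =
  growthFoldP I L S (λ acc → size (enc b acc)) (room I) K 𝕏 (fits I) grow (λ _ → ≤-refl)

γP : ∀ {Γ a b} → PolyTime ((Γ ⊗ b) ⊗ a) Γ (λ p → proj₁ (proj₁ p))
γP = fstP ∘P fstP

accP : ∀ {Γ a b} → PolyTime ((Γ ⊗ b) ⊗ a) b (λ p → proj₂ (proj₁ p))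
accP = sndP ∘P fstP

ʳ++P : ∀ {Γ a xs ys} → PolyTime Γ (list a) xs → PolyTime Γ (list a) ys →
       PolyTime Γ (list a) (λ γ → xs γ ʳ++ ys γ)
ʳ++P {a = a} L I = sizeFoldP I L (sndP ∷P accP) (𝕏 ⊕ con 1) λ γ acc x →
  lemma (size (enc _ γ)) (size (enc a x)) (size (enc (list a) acc))
  where
  shuffle : ∀ k m n → k + suc (m + n) ≡ n + (k + m + 1)
  shuffle = solve-∀
  lemma : ∀ k m n → suc (m + n) ≤ n + (k + m + 1)
  lemma k m n = ≤-trans (m≤n+m (suc (m + n)) k) (≤-reflexive (shuffle k m n))

-- concatMap, except that it produces the elements in another order.
gather : ∀ {A B : Set} → (A → List B) → List A → List B
gather f = foldl (λ acc x → f x ʳ++ acc) []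

size-ʳ++ : ∀ {a} (xs ys : List ⟦ a ⟧) →
           ∥_∥ {list a} (xs ʳ++ ys) ≤ ∥_∥ {list a} ys + ∥_∥ {list a} xs
size-ʳ++ []       ys = m≤m+n _ _
size-ʳ++ {a} (x ∷ xs) ys = ≤-trans (size-ʳ++ {a} xs (x ∷ ys))
  (≤-reflexive (lemma (∥_∥ {a} x) (∥_∥ {list a} ys) (∥_∥ {list a} xs)))
  where
  lemma : ∀ l m n → suc (l + m) + n ≡ m + suc (l + n)
  lemma = solve-∀

gatherP : ∀ {Γ a b xs} {f : ⟦ Γ ⊗ a ⟧ → List ⟦ b ⟧} → PolyTime Γ (list a) xs →
          PolyTime (Γ ⊗ a) (list b) f →
          PolyTime Γ (list b) (λ γ → gather (λ x → f (γ , x)) (xs γ))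
gatherP {b = b} {f = f} L F =
  sizeFoldP []P L (ʳ++P (F ∘P ⟨ γP , sndP ⟩P) accP) (room F ⊚ (con 1 ⊕ 𝕏)) λ γ acc x →
    ≤-trans (size-ʳ++ {b} (f (γ , x)) acc) (+-monoʳ-≤ (∥_∥ {list b} acc) (fits F (γ , x)))

notP : ∀ {Γ p} → PolyTime Γ bool p → PolyTime Γ bool (λ γ → if p γ then false else true)
notP P = ifP P falseP trueP

guard : ∀ {A : Set} → Bool → A → List A
guard b x = if b then x ∷ [] else []

guardP : ∀ {Γ a p f} → PolyTime Γ bool p → PolyTime Γ a f → PolyTime Γ (list a) (λ γ → guard (p γ) (f γ))
guardP P F = ifP P (F ∷P []P) []P

-- Unary numbers

-- Truncated subtraction is a fold over a single list. Applied in both directions, it replaces the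
-- simultaneous recursion on two lists that an equality test would require.
monus : List ⊤ → List ⊤ → List ⊤
monus xs ys = foldl (λ acc _ → tail′ acc) xs ys

size-tail : ∀ {a} (xs : List ⟦ a ⟧) → ∥_∥ {list a} (tail′ xs) ≤ ∥_∥ {list a} xs
size-tail {a} = fits (tailP {a})

monusP : ∀ {Γ f g} → PolyTime Γ (list unit) f → PolyTime Γ (list unit) g →
         PolyTime Γ (list unit) (λ γ → monus (f γ) (g γ))
monusP F G = sizeFoldP F G (tailP ∘P accP) (con 0) λ γ acc x →
  ≤-trans (size-tail {unit} acc) (m≤m+n _ _)

sameV : List ⊤ → List ⊤ → Bool
sameV xs ys = if nonempty (monus xs ys) then false else
              if nonempty (monus ys xs) then false else true

sameVP : ∀ {Γ f g} → PolyTime Γ (list unit) f → PolyTime Γ (list unit) g →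
         PolyTime Γ bool (λ γ → sameV (f γ) (g γ))
sameVP F G = ifP (nonemptyP ∘P monusP F G) falseP (notP (nonemptyP ∘P monusP G F))

-- Binary numbers, least significant bit first

bits : Ty
bits = list bool

bit : Bool → ℕ
bit b = if b then 1 else 0

value : List Bool → ℕ
value []       = 0
value (b ∷ bs) = bit b + 2 * value bs

size≤length : ∀ bs → size (enc bits bs) ≤ 1 + 4 * length bs
size≤length []       = ≤-refl
size≤length (b ∷ bs) = ≤-trans (s≤s (+-mono-≤ (size-bool≤3 b) (size≤length bs)))
                         (≤-reflexive (lemma (length bs)))
  where
  lemma : ∀ n → suc (3 + (1 + 4 * n)) ≡ 1 + 4 * suc n
  lemma = solve-∀

xor₃ maj : Bool → Bool → Bool → Bool
xor₃ a b c = if a then (if b then c else if c then false else true)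
                  else (if b then (if c then false else true) else c)
maj a b c  = if a then (if b then true else c) else (if b then c else false)

xor₃P : ∀ {Γ f g h} → PolyTime Γ bool f → PolyTime Γ bool g → PolyTime Γ bool h →
        PolyTime Γ bool (λ γ → xor₃ (f γ) (g γ) (h γ))
xor₃P F G H = ifP F (ifP G H (notP H)) (ifP G (notP H) H)

majP : ∀ {Γ f g h} → PolyTime Γ bool f → PolyTime Γ bool g → PolyTime Γ bool h →
       PolyTime Γ bool (λ γ → maj (f γ) (g γ) (h γ))
majP F G H = ifP F (ifP G trueP H) (ifP G H falseP)

-- The unread bits of both summands, the carry, and the finished bits in reverse order.
AddState : Ty
AddState = (bits ⊗ bits) ⊗ bool ⊗ bits

addStep : ⟦ AddState ⟧ → ⟦ AddState ⟧
addStep ((xs , ys) , c , out) =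
  (tail′ xs , tail′ ys) , maj (headBit xs) (headBit ys) c , xor₃ (headBit xs) (headBit ys) c ∷ out

addStepP : PolyTime AddState AddState addStep
addStepP = ⟨ ⟨ tailP ∘P xsP , tailP ∘P ysP ⟩P
           , ⟨ majP (headBitP ∘P xsP) (headBitP ∘P ysP) cP
             , xor₃P (headBitP ∘P xsP) (headBitP ∘P ysP) cP ∷P (sndP ∘P sndP) ⟩P ⟩P
  where
  xsP = fstP {bits} {bits} ∘P fstP {bits ⊗ bits} {bool ⊗ bits}
  ysP = sndP {bits} {bits} ∘P fstP {bits ⊗ bits} {bool ⊗ bits}
  cP  = fstP {bool} {bits} ∘P sndP {bits ⊗ bits} {bool ⊗ bits}

addFinish : ⟦ AddState ⟧ → List Bool
addFinish (_ , c , out) = out ʳ++ (c ∷ [])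

-- The first argument only serves as a clock for the number of bits to add.
addUpTo : List Bool → List Bool → List Bool → List Bool
addUpTo cs xs ys = addFinish (foldl (λ s _ → addStep s) ((xs , ys) , false , []) cs)

addUpToP : ∀ {Γ f g h} → PolyTime Γ bits f → PolyTime Γ bits g → PolyTime Γ bits h →
           PolyTime Γ bits (λ γ → addUpTo (f γ) (g γ) (h γ))
addUpToP F G H =
  ʳ++P (sndP ∘P sndP) ((fstP ∘P sndP) ∷P []P) ∘P
  sizeFoldP {b = AddState} ⟨ ⟨ G , H ⟩P , ⟨ falseP , []P ⟩P ⟩P F (addStepP ∘P accP) (con 7)
    λ _ acc _ → grow acc
  where
  shuffle : ∀ k l m n → m + suc (suc (k + l) + suc (3 + suc (3 + n)))
                      ≡ suc (suc (k + l) + suc (m + n)) + 7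
  shuffle = solve-∀
  lemma : ∀ {k′ l′ m′ i} k l m n → k′ ≤ k → l′ ≤ l → m′ ≤ 3 → i ≤ 3 →
          suc (suc (k′ + l′) + suc (m′ + suc (i + n))) ≤ suc (suc (k + l) + suc (m + n)) + 7
  lemma k l m n k≤ l≤ m≤ i≤ = ≤-trans
    (s≤s (+-mono-≤ (s≤s (+-mono-≤ k≤ l≤)) (s≤s (+-mono-≤ m≤ (s≤s (+-monoˡ-≤ n i≤))))))
    (≤-trans (m≤n+m _ m) (≤-reflexive (shuffle k l m n)))
  grow : ∀ acc → size (enc AddState (addStep acc)) ≤ size (enc AddState acc) + 7
  grow ((xs , ys) , c , out) =
    lemma (size (enc bits xs)) (size (enc bits ys)) (size (encodeBool c)) (size (enc bits out))
      (size-tail {bool} xs) (size-tail {bool} ys)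
      (size-bool≤3 (maj (headBit xs) (headBit ys) c)) (size-bool≤3 (xor₃ (headBit xs) (headBit ys) c))

value-uncons : ∀ xs → value xs ≡ bit (headBit xs) + 2 * value (tail′ xs)
value-uncons []       = refl
value-uncons (_ ∷ _) = refl

length-tail : ∀ {A : Set} {n} (xs : List A) → length xs ≤ suc n → length (tail′ xs) ≤ n
length-tail []       _         = z≤n
length-tail (_ ∷ xs) (s≤s ≤n) = ≤n

length≤0 : ∀ {A : Set} {xs : List A} → length xs ≤ 0 → xs ≡ []
length≤0 {xs = []} _ = refl

length-ʳ++ : ∀ {A : Set} (xs ys : List A) → length (xs ʳ++ ys) ≡ length xs + length ys
length-ʳ++ []       ys = refl
length-ʳ++ (x ∷ xs) ys = trans (length-ʳ++ xs (x ∷ ys)) (+-suc (length xs) (length ys))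

xor₃-maj : ∀ a b c → bit (xor₃ a b c) + 2 * bit (maj a b c) ≡ bit a + bit b + bit c
xor₃-maj false false false = refl
xor₃-maj false false true  = refl
xor₃-maj false true  false = refl
xor₃-maj false true  true  = refl
xor₃-maj true  false false = refl
xor₃-maj true  false true  = refl
xor₃-maj true  true  false = refl
xor₃-maj true  true  true  = refl

-- The same ripple-carry addition by structural recursion, with its output in order, so that values
-- can be computed by induction. The last carry becomes the top bit.
sumBits : List Bool → List Bool → List Bool → Bool → List Bool
sumBits []       xs ys c = c ∷ []
sumBits (_ ∷ cs) xs ys c =
  xor₃ (headBit xs) (headBit ys) c ∷ sumBits cs (tail′ xs) (tail′ ys) (maj (headBit xs) (headBit ys) c)

addUpTo-sumBits : ∀ cs xs ys c out →
  addFinish (foldl (λ s _ → addStep s) ((xs , ys) , c , out) cs) ≡ out ʳ++ sumBits cs xs ys c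
addUpTo-sumBits []       xs ys c out = refl
addUpTo-sumBits (_ ∷ cs) xs ys c out = addUpTo-sumBits cs (tail′ xs) (tail′ ys) _ _

value-sumBits : ∀ cs xs ys c → length xs ≤ length cs → length ys ≤ length cs →
                value (sumBits cs xs ys c) ≡ value xs + value ys + bit c
value-sumBits [] xs ys c xs≤ ys≤
  rewrite length≤0 {xs = xs} xs≤ | length≤0 {xs = ys} ys≤ = +-identityʳ (bit c)
value-sumBits (_ ∷ cs) xs ys c xs≤ ys≤
  rewrite value-sumBits cs (tail′ xs) (tail′ ys) (maj (headBit xs) (headBit ys) c)
            (length-tail xs xs≤) (length-tail ys ys≤)
        | value-uncons xs | value-uncons ys
  = begin
      bit (xor₃ a b c) + 2 * (x + y + bit (maj a b c))
        ≡⟨ lemma₁ (bit (xor₃ a b c)) x y (bit (maj a b c)) ⟩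
      bit (xor₃ a b c) + 2 * bit (maj a b c) + 2 * (x + y)
        ≡⟨ cong (_+ 2 * (x + y)) (xor₃-maj a b c) ⟩
      bit a + bit b + bit c + 2 * (x + y)
        ≡⟨ lemma₂ (bit a) (bit b) (bit c) x y ⟩
      bit a + 2 * x + (bit b + 2 * y) + bit c ∎
  where
  open ≡-Reasoning
  a = headBit xs
  b = headBit ys
  x = value (tail′ xs)
  y = value (tail′ ys)
  lemma₁ : ∀ s x y m → s + 2 * (x + y + m) ≡ s + 2 * m + 2 * (x + y)
  lemma₁ = solve-∀
  lemma₂ : ∀ a b c x y → a + b + c + 2 * (x + y) ≡ a + 2 * x + (b + 2 * y) + c
  lemma₂ = solve-∀

length-sumBits : ∀ cs xs ys c → length (sumBits cs xs ys c) ≡ suc (length cs)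
length-sumBits []       xs ys c = refl
length-sumBits (_ ∷ cs) xs ys c = cong suc (length-sumBits cs (tail′ xs) (tail′ ys) _)

value-addUpTo : ∀ cs xs ys → length xs ≤ length cs → length ys ≤ length cs →
                value (addUpTo cs xs ys) ≡ value xs + value ys
value-addUpTo cs xs ys xs≤ ys≤ =
  trans (cong value (addUpTo-sumBits cs xs ys false []))
    (trans (value-sumBits cs xs ys false xs≤ ys≤) (+-identityʳ _))

length-addUpTo : ∀ cs xs ys → length (addUpTo cs xs ys) ≡ suc (length cs)
length-addUpTo cs xs ys =
  trans (cong length (addUpTo-sumBits cs xs ys false [])) (length-sumBits cs xs ys false)

length≤ʳ++ˡ : ∀ {A : Set} (xs ys : List A) → length xs ≤ length (xs ʳ++ ys)
length≤ʳ++ˡ xs ys = ≤-trans (m≤m+n _ _) (≤-reflexive (sym (length-ʳ++ xs ys)))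

length≤ʳ++ʳ : ∀ {A : Set} (xs ys : List A) → length ys ≤ length (xs ʳ++ ys)
length≤ʳ++ʳ xs ys = ≤-trans (m≤n+m _ _) (≤-reflexive (sym (length-ʳ++ xs ys)))

-- The concatenation is a clock that outlasts both summands without a comparison of lengths. The
-- price is that lengths add up, as leading zeros are never removed; this stays polynomial because
-- labels are extended by one arc weight at a time.
add : List Bool → List Bool → List Bool
add xs ys = addUpTo (xs ʳ++ ys) xs ys

addP : ∀ {Γ f g} → PolyTime Γ bits f → PolyTime Γ bits g → PolyTime Γ bits (λ γ → add (f γ) (g γ))
addP F G = addUpToP (ʳ++P F G) F G

value-add : ∀ xs ys → value (add xs ys) ≡ value xs + value ys
value-add xs ys = value-addUpTo (xs ʳ++ ys) xs ys (length≤ʳ++ˡ xs ys) (length≤ʳ++ʳ xs ys)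

length-add : ∀ xs ys → length (add xs ys) ≡ suc (length xs + length ys)
length-add xs ys = trans (length-addUpTo (xs ʳ++ ys) xs ys) (cong suc (length-ʳ++ xs ys))

LeqState : Ty
LeqState = (bits ⊗ bits) ⊗ bool

-- The scan starts at the least significant bit, so a difference found later overrides the verdict
-- `r` on the lower bits.
leqBit : Bool → Bool → Bool → Bool
leqBit a b r = if a then (if b then r else false) else (if b then true else r)

leqStep : ⟦ LeqState ⟧ → ⟦ LeqState ⟧
leqStep ((xs , ys) , r) = (tail′ xs , tail′ ys) , leqBit (headBit xs) (headBit ys) r

leqStepP : PolyTime LeqState LeqState leqStep
leqStepP = ⟨ ⟨ tailP ∘P xsP , tailP ∘P ysP ⟩P
           , ifP (headBitP ∘P xsP) (ifP (headBitP ∘P ysP) sndP falseP)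
                                   (ifP (headBitP ∘P ysP) trueP sndP) ⟩P
  where
  xsP = fstP {bits} {bits} ∘P fstP {bits ⊗ bits} {bool}
  ysP = sndP {bits} {bits} ∘P fstP {bits ⊗ bits} {bool}

leq : List Bool → List Bool → Bool
leq xs ys = proj₂ (foldl (λ s _ → leqStep s) ((xs , ys) , true) (xs ʳ++ ys))

leqP : ∀ {Γ f g} → PolyTime Γ bits f → PolyTime Γ bits g → PolyTime Γ bool (λ γ → leq (f γ) (g γ))
leqP F G = sndP ∘P sizeFoldP {b = LeqState} ⟨ ⟨ F , G ⟩P , trueP ⟩P (ʳ++P F G) (leqStepP ∘P accP)
  (con 2) λ _ acc _ → grow acc
  where
  shuffle : ∀ k l m → m + suc (suc (k + l) + 3) ≡ suc (suc (k + l) + suc m) + 2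
  shuffle = solve-∀
  lemma : ∀ {k′ l′ m′} k l m → k′ ≤ k → l′ ≤ l → m′ ≤ 3 → 0 < m →
          suc (suc (k′ + l′) + m′) ≤ suc (suc (k + l) + m) + 2
  lemma k l (suc m) k≤ l≤ m≤ _ = ≤-trans (s≤s (+-mono-≤ (s≤s (+-mono-≤ k≤ l≤)) m≤))
    (≤-trans (m≤n+m _ m) (≤-reflexive (shuffle k l m)))
  grow : ∀ acc → size (enc LeqState (leqStep acc)) ≤ size (enc LeqState acc) + 2
  grow ((xs , ys) , r) = lemma (size (enc bits xs)) (size (enc bits ys)) (size (encodeBool r))
    (size-tail {bool} xs) (size-tail {bool} ys) (size-bool≤3 (leqBit (headBit xs) (headBit ys) r))
    (size>0 (encodeBool r))

infix 3 _decides_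

_decides_ : Bool → Set → Set
b decides P = (b ≡ true → P) × (P → b ≡ true)

-- The bit computed by leqBit is the negated borrow of a subtraction.
leqBit-digits : ∀ a b r → ∃[ d ] bit b + 2 * bit (not (leqBit a b r)) ≡ bit a + bit (not r) + bit d
leqBit-digits false false false = true  , refl
leqBit-digits false false true  = false , refl
leqBit-digits false true  false = false , refl
leqBit-digits false true  true  = true  , refl
leqBit-digits true  false false = false , refl
leqBit-digits true  false true  = true  , refl
leqBit-digits true  true  false = true  , refl
leqBit-digits true  true  true  = false , refl

2*-cancel-bit : ∀ {m n} d → 2 * m ≤ bit d + 2 * n → m ≤ n
2*-cancel-bit false le = *-cancelˡ-≤ 2 le
2*-cancel-bit {m} {n} true le = ≮⇒≥ λ n<m → <-irrefl refl (≤-trans (lemma n<m) le)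
  where
  lemma : n < m → suc (1 + 2 * n) ≤ 2 * m
  lemma n<m = ≤-trans (≤-reflexive (sym (*-suc 2 n))) (*-monoʳ-≤ 2 n<m)

-- One digit of a subtraction with difference digit `d`, incoming borrow `β` and outgoing borrow
-- `β′`. In one direction `d` is dropped since it is nonnegative; in the other it is rounded away
-- since it is less than 2.
leq-digits : ∀ {a b β β′} d m n → b + 2 * β′ ≡ a + β + bit d →
             (m + β′ ≤ n → a + 2 * m + β ≤ b + 2 * n) × (a + 2 * m + β ≤ b + 2 * n → m + β′ ≤ n)
leq-digits {a} {b} {β} {β′} d m n eq = forth , back
  where
  open ≤-Reasoning
  lemma₁ : ∀ a β m β′ d → a + 2 * m + β + (d + 2 * β′) ≡ a + β + d + 2 * (m + β′)
  lemma₁ = solve-∀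
  lemma₂ : ∀ b β′ n → b + 2 * β′ + 2 * n ≡ b + 2 * n + 2 * β′
  lemma₂ = solve-∀
  lemma₃ : ∀ b n β′ d → b + 2 * n + (d + 2 * β′) ≡ b + 2 * β′ + (d + 2 * n)
  lemma₃ = solve-∀
  forth : m + β′ ≤ n → a + 2 * m + β ≤ b + 2 * n
  forth le = +-cancelʳ-≤ (2 * β′) _ _ (begin
    a + 2 * m + β + 2 * β′               ≤⟨ +-monoʳ-≤ (a + 2 * m + β) (m≤n+m (2 * β′) (bit d)) ⟩
    a + 2 * m + β + (bit d + 2 * β′)     ≡⟨ lemma₁ a β m β′ (bit d) ⟩
    a + β + bit d + 2 * (m + β′)         ≤⟨ +-monoʳ-≤ (a + β + bit d) (*-monoʳ-≤ 2 le) ⟩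
    a + β + bit d + 2 * n                ≡⟨ cong (_+ 2 * n) eq ⟨
    b + 2 * β′ + 2 * n                   ≡⟨ lemma₂ b β′ n ⟩
    b + 2 * n + 2 * β′                   ∎)
  back : a + 2 * m + β ≤ b + 2 * n → m + β′ ≤ n
  back le = 2*-cancel-bit d (+-cancelˡ-≤ (a + β + bit d) _ _ (begin
    a + β + bit d + 2 * (m + β′)         ≡⟨ lemma₁ a β m β′ (bit d) ⟨
    a + 2 * m + β + (bit d + 2 * β′)     ≤⟨ +-monoˡ-≤ (bit d + 2 * β′) le ⟩
    b + 2 * n + (bit d + 2 * β′)         ≡⟨ lemma₃ b n β′ (bit d) ⟩
    b + 2 * β′ + (bit d + 2 * n)         ≡⟨ cong (_+ (bit d + 2 * n)) eq ⟩
    a + β + bit d + (bit d + 2 * n)      ∎))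

-- The verdict `r = false` on the lower bits is a borrow of 1, which makes the comparison of the
-- remaining bits strict.
leqLoop-decides : ∀ cs xs ys r → length xs ≤ length cs → length ys ≤ length cs →
  proj₂ (foldl (λ s (_ : Bool) → leqStep s) ((xs , ys) , r) cs) decides
    (value xs + bit (not r) ≤ value ys)
leqLoop-decides [] xs ys r xs≤ ys≤
  rewrite length≤0 {xs = xs} xs≤ | length≤0 {xs = ys} ys≤ = base r
  where
  base : ∀ r → r decides (bit (not r) ≤ 0)
  base true  = (λ _ → z≤n) , (λ _ → refl)
  base false = (λ ()) , (λ ())
leqLoop-decides (_ ∷ cs) xs ys r xs≤ ys≤
  rewrite value-uncons xs | value-uncons ys
  with leqBit-digits (headBit xs) (headBit ys) r
     | leqLoop-decides cs (tail′ xs) (tail′ ys) (leqBit (headBit xs) (headBit ys) r)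
         (length-tail xs xs≤) (length-tail ys ys≤)
... | d , eq | sound , complete with leq-digits {bit (headBit xs)} {bit (headBit ys)} {bit (not r)} d (value (tail′ xs)) (value (tail′ ys)) eq
...   | forth , back = forth ∘ sound , complete ∘ back

leq-decides : ∀ xs ys → leq xs ys decides (value xs ≤ value ys)
leq-decides xs ys with leqLoop-decides (xs ʳ++ ys) xs ys true (length≤ʳ++ˡ xs ys) (length≤ʳ++ʳ xs ys)
... | sound , complete rewrite +-identityʳ (value xs) = sound , complete

MulState : Ty
MulState = bits ⊗ bits

-- One row of schoolbook multiplication. The lowest bit of the sum is final and leaves the window;
-- the clock `false ∷ ys` gives the sum `2 + length ys` bits, so that the window always returns to
-- `1 + length ys` bits.
partialSum : List Bool → List Bool → Bool → List Bool
partialSum ys acc b = addUpTo (false ∷ ys) acc (if b then ys else [])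

mulStep : List Bool → ⟦ MulState ⟧ → Bool → ⟦ MulState ⟧
mulStep ys (acc , out) b = tail′ (partialSum ys acc b) , headBit (partialSum ys acc b) ∷ out

mulStepP : PolyTime (((bits ⊗ bits) ⊗ MulState) ⊗ bool) MulState
  (λ p → mulStep (proj₂ (proj₁ (proj₁ p))) (proj₂ (proj₁ p)) (proj₂ p))
mulStepP = ⟨ tailP ∘P sumP , (headBitP ∘P sumP) ∷P (sndP ∘P accP) ⟩P
  where
  sumP = addUpToP {((bits ⊗ bits) ⊗ MulState) ⊗ bool} (falseP ∷P (sndP ∘P γP)) (fstP ∘P accP)
           (ifP sndP (sndP ∘P γP) []P)

mul : List Bool → List Bool → List Bool
mul xs ys = let (acc , out) = foldl (mulStep ys) ([] , []) xs in out ʳ++ acc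

length-partialSum : ∀ ys acc b → length (partialSum ys acc b) ≡ 2 + length ys
length-partialSum ys acc b = length-addUpTo (false ∷ ys) acc (if b then ys else [])

mulP : ∀ {Γ f g} → PolyTime Γ bits f → PolyTime Γ bits g → PolyTime Γ bits (λ γ → mul (f γ) (g γ))
mulP F G = ʳ++P sndP fstP ∘P
  growthFoldP {b = MulState} ⟨ []P , []P ⟩P fstP mulStepP
    (λ p → length (proj₁ p) + length (proj₂ p)) (con 0) (𝕏 ⊕ con 2) (con 3 ⊕ con 4 ⊛ 𝕏)
    (λ _ → z≤n) (λ γ acc x → grow (proj₁ γ) (proj₂ γ) (proj₁ acc) (proj₂ acc) x) bound
  ∘P ⟨ F , G ⟩P
  where
  open ≤-Reasoning
  grow : ∀ (xs ys acc out : List Bool) b →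
         length (tail′ (partialSum ys acc b)) + suc (length out) ≤
         length acc + length out + (size (enc (bits ⊗ bits) (xs , ys)) + size (encodeBool b) + 2)
  grow xs ys acc out b = begin
    length (tail′ (partialSum ys acc b)) + suc (length out)
      ≤⟨ +-monoˡ-≤ (suc (length out)) (length-tail (partialSum ys acc b) (≤-reflexive (length-partialSum ys acc b))) ⟩
    suc (length ys) + suc (length out)
      ≤⟨ +-monoˡ-≤ (suc (length out)) (s≤s (length≤size {bool} ys)) ⟩
    suc (size (enc bits ys)) + suc (length out)
      ≤⟨ m≤n+m _ (length acc + suc (size (enc bits xs)) + size (encodeBool b)) ⟩
    length acc + suc (size (enc bits xs)) + size (encodeBool b) + (suc (size (enc bits ys)) + suc (length out))
      ≡⟨ lemma (length acc) (size (enc bits xs)) (size (encodeBool b)) (size (enc bits ys)) (length out) ⟩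
    length acc + length out + (suc (size (enc bits xs) + size (enc bits ys)) + size (encodeBool b) + 2) ∎
    where
    lemma : ∀ a x b y o → a + suc x + b + (suc y + suc o) ≡ a + o + (suc (x + y) + b + 2)
    lemma = solve-∀
  bound : ∀ (acc : ⟦ MulState ⟧) → size (enc MulState acc) ≤ 3 + 4 * (length (proj₁ acc) + length (proj₂ acc))
  bound (acc , out) = ≤-trans (s≤s (+-mono-≤ (size≤length acc) (size≤length out)))
    (≤-reflexive (lemma (length acc) (length out)))
    where
    lemma : ∀ m n → suc (1 + 4 * m + (1 + 4 * n)) ≡ 3 + 4 * (m + n)
    lemma = solve-∀

productBits : List Bool → List Bool → List Bool → List Bool
productBits []       ys acc = acc
productBits (b ∷ xs) ys acc =
  headBit (partialSum ys acc b) ∷ productBits xs ys (tail′ (partialSum ys acc b))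

mul-productBits : ∀ xs ys acc out →
  (let (acc′ , out′) = foldl (mulStep ys) (acc , out) xs in out′ ʳ++ acc′) ≡
  out ʳ++ productBits xs ys acc
mul-productBits []       ys acc out = refl
mul-productBits (b ∷ xs) ys acc out = mul-productBits xs ys _ _

value-productBits : ∀ xs ys acc → length acc ≤ suc (length ys) →
                    value (productBits xs ys acc) ≡ value acc + value xs * value ys
value-productBits []       ys acc acc≤ = sym (+-identityʳ _)
value-productBits (b ∷ xs) ys acc acc≤ = begin
  bit (headBit s) + 2 * value (productBits xs ys (tail′ s))
    ≡⟨ cong (λ v → bit (headBit s) + 2 * v) (value-productBits xs ys (tail′ s)
         (length-tail s (≤-reflexive (length-partialSum ys acc b)))) ⟩
  bit (headBit s) + 2 * (value (tail′ s) + value xs * value ys)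
    ≡⟨ lemma₁ (bit (headBit s)) (value (tail′ s)) (value xs) (value ys) ⟩
  bit (headBit s) + 2 * value (tail′ s) + 2 * value xs * value ys
    ≡⟨ cong (_+ 2 * value xs * value ys) (value-uncons s) ⟨
  value s + 2 * value xs * value ys
    ≡⟨ cong (_+ 2 * value xs * value ys) (value-addUpTo (false ∷ ys) acc (if b then ys else []) acc≤ (choice b)) ⟩
  value acc + value (if b then ys else []) + 2 * value xs * value ys
    ≡⟨ cong (λ v → value acc + v + 2 * value xs * value ys) (choice-value b) ⟩
  value acc + bit b * value ys + 2 * value xs * value ys
    ≡⟨ lemma₂ (value acc) (bit b) (value xs) (value ys) ⟩
  value acc + (bit b + 2 * value xs) * value ys ∎
  where
  open ≡-Reasoning
  s = partialSum ys acc b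
  choice : ∀ b → length (if b then ys else []) ≤ suc (length ys)
  choice true  = n≤1+n _
  choice false = z≤n
  choice-value : ∀ b → value (if b then ys else []) ≡ bit b * value ys
  choice-value true  = sym (+-identityʳ _)
  choice-value false = refl
  lemma₁ : ∀ h t x y → h + 2 * (t + x * y) ≡ h + 2 * t + 2 * x * y
  lemma₁ = solve-∀
  lemma₂ : ∀ a b x y → a + b * y + 2 * x * y ≡ a + (b + 2 * x) * y
  lemma₂ = solve-∀

value-mul : ∀ xs ys → value (mul xs ys) ≡ value xs * value ys
value-mul xs ys = trans (cong value (mul-productBits xs ys [] [])) (value-productBits xs ys [] z≤n)

length-productBits : ∀ xs ys acc → length acc ≤ suc (length ys) →
                     length (productBits xs ys acc) ≤ length xs + suc (length ys)
length-productBits []       ys acc acc≤ = acc≤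
length-productBits (b ∷ xs) ys acc acc≤ = s≤s (length-productBits xs ys (tail′ (partialSum ys acc b))
  (length-tail (partialSum ys acc b) (≤-reflexive (length-partialSum ys acc b))))

length-mul : ∀ xs ys → length (mul xs ys) ≤ length xs + suc (length ys)
length-mul xs ys = ≤-trans (≤-reflexive (cong length (mul-productBits xs ys [] [])))
  (length-productBits xs ys [] z≤n)

-- Elements of gathered lists

∈-ʳ++⁺ˡ : ∀ {A : Set} {y : A} {xs} ys → y ∈ xs → y ∈ xs ʳ++ ys
∈-ʳ++⁺ʳ : ∀ {A : Set} {y : A} xs {ys} → y ∈ ys → y ∈ xs ʳ++ ys
∈-ʳ++⁺ˡ {xs = x ∷ xs} ys (here refl) = ∈-ʳ++⁺ʳ xs (here refl)
∈-ʳ++⁺ˡ {xs = x ∷ xs} ys (there y∈)  = ∈-ʳ++⁺ˡ (x ∷ ys) y∈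
∈-ʳ++⁺ʳ []       y∈ = y∈
∈-ʳ++⁺ʳ (x ∷ xs) y∈ = ∈-ʳ++⁺ʳ xs (there y∈)

∈-ʳ++⁻ : ∀ {A : Set} {y : A} xs {ys} → y ∈ xs ʳ++ ys → y ∈ xs ⊎ y ∈ ys
∈-ʳ++⁻ []       y∈ = inj₂ y∈
∈-ʳ++⁻ (x ∷ xs) y∈ with ∈-ʳ++⁻ xs y∈
... | inj₁ y∈xs         = inj₁ (there y∈xs)
... | inj₂ (here y≡x)   = inj₁ (here y≡x)
... | inj₂ (there y∈ys) = inj₂ y∈ys

module _ {A B : Set} (f : A → List B) where

  gatherOnto : List B → List A → List B
  gatherOnto = foldl (λ acc x → f x ʳ++ acc)

  ∈-gatherOnto : ∀ {y} xs {acc} → y ∈ acc → y ∈ gatherOnto acc xs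
  ∈-gatherOnto []       y∈ = y∈
  ∈-gatherOnto (x ∷ xs) y∈ = ∈-gatherOnto xs (∈-ʳ++⁺ʳ (f x) y∈)

  ∈-gather⁺ : ∀ {x y xs} → x ∈ xs → y ∈ f x → y ∈ gather f xs
  ∈-gather⁺ = go []
    where
    go : ∀ acc {x y xs} → x ∈ xs → y ∈ f x → y ∈ gatherOnto acc xs
    go acc {xs = x ∷ xs} (here refl) y∈ = ∈-gatherOnto xs (∈-ʳ++⁺ˡ acc y∈)
    go acc {xs = x ∷ xs} (there x∈)  y∈ = go (f x ʳ++ acc) x∈ y∈

  ∈-gather⁻ : ∀ {y} xs → y ∈ gather f xs → ∃[ x ] x ∈ xs × y ∈ f x
  ∈-gather⁻ xs y∈ with go xs y∈
    where
    go : ∀ {y} xs {acc} → y ∈ gatherOnto acc xs → (∃[ x ] x ∈ xs × y ∈ f x) ⊎ y ∈ acc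
    go []       y∈ = inj₂ y∈
    go (x ∷ xs) y∈ with go xs y∈
    ... | inj₁ (x′ , x′∈ , y∈′) = inj₁ (x′ , there x′∈ , y∈′)
    ... | inj₂ y∈′ with ∈-ʳ++⁻ (f x) y∈′
    ...   | inj₁ y∈fx  = inj₁ (x , here refl , y∈fx)
    ...   | inj₂ y∈acc = inj₂ y∈acc
  ... | inj₁ found = found

  length-gather : ∀ {k} → (∀ x → length (f x) ≤ k) → ∀ xs → length (gather f xs) ≤ length xs * k
  length-gather {k} short xs = ≤-trans (go xs []) (≤-reflexive (+-identityʳ _))
    where
    lemma : ∀ m n a → m + (n + a) ≡ n + m + a
    lemma = solve-∀
    go : ∀ xs acc → length (gatherOnto acc xs) ≤ length xs * k + length acc
    go []       acc = ≤-refl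
    go (x ∷ xs) acc = ≤-trans (go xs (f x ʳ++ acc))
      (≤-trans (+-monoʳ-≤ (length xs * k) (≤-trans (≤-reflexive (length-ʳ++ (f x) acc))
                                                   (+-monoˡ-≤ (length acc) (short x))))
               (≤-reflexive (lemma (length xs * k) k (length acc))))

∈-guard⁺ : ∀ {A : Set} {b} {x : A} → b ≡ true → x ∈ guard b x
∈-guard⁺ refl = here refl

∈-guard⁻ : ∀ {A : Set} {x y : A} b → y ∈ guard b x → b ≡ true × y ≡ x
∈-guard⁻ true (here y≡x) = refl , y≡x

nonempty⁺ : ∀ {A : Set} {x : A} {xs} → x ∈ xs → nonempty xs ≡ true
nonempty⁺ (here _)  = refl
nonempty⁺ (there _) = refl

nonempty⁻ : ∀ {A : Set} (xs : List A) → nonempty xs ≡ true → ∃[ x ] x ∈ xs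
nonempty⁻ (x ∷ _) _ = x , here refl

length-monus : ∀ xs ys → length (monus xs ys) ≡ length xs ∸ length ys
length-monus xs       []       = refl
length-monus []       (_ ∷ ys) = trans (length-monus [] ys) (0∸n≡0 (length ys))
length-monus (_ ∷ xs) (_ ∷ ys) = length-monus xs ys

length-⊤-injective : ∀ {xs ys : List ⊤} → length xs ≡ length ys → xs ≡ ys
length-⊤-injective {[]}     {[]}     _  = refl
length-⊤-injective {_ ∷ xs} {_ ∷ ys} eq = cong (tt ∷_) (length-⊤-injective (suc-injective eq))

sameV-sound : ∀ xs ys → sameV xs ys ≡ true → xs ≡ ys
sameV-sound xs ys same
  with monus xs ys | length-monus xs ys | monus ys xs | length-monus ys xs
... | [] | eq | [] | eq′ =
  length-⊤-injective (≤-antisym (m∸n≡0⇒m≤n (sym eq)) (m∸n≡0⇒m≤n (sym eq′)))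

sameV-refl : ∀ xs → sameV xs xs ≡ true
sameV-refl []       = refl
sameV-refl (_ ∷ xs) = sameV-refl xs

-- Lexicographic weights and their minima

V : Ty
V = list unit

-- Pairs of a follower's and a leader's weight, ordered lexicographically
W : Ty
W = bits ⊗ bits

addW : ⟦ W ⟧ → ⟦ W ⟧ → ⟦ W ⟧
addW (d , c) (d′ , c′) = add d d′ , add c c′

addWP : ∀ {Γ f g} → PolyTime Γ W f → PolyTime Γ W g → PolyTime Γ W (λ γ → addW (f γ) (g γ))
addWP F G = ⟨ addP (fstP ∘P F) (fstP ∘P G) , addP (sndP ∘P F) (sndP ∘P G) ⟩P

leqW : ⟦ W ⟧ → ⟦ W ⟧ → Bool
leqW (d , c) (d′ , c′) = if leq d d′ then (if leq d′ d then leq c c′ else true) else false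

leqWP : ∀ {Γ f g} → PolyTime Γ W f → PolyTime Γ W g → PolyTime Γ bool (λ γ → leqW (f γ) (g γ))
leqWP F G = ifP (leqP (fstP ∘P F) (fstP ∘P G))
  (ifP (leqP (fstP ∘P G) (fstP ∘P F)) (leqP (sndP ∘P F) (sndP ∘P G)) trueP) falseP

infix  4 _≤ₗ_
infixl 6 _+ₗ_

-- Second components are compared only in a tie. Stated without a disjunction, the two halves are
-- the two facts used later: optimality for the follower, and the least leader's cost among the
-- follower's optima.
_≤ₗ_ : ℕ × ℕ → ℕ × ℕ → Set
(d , c) ≤ₗ (d′ , c′) = d ≤ d′ × (d′ ≤ d → c ≤ c′)

_+ₗ_ : ℕ × ℕ → ℕ × ℕ → ℕ × ℕ
(d , c) +ₗ (d′ , c′) = d + d′ , c + c′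

≤ₗ-refl : ∀ {x} → x ≤ₗ x
≤ₗ-refl = ≤-refl , λ _ → ≤-refl

≤ₗ-trans : ∀ {x y z} → x ≤ₗ y → y ≤ₗ z → x ≤ₗ z
≤ₗ-trans (d≤ , c≤) (d′≤ , c′≤) =
  ≤-trans d≤ d′≤ , λ ≤d → ≤-trans (c≤ (≤-trans d′≤ ≤d)) (c′≤ (≤-trans ≤d d≤))

-- Cancellation turns a tie of the sums into a tie of the summands. This monotonicity is what allows
-- Bellman-Ford to keep only the least label of a vertex.
+ₗ-monoˡ : ∀ {x y} z → x ≤ₗ y → x +ₗ z ≤ₗ y +ₗ z
+ₗ-monoˡ (d , c) (d≤ , c≤) = +-monoˡ-≤ d d≤ , λ ≤d → +-monoˡ-≤ c (c≤ (+-cancelʳ-≤ d _ _ ≤d))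

wvalue : ⟦ W ⟧ → ℕ × ℕ
wvalue (d , c) = value d , value c

wvalue-addW : ∀ w w′ → wvalue (addW w w′) ≡ wvalue w +ₗ wvalue w′
wvalue-addW (d , c) (d′ , c′) = cong₂ _,_ (value-add d d′) (value-add c c′)

leqW-sound : ∀ w w′ → leqW w w′ ≡ true → wvalue w ≤ₗ wvalue w′
leqW-sound (d , c) (d′ , c′) eq with leq d d′ | leq-decides d d′ | leq d′ d | leq-decides d′ d
... | true | d≤ , _ | true  | _ = d≤ refl , λ _ → proj₁ (leq-decides c c′) eq
... | true | d≤ , _ | false | _ , ≤d = d≤ refl , λ le → contradiction (≤d le) (λ ())

leqW-total : ∀ w w′ → leqW w w′ ≡ false → wvalue w′ ≤ₗ wvalue w
leqW-total (d , c) (d′ , c′) eq with leq d d′ | leq-decides d d′ | leq d′ d | leq-decides d′ d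
... | true | d≤ , _ | true | ≤d , _ = ≤d refl , λ _ →
  <⇒≤ (≰⇒> λ c≤ → contradiction (trans (sym (proj₂ (leq-decides c c′) c≤)) eq) (λ ()))
... | false | _ , d≤ | _ | _ =
  <⇒≤ (≰⇒> λ le → contradiction (d≤ le) (λ ())) , λ le → contradiction (d≤ le) (λ ())

covered : ⟦ W ⟧ → List ⟦ W ⟧ → Bool
covered w ms = nonempty (gather (λ m → guard (leqW m w) tt) ms)

keepMin : List ⟦ W ⟧ → ⟦ W ⟧ → List ⟦ W ⟧
keepMin best w = if covered w best then best else w ∷ []

-- A singleton, or the empty list standing for infinity.
minimum : List ⟦ W ⟧ → List ⟦ W ⟧
minimum = foldl keepMin []

minimumP : ∀ {Γ ws} → PolyTime Γ (list W) ws → PolyTime Γ (list W) (λ γ → minimum (ws γ))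
minimumP L = sizeFoldP []P L
  (ifP (nonemptyP ∘P gatherP accP (guardP (leqWP sndP (sndP ∘P fstP)) ttP)) accP (sndP ∷P []P))
  (con 2 ⊕ 𝕏)
  λ γ best w → bound best w (covered w best)
  where
  bound : ∀ {k} (best : List ⟦ W ⟧) (w : ⟦ W ⟧) b →
          size (enc (list W) (if b then best else w ∷ [])) ≤
          size (enc (list W) best) + (2 + (k + size (enc W w)))
  bound best w true  = m≤m+n _ _
  bound {k} best w false = begin
    suc (size (enc W w) + 1)                ≡⟨ cong suc (+-comm _ 1) ⟩
    2 + size (enc W w)                      ≤⟨ +-monoʳ-≤ 2 (m≤n+m _ k) ⟩
    2 + (k + size (enc W w))                ≤⟨ m≤n+m _ _ ⟩
    size (enc (list W) best) + (2 + (k + size (enc W w))) ∎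
    where open ≤-Reasoning

length-keepMin : ∀ best w → length best ≤ 1 → length (keepMin best w) ≤ 1
length-keepMin best w short with covered w best
... | true  = short
... | false = ≤-refl

length-minimum : ∀ ws → length (minimum ws) ≤ 1
length-minimum ws = go ws [] z≤n
  where
  go : ∀ ws best → length best ≤ 1 → length (foldl keepMin best ws) ≤ 1
  go []       best short = short
  go (w ∷ ws) best short = go ws (keepMin best w) (length-keepMin best w short)

covered-sound : ∀ {w} ms → covered w ms ≡ true → ∃[ m ] m ∈ ms × wvalue m ≤ₗ wvalue w
covered-sound {w} ms eq with nonempty⁻ _ eq
... | _ , t∈ with ∈-gather⁻ (λ m → guard (leqW m w) tt) ms t∈
...   | m , m∈ , t∈′ = m , m∈ , leqW-sound m w (proj₁ (∈-guard⁻ (leqW m w) t∈′))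

uncovered : ∀ {w m} ms → covered w ms ≡ false → m ∈ ms → wvalue w ≤ₗ wvalue m
uncovered {w} {m} ms eq m∈ with leqW m w in le
... | false = leqW-total m w le
... | true  = contradiction
  (trans (sym (nonempty⁺ (∈-gather⁺ (λ m → guard (leqW m w) tt) m∈ (∈-guard⁺ le)))) eq) (λ ())

minimum-least : ∀ ws {m} → m ∈ minimum ws →
                m ∈ ws × (∀ {w} → w ∈ ws → wvalue m ≤ₗ wvalue w)
minimum-least ws m∈ with go ws [] z≤n m∈
  where
  go : ∀ ws best → length best ≤ 1 → ∀ {m} → m ∈ foldl keepMin best ws →
       (m ∈ best ⊎ m ∈ ws) ×
       (∀ {w} → w ∈ best → wvalue m ≤ₗ wvalue w) × (∀ {w} → w ∈ ws → wvalue m ≤ₗ wvalue w)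
  go [] (b ∷ []) _ (here refl) = inj₁ (here refl) , (λ { (here refl) → ≤ₗ-refl }) , λ ()
  go [] (_ ∷ _ ∷ _) (s≤s ()) _
  go (w ∷ ws) best short m∈ with covered w best in eq
  ... | true with go ws best short m∈ | covered-sound best eq
  ...   | origin , ≤best , ≤ws | b , b∈ , b≤w =
    map₂ there origin , ≤best ,
    λ { (here refl) → ≤ₗ-trans (≤best b∈) b≤w ; (there w∈) → ≤ws w∈ }
  go (w ∷ ws) best short m∈ | false with go ws (w ∷ []) ≤-refl m∈
  ...   | origin , ≤w , ≤ws =
    inj₂ ([ (λ { (here refl) → here refl }) , there ] origin) ,
    (λ b∈ → ≤ₗ-trans (≤w (here refl)) (uncovered best eq b∈)) ,
    λ { (here refl) → ≤w (here refl) ; (there w∈) → ≤ws w∈ }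
... | inj₂ m∈ws , _ , ≤ws = m∈ws , ≤ws

minimum-exists : ∀ {ws w} → w ∈ ws → ∃[ m ] m ∈ minimum ws
minimum-exists {w ∷ ws} _ = go ws (keepMin [] w) (w , here refl)
  where
  go : ∀ ws best → ∃[ b ] b ∈ best → ∃[ m ] m ∈ foldl keepMin best ws
  go []       best inhabited = inhabited
  go (w ∷ ws) best inhabited with covered w best
  ... | true  = go ws best inhabited
  ... | false = go ws (w ∷ []) (w , here refl)

-- The Bellman–Ford algorithm

Arc Table : Ty
Arc   = V ⊗ V ⊗ W
Table = list (V ⊗ W)

query : ⟦ V ⟧ → ⟦ Table ⟧ → List ⟦ W ⟧
query u T = minimum (gather (λ (v , w) → guard (sameV u v) w) T)

queryP : ∀ {Γ u T} → PolyTime Γ V u → PolyTime Γ Table T → PolyTime Γ (list W) (λ γ → query (u γ) (T γ))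
queryP U T = minimumP (gatherP T (guardP (sameVP (U ∘P fstP) (fstP ∘P sndP)) (sndP ∘P sndP)))

zeroW : ⟦ W ⟧
zeroW = [] , []

zeroWP : ∀ {Γ} → PolyTime Γ W (λ _ → zeroW)
zeroWP = ⟨ []P , []P ⟩P

extensions : ⟦ Table ⟧ → ⟦ Arc ⟧ → ⟦ Table ⟧
extensions T (u , v , w) = gather (λ q → (v , addW q w) ∷ []) (query u T)

-- The table is rebuilt instead of extended, so its length does not grow with the rounds. Entering
-- `s` anew each time makes round `n` cover all walks of at most `n` arcs instead of exactly `n`.
bfRound : ⟦ list Arc ⟧ → ⟦ V ⟧ → ⟦ Table ⟧ → ⟦ Table ⟧
bfRound arcs s T = (s , zeroW) ∷ gather (extensions T) arcs

bfRoundP : ∀ {Γ arcs s T} → PolyTime Γ (list Arc) arcs → PolyTime Γ V s → PolyTime Γ Table T →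
           PolyTime Γ Table (λ γ → bfRound (arcs γ) (s γ) (T γ))
bfRoundP A S T = ⟨ S , zeroWP ⟩P ∷P gatherP A
  (gatherP (queryP (fstP ∘P sndP) (T ∘P fstP))
    (⟨ fstP ∘P sndP ∘P sndP ∘P fstP , addWP sndP (sndP ∘P sndP ∘P sndP ∘P fstP) ⟩P ∷P []P))

-- Only the length of `fuel` matters. The list of edges will serve as fuel.
bellmanFord : ∀ {A : Set} → ⟦ list Arc ⟧ → ⟦ V ⟧ → List A → ⟦ Table ⟧
bellmanFord arcs s fuel = foldl (λ T _ → bfRound arcs s T) ((s , zeroW) ∷ []) fuel

∈-query⁻ : ∀ {u m} T → m ∈ query u T →
           (u , m) ∈ T × (∀ {w} → (u , w) ∈ T → wvalue m ≤ₗ wvalue w)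
∈-query⁻ {u} T m∈ with minimum-least _ m∈
... | m∈′ , least with ∈-gather⁻ (λ (v , w) → guard (sameV u v) w) T m∈′
...   | (v , w) , vw∈ , m∈″ with ∈-guard⁻ (sameV u v) m∈″
...     | same , refl with sameV-sound u v same
...       | refl = vw∈ ,
  λ w∈ → least (∈-gather⁺ (λ (v , w) → guard (sameV u v) w) w∈ (∈-guard⁺ (sameV-refl u)))

∈-query⁺ : ∀ {u w T} → (u , w) ∈ T → ∃[ m ] m ∈ query u T
∈-query⁺ {u} w∈ =
  minimum-exists (∈-gather⁺ (λ (v , w) → guard (sameV u v) w) w∈ (∈-guard⁺ (sameV-refl u)))

∈-extensions⁻ : ∀ {x} T a → x ∈ extensions T a →
                ∃[ q ] q ∈ query (proj₁ a) T × x ≡ (proj₁ (proj₂ a) , addW q (proj₂ (proj₂ a)))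
∈-extensions⁻ T (u , v , w) x∈ with ∈-gather⁻ (λ q → (v , addW q w) ∷ []) (query u T) x∈
... | q , q∈ , here eq = q , q∈ , eq

data Walk (arcs : ⟦ list Arc ⟧) (s : ⟦ V ⟧) : ℕ → ⟦ V ⟧ → ℕ × ℕ → Set where
  start  : Walk arcs s 0 s (0 , 0)
  extend : ∀ {k u v w x} → Walk arcs s k u x → (u , v , w) ∈ arcs →
           Walk arcs s (suc k) v (x +ₗ wvalue w)

module _ (arcs : ⟦ list Arc ⟧) (s : ⟦ V ⟧) where

  Sound : ⟦ Table ⟧ → Set
  Sound T = ∀ {v q} → (v , q) ∈ T → ∃[ k ] Walk arcs s k v (wvalue q)

  -- An inequality is enough, because `Sound` supplies a walk that realises each label.
  Complete : ℕ → ⟦ Table ⟧ → Set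
  Complete n T = ∀ {k v x} → Walk arcs s k v x → k ≤ n → ∃[ q ] (v , q) ∈ T × wvalue q ≤ₗ x

  bfRound-sound : ∀ {T} → Sound T → Sound (bfRound arcs s T)
  bfRound-sound sound (here refl) = 0 , start
  bfRound-sound {T} sound (there vq∈) with ∈-gather⁻ (extensions T) arcs vq∈
  ... | (u , v , w) , a∈ , vq∈′ with ∈-extensions⁻ T (u , v , w) vq∈′
  ...   | q , q∈ , refl with sound (proj₁ (∈-query⁻ T q∈))
  ...     | k , walk = suc k , subst (Walk arcs s (suc k) v) (sym (wvalue-addW q w)) (extend walk a∈)

  bfRound-complete : ∀ {n T} → Complete n T → Complete (suc n) (bfRound arcs s T)
  bfRound-complete complete start _ = zeroW , here refl , ≤ₗ-refl
  bfRound-complete {T = T} complete (extend {u = u} {v} {w} walk a∈) (s≤s k≤n)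
    with complete walk k≤n
  ... | q , q∈ , q≤x with ∈-query⁺ q∈
  ...   | m , m∈ =
    addW m w ,
    there (∈-gather⁺ (extensions T) a∈ (∈-gather⁺ (λ q → (v , addW q w) ∷ []) m∈ (here refl))) ,
    subst (_≤ₗ _) (sym (wvalue-addW m w))
      (+ₗ-monoˡ (wvalue w) (≤ₗ-trans (proj₂ (∈-query⁻ T m∈) q∈) q≤x))

  module _ {A : Set} (fuel : List A) where

    bellmanFord-sound : Sound (bellmanFord arcs s fuel)
    bellmanFord-sound = go fuel λ { (here refl) → 0 , start }
      where
      go : ∀ (fuel : List A) {T} → Sound T → Sound (foldl (λ T _ → bfRound arcs s T) T fuel)
      go []         sound = sound
      go (_ ∷ fuel) sound = go fuel (bfRound-sound sound)

    bellmanFord-complete : Complete (length fuel) (bellmanFord arcs s fuel)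
    bellmanFord-complete =
      subst (λ n → Complete n (bellmanFord arcs s fuel)) (+-identityʳ _) (go fuel initial)
      where
      initial : Complete 0 ((s , zeroW) ∷ [])
      initial start        _ = zeroW , here refl , ≤ₗ-refl
      initial (extend _ _) ()
      go : ∀ (fuel : List A) {n T} → Complete n T →
           Complete (length fuel + n) (foldl (λ T _ → bfRound arcs s T) T fuel)
      go []         complete = complete
      go (_ ∷ fuel) {n} {T} complete =
        subst (λ n → Complete n (foldl (λ T _ → bfRound arcs s T) (bfRound arcs s T) fuel))
          (+-suc (length fuel) n) (go fuel (bfRound-complete complete))

    distance : ⟦ V ⟧ → List ⟦ W ⟧
    distance v = query v (bellmanFord arcs s fuel)

    distance-walk : ∀ {v m} → m ∈ distance v → ∃[ k ] Walk arcs s k v (wvalue m)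
    distance-walk m∈ = bellmanFord-sound (proj₁ (∈-query⁻ _ m∈))

    distance-least : ∀ {v m k x} → m ∈ distance v → Walk arcs s k v x → k ≤ length fuel → wvalue m ≤ₗ x
    distance-least m∈ walk k≤ with bellmanFord-complete walk k≤
    ... | q , q∈ , q≤x = ≤ₗ-trans (proj₂ (∈-query⁻ _ m∈) q∈) q≤x

    distance-exists : ∀ {v k x} → Walk arcs s k v x → k ≤ length fuel → ∃[ m ] m ∈ distance v
    distance-exists walk k≤ with bellmanFord-complete walk k≤
    ... | q , q∈ , _ = ∈-query⁺ q∈

-- The size of Bellman-Ford tables

wlength : ⟦ W ⟧ → ℕ
wlength (d , c) = length d + length c

wlength≤size : ∀ w → wlength w ≤ size (enc W w)
wlength≤size (d , c) = ≤-trans (+-mono-≤ (length≤size {bool} d) (length≤size {bool} c)) (n≤1+n _)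

size≤wlength : ∀ w → size (enc W w) ≤ 3 + 4 * wlength w
size≤wlength (d , c) = ≤-trans (s≤s (+-mono-≤ (size≤length d) (size≤length c)))
  (≤-reflexive (lemma (length d) (length c)))
  where
  lemma : ∀ m n → suc (1 + 4 * m + (1 + 4 * n)) ≡ 3 + 4 * (m + n)
  lemma = solve-∀

-- Labels are measured by their number of bits since the tree size of a bit depends on its value.
-- The 2 accounts for one carry in each component.
wlength-addW : ∀ w w′ → wlength (addW w w′) ≡ wlength w + (2 + wlength w′)
wlength-addW (d , c) (d′ , c′) rewrite length-add d d′ | length-add c c′ =
  lemma (length d) (length d′) (length c) (length c′)
  where
  lemma : ∀ k l m n → suc (k + l) + suc (m + n) ≡ k + m + (2 + (l + n))
  lemma = solve-∀

size≤length*max : ∀ {a k} (xs : List ⟦ a ⟧) → (∀ {x} → x ∈ xs → size (enc a x) ≤ k) →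
                  size (enc (list a) xs) ≤ 1 + length xs * suc k
size≤length*max []       _     = ≤-refl
size≤length*max {a} {k} (x ∷ xs) bound =
  s≤s (≤-trans (+-mono-≤ (bound (here refl)) (size≤length*max {a} xs (bound ∘ there)))
    (≤-reflexive (+-suc k _)))

-- For accumulators whose bound depends on the number of steps made. A table is of this kind: what
-- grows by a fixed amount per round is each single label.
along-rank : ∀ {A B : Set} {f : B → A → B} (Inv : ℕ → B → Set) →
             (∀ {k acc} x → Inv k acc → Inv (suc k) (f acc x)) →
             ∀ {k acc} ys → Inv k acc →
             Along f (λ acc → ∃[ j ] j ≤ k + length ys × Inv j acc) acc ys
along-rank Inv next {k} []       inv = [] (k , m≤m+n k 0 , inv)
along-rank Inv next {k} (y ∷ ys) inv = (k , m≤m+n k _ , inv) ∷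
  along-map (λ (j , j≤ , inv) → j , ≤-trans j≤ (≤-reflexive (sym (+-suc k (length ys)))) , inv)
    (along-rank Inv next ys (next y inv))

-- All labels produced in round j are sums of at most j arc weights.
module _ (arcs : ⟦ list Arc ⟧) (s : ⟦ V ⟧) {n : ℕ}
         (arcs≤n : size (enc (list Arc) arcs) ≤ n) (s≤n : size (enc V s) ≤ n) where

  -- A round adds at most `n` bits for the arc and 2 carries to a label, hence `j * (2 + n)`.
  Small : ℕ → ⟦ Table ⟧ → Set
  Small j T = length T ≤ suc (length arcs) ×
              (∀ {v w} → (v , w) ∈ T → size (enc V v) ≤ n × wlength w ≤ j * (2 + n))

  arc-small : ∀ {u v w} → (u , v , w) ∈ arcs → size (enc V v) ≤ n × wlength w ≤ n
  arc-small {u} {v} {w} a∈ =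
    ≤-trans (≤-trans (m≤m+n _ _) (n≤1+n _)) vw≤n ,
    ≤-trans (wlength≤size w) (≤-trans (≤-trans (m≤n+m _ _) (n≤1+n _)) vw≤n)
    where
    vw≤n : size (enc (V ⊗ W) (v , w)) ≤ n
    vw≤n = ≤-trans (≤-trans (m≤n+m _ _) (n≤1+n _)) (≤-trans (∈⇒size≤ {Arc} a∈) arcs≤n)

  small-start : Small 0 ((s , zeroW) ∷ [])
  small-start = s≤s z≤n , λ { (here refl) → s≤n , z≤n }

  small-next : ∀ {j T} → Small j T → Small (suc j) (bfRound arcs s T)
  small-next {j} {T} (_ , small) =
    s≤s (≤-trans (length-gather (extensions T) short arcs) (≤-reflexive (*-identityʳ (length arcs)))) ,
    λ { (here refl) → s≤n , z≤n ; (there vw∈) → entry vw∈ }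
    where
    short : ∀ a → length (extensions T a) ≤ 1
    short (u , v , w) = ≤-trans (length-gather (λ q → (v , addW q w) ∷ []) (λ _ → ≤-refl) (query u T))
      (≤-trans (≤-reflexive (*-identityʳ (length (query u T)))) (length-minimum (gather (λ (v , w) → guard (sameV u v) w) T)))
    entry : ∀ {v w} → (v , w) ∈ gather (extensions T) arcs →
            size (enc V v) ≤ n × wlength w ≤ suc j * (2 + n)
    entry vw∈ with ∈-gather⁻ (extensions T) arcs vw∈
    ... | (u , v , w) , a∈ , vw∈′ with ∈-extensions⁻ T (u , v , w) vw∈′
    ...   | q , q∈ , refl =
      proj₁ (arc-small a∈) ,
      ≤-trans (≤-reflexive (trans (wlength-addW q w) (+-comm (wlength q) _)))
        (+-mono-≤ (+-monoʳ-≤ 2 (proj₂ (arc-small a∈))) (proj₂ (small (proj₁ (∈-query⁻ T q∈)))))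

  small-size : ∀ {j T} → Small j T →
               size (enc Table T) ≤ 1 + suc n * suc (1 + (n + (3 + 4 * (j * (2 + n)))))
  small-size {j} {T} (short , small) = ≤-trans
    (size≤length*max {V ⊗ W} T λ { {v , w} vw∈ → s≤s (+-mono-≤ (proj₁ (small vw∈))
      (≤-trans (size≤wlength w) (+-monoʳ-≤ 3 (*-monoʳ-≤ 4 (proj₂ (small vw∈)))))) })
    (s≤s (*-monoˡ-≤ (suc (1 + (n + (3 + 4 * (j * (2 + n))))))
      (≤-trans short (s≤s (≤-trans (length≤size {Arc} arcs) arcs≤n)))))

bellmanFordP : ∀ {Γ a arcs s} {fuel : ⟦ Γ ⟧ → List ⟦ a ⟧} → PolyTime Γ (list Arc) arcs → PolyTime Γ V s →
               PolyTime Γ (list a) fuel →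
               PolyTime Γ Table (λ γ → bellmanFord (arcs γ) (s γ) (fuel γ))
bellmanFordP {Γ} {a} {arcs} {s} {fuel} A S F = foldP
  (⟨ S , zeroWP ⟩P ∷P []P) F (bfRoundP (A ∘P γP) (S ∘P γP) accP) tableSize
  λ γ → along-map (λ {T} → bound γ {T})
    (along-rank (Small (arcs γ) (s γ) (A≤ γ) (S≤ γ))
      (λ {j} {T} _ → small-next (arcs γ) (s γ) (A≤ γ) (S≤ γ) {j} {T})
      (fuel γ) (small-start (arcs γ) (s γ) (A≤ γ) (S≤ γ)))
  where
  n : Poly
  n = room A ⊕ room S
  tableSize : Poly
  tableSize = con 1 ⊕ (con 1 ⊕ n) ⊛ (con 2 ⊕ (n ⊕ (con 3 ⊕ con 4 ⊛ (room F ⊛ (con 2 ⊕ n)))))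
  A≤ : ∀ γ → size (enc (list Arc) (arcs γ)) ≤ n at size (enc Γ γ)
  A≤ γ = ≤-trans (fits A γ) (m≤m+n _ _)
  S≤ : ∀ γ → size (enc V (s γ)) ≤ n at size (enc Γ γ)
  S≤ γ = ≤-trans (fits S γ) (m≤n+m _ _)
  bound : ∀ γ {T} → ∃[ j ] j ≤ length (fuel γ) × Small (arcs γ) (s γ) (A≤ γ) (S≤ γ) j T →
          size (enc Table T) ≤ tableSize at size (enc Γ γ)
  bound γ {T} (j , j≤ , small) = ≤-trans (small-size (arcs γ) (s γ) (A≤ γ) (S≤ γ) {j} {T} small)
    (s≤s (*-monoʳ-≤ (suc k) (+-monoʳ-≤ 2 (+-monoʳ-≤ k (+-monoʳ-≤ 3
      (*-monoʳ-≤ 4 (*-monoˡ-≤ (2 + k) (≤-trans j≤ (≤-trans (length≤size {a} (fuel γ)) (fits F γ))))))))))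
    where
    k = n at size (enc Γ γ)

-- Scaling to a common denominator

sameBits : List Bool → List Bool → Bool
sameBits xs ys = if leq xs ys then leq ys xs else false

sameBitsP : ∀ {Γ f g} → PolyTime Γ bits f → PolyTime Γ bits g →
            PolyTime Γ bool (λ γ → sameBits (f γ) (g γ))
sameBitsP F G = ifP (leqP F G) (leqP G F) falseP

sameBits-sound : ∀ xs ys → sameBits xs ys ≡ true → value xs ≡ value ys
sameBits-sound xs ys eq with leq xs ys | leq-decides xs ys
... | true | ≤ys , _ = ≤-antisym (≤ys refl) (proj₁ (leq-decides ys xs) eq)

sameBits-refl : ∀ xs → sameBits xs xs ≡ true
sameBits-refl xs with leq xs xs in eq
... | true  = refl
... | false = trans (sym eq) (proj₂ (leq-decides xs xs) ≤-refl)

ExceptState : Ty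
ExceptState = bool ⊗ bits

exceptStep : List Bool → ⟦ ExceptState ⟧ → List Bool → ⟦ ExceptState ⟧
exceptStep d (pending , acc) x =
  if pending then (if sameBits d x then (false , acc) else (true , mul acc x)) else (false , mul acc x)

-- Leaves out the first occurrence of d, which replaces the division of the
-- common denominator by d.
productExcept : List Bool → List (List Bool) → List Bool
productExcept d ds = proj₂ (foldl (exceptStep d) (true , true ∷ []) ds)

productExceptP : ∀ {Γ f g} → PolyTime Γ bits f → PolyTime Γ (list bits) g →
                 PolyTime Γ bits (λ γ → productExcept (f γ) (g γ))
productExceptP {Γ} {f} F G = sndP ∘P growthFoldP {b = ExceptState} ⟨ trueP , trueP ∷P []P ⟩P G
  (ifP (fstP ∘P accP)
    (ifP (sameBitsP (F ∘P γP) sndP) ⟨ falseP , sndP ∘P accP ⟩P ⟨ trueP , product ⟩P)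
    ⟨ falseP , product ⟩P)
  (λ p → length (proj₂ p)) (con 1) (con 1 ⊕ 𝕏) (con 5 ⊕ con 4 ⊛ 𝕏) (λ _ → ≤-refl)
  (λ γ acc x → grow (f γ) (proj₁ acc) (proj₂ acc) x) (λ acc → bound (proj₁ acc) (proj₂ acc))
  where
  product : PolyTime ((Γ ⊗ ExceptState) ⊗ bits) bits _
  product = mulP (sndP ∘P accP) sndP
  grown : ∀ {k} acc x → length (mul acc x) ≤ length acc + (1 + (k + size (enc bits x)))
  grown {k} acc x = ≤-trans (length-mul acc x)
    (+-monoʳ-≤ (length acc) (s≤s (≤-trans (length≤size {bool} x) (m≤n+m _ k))))
  grow : ∀ {k} d pending acc x → length (proj₂ (exceptStep d (pending , acc) x)) ≤
         length acc + (1 + (k + size (enc bits x)))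
  grow d false acc x = grown acc x
  grow d true  acc x with sameBits d x
  ... | true  = m≤m+n _ _
  ... | false = grown acc x
  bound : ∀ p acc → size (enc ExceptState (p , acc)) ≤ 5 + 4 * length acc
  bound true  acc = s≤s (+-monoʳ-≤ 3 (size≤length acc))
  bound false acc = s≤s (≤-trans (+-monoʳ-≤ 1 (size≤length acc)) (m≤n+m _ 2))

productOf : List (List Bool) → ℕ
productOf = foldr (λ d p → value d * p) 1

-- The test compares values, so the factor left out has the value of `d` whichever occurrence it is;
-- membership of `d` ensures that some factor is left out.
value-productExcept : ∀ {d ds} → d ∈ ds → value (productExcept d ds) * value d ≡ productOf ds
value-productExcept {d} {ds} d∈ = trans (pending ds (true ∷ []) d∈) (*-identityˡ (productOf ds))
  where
  open ≡-Reasoning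
  rest : ∀ ds acc → value (proj₂ (foldl (exceptStep d) (false , acc) ds)) ≡ value acc * productOf ds
  rest []       acc = sym (*-identityʳ (value acc))
  rest (x ∷ ds) acc = begin
    value (proj₂ (foldl (exceptStep d) (false , mul acc x) ds)) ≡⟨ rest ds (mul acc x) ⟩
    value (mul acc x) * productOf ds       ≡⟨ cong (_* productOf ds) (value-mul acc x) ⟩
    value acc * value x * productOf ds     ≡⟨ *-assoc (value acc) _ _ ⟩
    value acc * (value x * productOf ds)   ∎
  lemma : ∀ a p x → a * p * x ≡ a * (x * p)
  lemma = solve-∀
  pending : ∀ ds acc → d ∈ ds →
            value (proj₂ (foldl (exceptStep d) (true , acc) ds)) * value d ≡ value acc * productOf ds
  pending (x ∷ ds) acc d∈ with sameBits d x in eq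
  ... | true = begin
    value (proj₂ (foldl (exceptStep d) (false , acc) ds)) * value d
      ≡⟨ cong₂ _*_ (rest ds acc) (sameBits-sound d x eq) ⟩
    value acc * productOf ds * value x
      ≡⟨ lemma (value acc) (productOf ds) (value x) ⟩
    value acc * (value x * productOf ds) ∎
  pending (x ∷ ds) acc (here refl) | false =
    contradiction (trans (sym (sameBits-refl x)) eq) (λ ())
  pending (x ∷ ds) acc (there d∈)  | false = begin
    value (proj₂ (foldl (exceptStep d) (true , mul acc x) ds)) * value d
      ≡⟨ pending ds (mul acc x) d∈ ⟩
    value (mul acc x) * productOf ds       ≡⟨ cong (_* productOf ds) (value-mul acc x) ⟩
    value acc * value x * productOf ds     ≡⟨ *-assoc (value acc) _ _ ⟩
    value acc * (value x * productOf ds)   ∎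

-- Numerator and denominator
Frac : Ty
Frac = bits ⊗ bits

scale : List (List Bool) → ⟦ Frac ⟧ → List Bool
scale ds (n , d) = mul n (productExcept d ds)

scaleP : ∀ {Γ f g} → PolyTime Γ (list bits) f → PolyTime Γ Frac g → PolyTime Γ bits (λ γ → scale (f γ) (g γ))
scaleP F G = mulP (fstP ∘P G) (productExceptP (sndP ∘P G) F)

value-scale : ∀ {n d ds} → d ∈ ds → value (scale ds (n , d)) * value d ≡ value n * productOf ds
value-scale {n} {d} {ds} d∈ = trans (cong (_* value d) (value-mul n (productExcept d ds)))
  (trans (*-assoc (value n) _ _) (cong (value n *_) (value-productExcept {d} {ds} d∈)))

-- The algorithm

RawEdge Edge : Ty
RawEdge = V ⊗ V ⊗ bool ⊗ Frac ⊗ Frac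
Edge    = V ⊗ V ⊗ bool ⊗ W

followerArcs : ⟦ list Edge ⟧ → ⟦ list Arc ⟧
followerArcs = gather (λ (u , v , l , w) → if l then [] else (u , v , w) ∷ [])

followerArcsP : ∀ {Γ es} → PolyTime Γ (list Edge) es → PolyTime Γ (list Arc) (λ γ → followerArcs (es γ))
followerArcsP E = gatherP E (ifP (fstP ∘P sndP ∘P sndP ∘P sndP) []P
  (⟨ fstP ∘P sndP , ⟨ fstP ∘P sndP ∘P sndP , sndP ∘P sndP ∘P sndP ∘P sndP ⟩P ⟩P ∷P []P))

-- Lexicographic minimality makes the segment optimal for the follower and, among
-- the optimal ones, cheapest for the leader.
segment : ⟦ list Edge ⟧ → ⟦ V ⟧ → ⟦ V ⟧ → List ⟦ W ⟧
segment es u v = distance (followerArcs es) u es v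

segmentP : ∀ {Γ es u v} → PolyTime Γ (list Edge) es → PolyTime Γ V u → PolyTime Γ V v →
           PolyTime Γ (list W) (λ γ → segment (es γ) (u γ) (v γ))
segmentP E U V′ = queryP V′ (bellmanFordP (followerArcsP E) U E)

-- A follower segment starts at `s` or behind a leader edge. Listing the targets of follower edges
-- too is harmless, as a composite walk from `s` visits only `s` and targets of leader edges.
segmentStarts : ⟦ V ⟧ → ⟦ list Edge ⟧ → ⟦ list V ⟧
segmentStarts s es = s ∷ gather (λ (u , v , l , w) → v ∷ []) es

segmentStartsP : ∀ {Γ s es} → PolyTime Γ V s → PolyTime Γ (list Edge) es →
                 PolyTime Γ (list V) (λ γ → segmentStarts (s γ) (es γ))
segmentStartsP S E = S ∷P gatherP E ((fstP ∘P sndP ∘P sndP) ∷P []P)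

arcsThrough : ⟦ list Edge ⟧ → ⟦ V ⟧ → ⟦ Edge ⟧ → ⟦ list Arc ⟧
arcsThrough es u (x , v , l , (d , c)) =
  if l then gather (λ m → (u , v , ([] , add (proj₂ m) c)) ∷ []) (segment es u x) else []

-- A composite arc is a follower segment followed by a leader edge; its
-- weight ignores the follower's objective.
compositeArcs : ⟦ list Edge ⟧ → ⟦ V ⟧ → ⟦ list Arc ⟧
compositeArcs es s = gather (λ u → gather (arcsThrough es u) es) (segmentStarts s es)

arcsThroughP : ∀ {Γ es u e} → PolyTime Γ (list Edge) es → PolyTime Γ V u → PolyTime Γ Edge e →
               PolyTime Γ (list Arc) (λ γ → arcsThrough (es γ) (u γ) (e γ))
arcsThroughP E U F = ifP (fstP ∘P sndP ∘P sndP ∘P F)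
  (gatherP (segmentP E U (fstP ∘P F))
    (⟨ U ∘P fstP , ⟨ fstP ∘P sndP ∘P F ∘P fstP
       , ⟨ []P , addP (sndP ∘P sndP) (sndP ∘P sndP ∘P sndP ∘P sndP ∘P F ∘P fstP) ⟩P ⟩P ⟩P ∷P []P))
  []P

compositeArcsP : ∀ {Γ es s} → PolyTime Γ (list Edge) es → PolyTime Γ V s →
                 PolyTime Γ (list Arc) (λ γ → compositeArcs (es γ) (s γ))
compositeArcsP E S = gatherP (segmentStartsP S E)
  (gatherP (E ∘P fstP) (arcsThroughP (E ∘P fstP ∘P fstP) (sndP ∘P fstP) sndP))

accepting : ⟦ list Edge ⟧ → ⟦ V ⟧ → ⟦ V ⟧ → List Bool → ⟦ V ⟧ → List ⊤
accepting es s t T u =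
  gather (λ m → gather (λ m′ → guard (leq (add (proj₂ m) (proj₂ m′)) T) tt) (segment es u t))
         (distance (compositeArcs es s) s es u)

accept : ⟦ list Edge ⟧ → ⟦ V ⟧ → ⟦ V ⟧ → List Bool → Bool
accept es s t T = nonempty (gather (accepting es s t T) (segmentStarts s es))

acceptP : ∀ {Γ es s t T} → PolyTime Γ (list Edge) es → PolyTime Γ V s → PolyTime Γ V t →
          PolyTime Γ bits T → PolyTime Γ bool (λ γ → accept (es γ) (s γ) (t γ) (T γ))
acceptP E S T B = nonemptyP ∘P gatherP (segmentStartsP S E)
  (gatherP (queryP sndP (bellmanFordP (compositeArcsP (E ∘P fstP) (S ∘P fstP)) (S ∘P fstP) (E ∘P fstP)))
    (gatherP (segmentP (E ∘P fstP ∘P fstP) (sndP ∘P fstP) (T ∘P fstP ∘P fstP))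
      (guardP (leqP (addP (sndP ∘P sndP ∘P fstP) (sndP ∘P sndP)) (B ∘P fstP ∘P fstP ∘P fstP)) ttP)))

InputTy : Ty
InputTy = (V ⊗ list RawEdge ⊗ V ⊗ V) ⊗ Frac

-- The denominator of the threshold takes part, so that the threshold is scaled by the same factor
-- as the weights.
denominators : ⟦ list RawEdge ⟧ → ⟦ Frac ⟧ → List (List Bool)
denominators es T = proj₂ T ∷ gather (λ (u , v , l , c , d) → proj₂ c ∷ proj₂ d ∷ []) es

-- The weights change places: an instance lists the leader's weight first, whereas the lexicographic
-- order of `W` needs the follower's weight first.
scaleEdge : List (List Bool) → ⟦ RawEdge ⟧ → ⟦ Edge ⟧
scaleEdge ds (u , v , l , c , d) = u , v , l , scale ds d , scale ds c

scaleEdges : List (List Bool) → ⟦ list RawEdge ⟧ → ⟦ list Edge ⟧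
scaleEdges ds = gather (λ e → scaleEdge ds e ∷ [])

decide : ⟦ InputTy ⟧ → Bool
decide ((_ , es , s , t) , T) =
  let ds = denominators es T in accept (scaleEdges ds es) s t (scale ds T)

decideP : PolyTime InputTy bool decide
decideP = acceptP edgesP (fstP ∘P sndP ∘P sndP ∘P fstP) (sndP ∘P sndP ∘P sndP ∘P fstP)
            (scaleP dsP sndP)
  where
  esP = fstP ∘P sndP ∘P fstP {V ⊗ list RawEdge ⊗ V ⊗ V} {Frac}
  dsP : PolyTime InputTy (list bits) (λ i → denominators (proj₁ (proj₂ (proj₁ i))) (proj₂ i))
  dsP = (sndP ∘P sndP) ∷P gatherP esP
    ((sndP ∘P fstP ∘P sndP ∘P sndP ∘P sndP ∘P sndP) ∷P
     (sndP ∘P sndP ∘P sndP ∘P sndP ∘P sndP ∘P sndP) ∷P []P)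
  edgesP : PolyTime InputTy (list Edge)
             (λ i → let es = proj₁ (proj₂ (proj₁ i)) in scaleEdges (denominators es (proj₂ i)) es)
  edgesP = gatherP esP
    (⟨ fstP ∘P sndP , ⟨ fstP ∘P sndP ∘P sndP , ⟨ fstP ∘P sndP ∘P sndP ∘P sndP ,
       ⟨ scaleP (dsP ∘P fstP) (sndP ∘P sndP ∘P sndP ∘P sndP ∘P sndP)
       , scaleP (dsP ∘P fstP) (fstP ∘P sndP ∘P sndP ∘P sndP ∘P sndP) ⟩P ⟩P ⟩P ⟩P ∷P []P)

-- Walks in an acyclic digraph

Unique⇒length≤ : ∀ {n} {xs : List (Fin n)} → Unique xs → length xs ≤ n
Unique⇒length≤ {xs = xs} unique = Fin.injective⇒≤ (injective xs unique)
  where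
  injective : ∀ {A : Set} (xs : List A) → Unique xs →
              ∀ {i j} → List.lookup xs i ≡ List.lookup xs j → i ≡ j
  injective (x ∷ xs) (x∉ ∷ u) {zero}  {zero}  eq = refl
  injective (x ∷ xs) (x∉ ∷ u) {zero}  {suc j} eq = contradiction eq (All.lookup x∉ (∈-lookup j))
  injective (x ∷ xs) (x∉ ∷ u) {suc i} {zero}  eq = contradiction (sym eq) (All.lookup x∉ (∈-lookup i))
  injective (x ∷ xs) (x∉ ∷ u) {suc i} {suc j} eq = cong suc (injective xs u eq)

-- If the heads differed, each would occur in the tail of the other list, and so each would precede
-- the other.
sorted-unique : ∀ {A : Set} {P : A → A → Set} → (∀ {a} → ¬ P a a) →
                (∀ {a b} → P a b → ¬ P b a) →
                ∀ {xs ys} → AllPairs P xs → AllPairs P ys →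
                (∀ {e} → e ∈ xs → e ∈ ys) → (∀ {e} → e ∈ ys → e ∈ xs) → xs ≡ ys
sorted-unique irr asym {[]}     {[]}     _ _ _ _ = refl
sorted-unique irr asym {[]}     {y ∷ ys} _ _ _ ys⊆ = contradiction (ys⊆ (here refl)) λ ()
sorted-unique irr asym {x ∷ xs} {[]}     _ _ xs⊆ _ = contradiction (xs⊆ (here refl)) λ ()
sorted-unique {P = P} irr asym {x ∷ xs} {y ∷ ys} (Px ∷ sorted) (Py ∷ sorted′) xs⊆ ys⊆ =
  cong₂ _∷_ x≡y (sorted-unique irr asym sorted sorted′ tail⊆ tail⊇)
  where
  x≡y : x ≡ y
  x≡y with xs⊆ (here refl) | ys⊆ (here refl)
  ... | here eq   | _         = eq
  ... | there _   | here eq   = sym eq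
  ... | there x∈  | there y∈  = contradiction (All.lookup Px y∈) (asym (All.lookup Py x∈))
  tail⊆ : ∀ {e} → e ∈ xs → e ∈ ys
  tail⊆ e∈ with xs⊆ (there e∈)
  ... | there e∈ys = e∈ys
  ... | here refl  = contradiction (subst (P x) (sym x≡y) (All.lookup Px e∈)) irr
  tail⊇ : ∀ {e} → e ∈ ys → e ∈ xs
  tail⊇ e∈ with ys⊆ (there e∈)
  ... | there e∈xs = e∈xs
  ... | here refl  = contradiction (subst (P y) x≡y (All.lookup Py e∈)) irr

total : ∀ {A : Set} → (A → ℕ) → List A → ℕ
total w = foldr (λ e n → w e + n) 0

total-++ : ∀ {A : Set} (w : A → ℕ) es fs → total w (es ++ fs) ≡ total w es + total w fs
total-++ w []       fs = refl
total-++ w (e ∷ es) fs = trans (cong (w e +_) (total-++ w es fs)) (sym (+-assoc (w e) _ _))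

module Walks (G : Digraph) where

  open Digraph G hiding (V)

  ++-walk : ∀ {u v w es fs} → IsWalk u es v → IsWalk v fs w → IsWalk u (es ++ fs) w
  ++-walk stop       q = q
  ++-walk (step p)   q = step (++-walk p q)

  split-walk : ∀ {u w} es {fs} → IsWalk u (es ++ fs) w → ∃[ v ] IsWalk u es v × IsWalk v fs w
  split-walk []       p        = _ , stop , p
  split-walk (e ∷ es) (step p) with split-walk es p
  ... | v , q , r = v , step q , r

  walk-to : ∀ {u v e es} → IsWalk u es v → e ∈ es → ∃[ ws ] IsWalk u ws (source e)
  walk-to (step p) (here refl) = [] , stop
  walk-to (step {e} p) (there e∈) with walk-to p e∈
  ... | ws , q = e ∷ ws , step q

  Precedes : E → E → Set
  Precedes a b = ∃[ ws ] IsWalk (target a) ws (source b)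

  walk-sorted : ∀ {u v es} → IsWalk u es v → AllPairs Precedes es
  walk-sorted stop     = []
  walk-sorted (step p) = All.tabulate (walk-to p) ∷ walk-sorted p

  module _ (acyclic : Acyclic) where

    no-cycle : ∀ {u e es} → ¬ IsWalk u (es ++ e ∷ []) u
    no-cycle {es = []}    p = contradiction (acyclic _ _ p) λ ()
    no-cycle {es = _ ∷ _} p = contradiction (acyclic _ _ p) λ ()

    Precedes-irrefl : ∀ {a} → ¬ Precedes a a
    Precedes-irrefl (_ , p) = no-cycle (++-walk p (step stop))

    Precedes-asym : ∀ {a b} → Precedes a b → ¬ Precedes b a
    Precedes-asym (_ , p) (_ , q) = Precedes-irrefl (_ , ++-walk p (step q))

    walk-unique : ∀ {u v es} → IsWalk u es v → Unique es
    walk-unique p = AllPairs.map (λ { a≺b refl → Precedes-irrefl a≺b }) (walk-sorted p)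

    walk-short : ∀ {u v es} → IsWalk u es v → length es ≤ #E
    walk-short p = Unique⇒length≤ (walk-unique p)

    no-return : ∀ {u v e es} → IsWalk u es v → e ∈ es → u ≢ target e
    no-return p e∈ eq with walk-to p e∈
    ... | _ , q = no-cycle (subst (IsWalk _ _) (sym eq) (++-walk q (step stop)))

    walk-simple : ∀ {u v es} → IsWalk u es v → Unique (u ∷ map target es)
    walk-simple stop       = [] ∷ []
    walk-simple p@(step q) = All.tabulate fresh ∷ walk-simple q
      where
      fresh : ∀ {x} → x ∈ map target _ → _ ≢ x
      fresh x∈ eq with ∈-map⁻ target x∈
      ... | _ , e∈ , eq′ = no-return p e∈ (trans eq eq′)

  -- Leader edges and optimal follower segments

  module Leaders (Eˡ : Subset #E) where

    leaders : List E → List E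
    leaders = filter (_∈? Eˡ)

    -- In an acyclic digraph the edges of a walk come in a fixed order, so
    -- the leader's choice determines the endpoints of all follower segments.
    leaders-determined : Acyclic → ∀ {u v u′ v′ es fs} → IsWalk u es v → IsWalk u′ fs v′ →
      (∀ {e} → e ∈ₛ Eˡ → e ∈ es → e ∈ fs) → (∀ {e} → e ∈ₛ Eˡ → e ∈ fs → e ∈ es) →
      leaders es ≡ leaders fs
    leaders-determined acyclic p q es⊆ fs⊆ =
      sorted-unique (Precedes-irrefl acyclic) (Precedes-asym acyclic)
        (AllPairs.filter⁺ (_∈? Eˡ) (walk-sorted p)) (AllPairs.filter⁺ (_∈? Eˡ) (walk-sorted q))
        (transfer es⊆) (transfer fs⊆)
      where
      transfer : ∀ {xs ys} → (∀ {e} → e ∈ₛ Eˡ → e ∈ xs → e ∈ ys) → ∀ {e} → e ∈ leaders xs → e ∈ leaders ys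
      transfer xs⊆ e∈ with ∈-filter⁻ (_∈? Eˡ) e∈
      ... | e∈xs , e∈L = ∈-filter⁺ (_∈? Eˡ) (xs⊆ e∈L e∈xs) e∈L

    -- Cuts at the last leader edge, because `Good` grows at its end.
    leaders-split : ∀ {e} zs ls → leaders zs ≡ ls ++ e ∷ [] →
                    ∃[ ys ] ∃[ gs ] zs ≡ ys ++ e ∷ gs × leaders ys ≡ ls × leaders gs ≡ []
    leaders-split [] []      ()
    leaders-split [] (_ ∷ _) ()
    leaders-split (z ∷ zs) ls eq with z ∈? Eˡ
    leaders-split (z ∷ zs) []       eq | yes z∈ with ∷-injective eq
    ... | refl , none = [] , zs , refl , refl , none
    leaders-split (z ∷ zs) (l ∷ ls) eq | yes z∈ with leaders-split zs ls (∷-injectiveʳ eq)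
    ... | ys , gs , refl , eq′ , none = z ∷ ys , gs , refl ,
      trans (filter-accept (_∈? Eˡ) z∈) (cong₂ _∷_ (∷-injectiveˡ eq) eq′) , none
    leaders-split (z ∷ zs) ls eq | no z∉ with leaders-split zs ls eq
    ... | ys , gs , refl , eq′ , none =
      z ∷ ys , gs , refl , trans (filter-reject (_∈? Eˡ) z∉) eq′ , none

    FollowerWalk : Fin #V → List E → Fin #V → Set
    FollowerWalk u es v = IsWalk u es v × leaders es ≡ []

    module Bilevel (d : E → ℕ) where

      Optimal : Fin #V → List E → Fin #V → Set
      Optimal u fs v = FollowerWalk u fs v × (∀ gs → FollowerWalk u gs v → total d fs ≤ total d gs)

      -- Walks from s that are empty or end with a leader edge, all of whose
      -- follower segments are optimal; the number counts the leader edges.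
      data Good (s : Fin #V) : ℕ → Fin #V → List E → Set where
        start  : Good s 0 s []
        extend : ∀ {k u es fs e} → Good s k u es → Optimal u fs (source e) → e ∈ₛ Eˡ →
                 Good s (suc k) (target e) (es ++ fs ++ e ∷ [])

      good-walk : ∀ {s k u es} → Good s k u es → IsWalk s es u
      good-walk start                       = stop
      good-walk (extend good ((p , _) , _) _) = ++-walk (good-walk good) (++-walk p (step stop))

      -- Every composite arc consumes a leader edge of the walk, so as many rounds as there are
      -- edges are enough for composite walks as well.
      good-length : ∀ {s k u es} → Good s k u es → k ≤ length es
      good-length start = z≤n
      good-length (extend {k} {es = es} {fs} {e} good _ _) = begin
        suc k                                   ≤⟨ s≤s (good-length good) ⟩
        suc (length es)                         ≤⟨ m≤m+n _ (length fs) ⟩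
        suc (length es + length fs)             ≡⟨ lemma (length es) (length fs) ⟩
        length es + (length fs + 1)             ≡⟨ cong (length es +_) (length-++ fs) ⟨
        length es + length (fs ++ e ∷ [])       ≡⟨ length-++ es ⟨
        length (es ++ fs ++ e ∷ [])             ∎
        where
        open ≤-Reasoning
        lemma : ∀ m n → suc (m + n) ≡ m + (n + 1)
        lemma = solve-∀

      -- The follower's optimality in terms of walks: the leader edges contribute equally to both
      -- totals, so comparing whole walks amounts to comparing the responses.
      ResponseOptimal : Fin #V → Fin #V → List E → Set
      ResponseOptimal s t es =
        ∀ es′ → IsWalk s es′ t → leaders es′ ≡ leaders es → total d es ≤ total d es′

      -- Exchanging a follower segment for another one with the same endpoints keeps the sequence of
      -- leader edges, so a cheaper segment would give a cheaper response.
      decompose : ∀ {s t es} → IsWalk s es t → ResponseOptimal s t es →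
                  ∃[ k ] ∃[ u ] ∃[ ps ] ∃[ fs ] Good s k u ps × Optimal u fs t × ps ++ fs ≡ es
      decompose {s} {t} p opt = go start stop refl p opt
        where
        exchange : ∀ {k u ps fs x zs} → Good s k u ps → FollowerWalk u fs x → IsWalk x zs t →
                   ResponseOptimal s t ((ps ++ fs) ++ zs) → Optimal u fs x
        exchange {ps = ps} {fs} {zs = zs} good (p , none) q opt = (p , none) , λ gs (r , none′) →
          +-cancelˡ-≤ (total d ps) _ _ (+-cancelʳ-≤ (total d zs) _ _ (begin
            total d ps + total d fs + total d zs   ≡⟨ total-++₃ ps fs zs ⟨
            total d ((ps ++ fs) ++ zs)             ≤⟨ opt _ (++-walk (++-walk (good-walk good) r) q)
                                                        (same-leaders gs none′) ⟩
            total d ((ps ++ gs) ++ zs)             ≡⟨ total-++₃ ps gs zs ⟩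
            total d ps + total d gs + total d zs   ∎))
          where
          open ≤-Reasoning
          total-++₃ : ∀ xs ys zs → total d ((xs ++ ys) ++ zs) ≡ total d xs + total d ys + total d zs
          total-++₃ xs ys zs = trans (total-++ d (xs ++ ys) zs) (cong (_+ total d zs) (total-++ d xs ys))
          leaders-without : ∀ gs → leaders gs ≡ [] → leaders ((ps ++ gs) ++ zs) ≡ leaders ps ++ leaders zs
          leaders-without gs none′ = trans (filter-++ (_∈? Eˡ) (ps ++ gs) zs)
            (cong (_++ leaders zs) (trans (filter-++ (_∈? Eˡ) ps gs)
              (trans (cong (leaders ps ++_) none′) (++-identityʳ _))))
          same-leaders : ∀ gs → leaders gs ≡ [] → leaders ((ps ++ gs) ++ zs) ≡ leaders ((ps ++ fs) ++ zs)
          same-leaders gs none′ = trans (leaders-without gs none′) (sym (leaders-without fs none))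
        -- Here `ps` is finished, `fs` is the current follower segment and `zs` is still to be
        -- scanned. A leader edge closes the segment, a follower edge prolongs it.
        go : ∀ {k u ps fs x zs} → Good s k u ps → IsWalk u fs x → leaders fs ≡ [] → IsWalk x zs t →
             ResponseOptimal s t ((ps ++ fs) ++ zs) →
             ∃[ k ] ∃[ u ] ∃[ ps′ ] ∃[ fs′ ] Good s k u ps′ × Optimal u fs′ t × ps′ ++ fs′ ≡ (ps ++ fs) ++ zs
        go good p none stop opt =
          _ , _ , _ , _ , good , exchange good (p , none) stop opt , sym (++-identityʳ _)
        go {ps = ps} {fs} good p none (step {e} {zs} q) opt with e ∈? Eˡ
        ... | yes e∈ with go (extend good (exchange good (p , none) (step q) opt) e∈) stop refl q
                            (subst (ResponseOptimal s t) regroup opt)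
          where
          regroup : (ps ++ fs) ++ e ∷ zs ≡ ((ps ++ fs ++ e ∷ []) ++ []) ++ zs
          regroup = trans (sym (++-assoc (ps ++ fs) (e ∷ []) zs))
            (cong (_++ zs) (trans (++-assoc ps fs (e ∷ [])) (sym (++-identityʳ _))))
        ...   | k , u , ps′ , fs′ , good′ , opt′ , eq =
          k , u , ps′ , fs′ , good′ , opt′ , trans eq
            (trans (cong (_++ zs) (trans (++-identityʳ _) (sym (++-assoc ps fs (e ∷ [])))))
                   (++-assoc (ps ++ fs) (e ∷ []) zs))
        go {ps = ps} {fs} good p none (step {e} {zs} q) opt | no e∉
          with go good (++-walk p (step stop))
                 (trans (filter-++ (_∈? Eˡ) fs (e ∷ [])) (cong₂ _++_ none (filter-reject (_∈? Eˡ) e∉)))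
                 q (subst (ResponseOptimal s t) regroup opt)
          where
          regroup : (ps ++ fs) ++ e ∷ zs ≡ (ps ++ fs ++ e ∷ []) ++ zs
          regroup = trans (sym (++-assoc (ps ++ fs) (e ∷ []) zs)) (cong (_++ zs) (++-assoc ps fs (e ∷ [])))
        ... | k , u , ps′ , fs′ , good′ , opt′ , eq =
          k , u , ps′ , fs′ , good′ , opt′ , trans eq
            (trans (cong (_++ zs) (sym (++-assoc ps fs (e ∷ [])))) (++-assoc (ps ++ fs) (e ∷ []) zs))

      leaders-extend : ∀ es {fs e} → leaders fs ≡ [] → e ∈ₛ Eˡ →
                       leaders (es ++ fs ++ e ∷ []) ≡ leaders es ++ e ∷ []
      leaders-extend es {fs} {e} none e∈ = trans (filter-++ (_∈? Eˡ) es (fs ++ e ∷ []))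
        (cong (leaders es ++_) (trans (filter-++ (_∈? Eˡ) fs (e ∷ []))
          (cong₂ _++_ none (filter-accept (_∈? Eˡ) e∈))))

      -- A walk with the same sequence of leader edges passes through the same segment endpoints, so
      -- its segments can be compared one by one. The last segment `gs` stays open, to be compared
      -- when the next leader edge or the end of the path is known.
      good-minimal : ∀ {s k u es} → Good s k u es → ∀ {x zs} → IsWalk s zs x → leaders zs ≡ leaders es →
        ∃[ zs₁ ] ∃[ gs ] zs ≡ zs₁ ++ gs × FollowerWalk u gs x × total d es ≤ total d zs₁
      good-minimal start {zs = zs} p same = [] , zs , refl , (p , same) , z≤n
      good-minimal (extend {es = es} {fs} {e} good ((_ , none) , least) e∈) {zs = zs} p same
        with leaders-split zs (leaders es) (trans same (leaders-extend es none e∈))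
      ... | ys , gs , refl , same′ , none′ with split-walk ys p
      ...   | _ , q , step r with good-minimal good q same′
      ...     | ys₁ , hs , refl , walk , es≤ =
        (ys₁ ++ hs) ++ e ∷ [] , gs , sym (++-assoc (ys₁ ++ hs) (e ∷ []) gs) , (r , none′) , (begin
          total d (es ++ fs ++ e ∷ [])                       ≡⟨ total-++₃ es fs ⟩
          total d es + (total d fs + total d (e ∷ []))       ≤⟨ +-mono-≤ es≤ (+-monoˡ-≤ _ (least hs walk)) ⟩
          total d ys₁ + (total d hs + total d (e ∷ []))      ≡⟨ total-++₃ ys₁ hs ⟨
          total d (ys₁ ++ hs ++ e ∷ [])                      ≡⟨ cong (total d) (++-assoc ys₁ hs (e ∷ [])) ⟨
          total d ((ys₁ ++ hs) ++ e ∷ [])                    ∎)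
        where
        open ≤-Reasoning
        total-++₃ : ∀ xs ys → total d (xs ++ ys ++ e ∷ []) ≡ total d xs + (total d ys + total d (e ∷ []))
        total-++₃ xs ys = trans (total-++ d xs (ys ++ e ∷ [])) (cong (total d xs +_) (total-++ d ys (e ∷ [])))

      recompose : ∀ {s k u t ps fs} → Good s k u ps → Optimal u fs t → ResponseOptimal s t (ps ++ fs)
      recompose {ps = ps} {fs} good ((_ , none) , least) zs p same
        with good-minimal good p (trans same (trans (filter-++ (_∈? Eˡ) ps fs)
               (trans (cong (leaders ps ++_) none) (++-identityʳ _))))
      ... | zs₁ , gs , refl , walk , ps≤ = begin
        total d (ps ++ fs)          ≡⟨ total-++ d ps fs ⟩
        total d ps + total d fs     ≤⟨ +-mono-≤ ps≤ (least gs walk) ⟩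
        total d zs₁ + total d gs    ≡⟨ total-++ d zs₁ gs ⟨
        total d (zs₁ ++ gs)         ∎
        where open ≤-Reasoning

-- Correctness of the algorithm

vertex : ∀ {n} → Fin n → ⟦ V ⟧
vertex v = List.replicate (toℕ v) tt

vertex-injective : ∀ {n} {u v : Fin n} → vertex u ≡ vertex v → u ≡ v
vertex-injective {u = u} {v} eq = Fin.toℕ-injective
  (trans (sym (length-replicate (toℕ u))) (trans (cong length eq) (length-replicate (toℕ v))))

∉ₛ⇒lookup : ∀ {n} {x : Fin n} {p} → x ∉ₛ p → lookup p x ≡ false
∉ₛ⇒lookup {x = x} {p} x∉ with lookup p x in eq
... | false = refl
... | true  = contradiction (lookup⇒[]= x p eq) x∉

lookup⇒∉ₛ : ∀ {n} {x : Fin n} {p} → lookup p x ≡ false → x ∉ₛ p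
lookup⇒∉ₛ eq x∈ = contradiction (trans (sym ([]=⇒lookup x∈)) eq) λ ()

relabel : ∀ {arcs s k k′ v x x′} → k ≡ k′ → x ≡ x′ → Walk arcs s k v x → Walk arcs s k′ v x′
relabel refl refl walk = walk

module Correctness (G : Digraph) (acyclic : Digraph.Acyclic G) (Eˡ : Subset (Digraph.#E G))
                   (s t : Fin (Digraph.#V G)) (wt : Digraph.E G → ⟦ W ⟧) (es : ⟦ list Edge ⟧) where

  open Digraph G hiding (V)

  edgeOf : E → ⟦ Edge ⟧
  edgeOf e = vertex (source e) , vertex (target e) , lookup Eˡ e , wt e

  d c : E → ℕ
  d e = value (proj₁ (wt e))
  c e = value (proj₂ (wt e))

  label : List E → ℕ × ℕ
  label fs = total d fs , total c fs

  open Walks G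
  open Leaders Eˡ
  open Bilevel d

  label-++ : ∀ fs gs → label (fs ++ gs) ≡ label fs +ₗ label gs
  label-++ fs gs = cong₂ _,_ (total-++ d fs gs) (total-++ c fs gs)

  label-∷ʳ : ∀ fs e → label (fs ++ e ∷ []) ≡ label fs +ₗ wvalue (wt e)
  label-∷ʳ fs e = trans (label-++ fs (e ∷ [])) (cong (label fs +ₗ_) (cong₂ _,_ (+-identityʳ _) (+-identityʳ _)))

  module _ (edges⁺ : ∀ e → edgeOf e ∈ es) (edges⁻ : ∀ {x} → x ∈ es → ∃[ e ] x ≡ edgeOf e)
           (long : #E ≤ length es) where

    followerArc : ⟦ Edge ⟧ → ⟦ list Arc ⟧
    followerArc (u , v , l , w) = if l then [] else (u , v , w) ∷ []

    followerArcs⁺ : ∀ {e} → e ∉ₛ Eˡ → (vertex (source e) , vertex (target e) , wt e) ∈ followerArcs es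
    followerArcs⁺ {e} e∉ = ∈-gather⁺ followerArc (edges⁺ e) arc∈
      where
      arc∈ : (vertex (source e) , vertex (target e) , wt e) ∈ followerArc (edgeOf e)
      arc∈ rewrite ∉ₛ⇒lookup e∉ = here refl

    followerArcs⁻ : ∀ {a} → a ∈ followerArcs es →
                    ∃[ e ] e ∉ₛ Eˡ × a ≡ (vertex (source e) , vertex (target e) , wt e)
    followerArcs⁻ a∈ with ∈-gather⁻ followerArc es a∈
    ... | x , x∈ , a∈′ with edges⁻ x∈
    ...   | e , refl with lookup Eˡ e in eq | a∈′
    ...     | false | here a≡ = e , lookup⇒∉ₛ eq , a≡

    leaders-∷ʳ : ∀ {fs e} → leaders fs ≡ [] → e ∉ₛ Eˡ → leaders (fs ++ e ∷ []) ≡ []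
    leaders-∷ʳ {fs} {e} none e∉ =
      trans (filter-++ (_∈? Eˡ) fs (e ∷ [])) (cong₂ _++_ none (filter-reject (_∈? Eˡ) e∉))

    FollowerReached : Fin #V → ⟦ V ⟧ → ℕ × ℕ → Set
    FollowerReached u y x = ∃[ v ] ∃[ fs ] y ≡ vertex v × FollowerWalk u fs v × x ≡ label fs

    follower-snoc : ∀ {u x} e → FollowerReached u (vertex (source e)) x → e ∉ₛ Eˡ →
                    FollowerReached u (vertex (target e)) (x +ₗ wvalue (wt e))
    follower-snoc {u} e (v , fs , y≡ , (p , none) , x≡) e∉ =
      target e , fs ++ e ∷ [] , refl ,
      (++-walk (subst (IsWalk u fs) (sym (vertex-injective y≡)) p) (step stop) , leaders-∷ʳ {fs} none e∉) ,
      trans (cong (_+ₗ wvalue (wt e)) x≡) (sym (label-∷ʳ fs e))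

    follower-sound : ∀ {u k y x} → Walk (followerArcs es) (vertex u) k y x → FollowerReached u y x
    follower-sound start = _ , [] , refl , (stop , refl) , refl
    follower-sound (extend walk a∈) with followerArcs⁻ a∈
    ... | e , e∉ , refl = follower-snoc e (follower-sound walk) e∉

    follower-complete : ∀ {u v fs} → FollowerWalk u fs v →
                        Walk (followerArcs es) (vertex u) (length fs) (vertex v) (label fs)
    follower-complete {u₀} (p , none) = go start p none
      where
      -- `Walk` grows at its end but `IsWalk` at its start, hence the accumulated prefix.
      go : ∀ {u v k x fs} → Walk (followerArcs es) (vertex u₀) k (vertex u) x → IsWalk u fs v →
           leaders fs ≡ [] → Walk (followerArcs es) (vertex u₀) (k + length fs) (vertex v) (x +ₗ label fs)
      go {k = k} {x} walk stop none =
        relabel (sym (+-identityʳ k)) (sym (cong₂ _,_ (+-identityʳ (proj₁ x)) (+-identityʳ (proj₂ x)))) walk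
      go {k = k} {x} walk (step {e} {fs} p) none with e ∈? Eˡ
      ... | no e∉ = relabel (sym (+-suc k (length fs)))
        (cong₂ _,_ (+-assoc (proj₁ x) (d e) (total d fs)) (+-assoc (proj₂ x) (c e) (total c fs)))
        (go (extend walk (followerArcs⁺ e∉)) p none)

    follower-short : ∀ {u v fs} → FollowerWalk u fs v → length fs ≤ length es
    follower-short (p , _) = ≤-trans (walk-short acyclic p) long

    segment-walk : ∀ {u v m} → m ∈ segment es (vertex u) v → FollowerReached u v (wvalue m)
    segment-walk {u} m∈ = follower-sound (proj₂ (distance-walk (followerArcs es) (vertex u) es m∈))

    segment-least : ∀ {u v m fs} → m ∈ segment es (vertex u) (vertex v) → FollowerWalk u fs v →
                    wvalue m ≤ₗ label fs
    segment-least {u} m∈ walk =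
      distance-least (followerArcs es) (vertex u) es m∈ (follower-complete walk) (follower-short walk)

    segment-exists : ∀ {u v fs} → FollowerWalk u fs v → ∃[ m ] m ∈ segment es (vertex u) (vertex v)
    segment-exists {u} walk =
      distance-exists (followerArcs es) (vertex u) es (follower-complete walk) (follower-short walk)

    SegmentPath : Fin #V → Fin #V → ⟦ W ⟧ → Set
    SegmentPath u v m = ∃[ fs ] Optimal u fs v × wvalue m ≡ label fs

    segment-sound : ∀ {u v m} → m ∈ segment es (vertex u) (vertex v) → SegmentPath u v m
    segment-sound {u} {v} {m} m∈ = optimal (segment-walk {u} {vertex v} {m} m∈)
      where
      optimal : FollowerReached u (vertex v) (wvalue m) → SegmentPath u v m
      optimal (v′ , fs , v≡ , walk , m≡) =
        fs , (subst (FollowerWalk u fs) (sym (vertex-injective v≡)) walk ,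
              λ gs walk′ → subst (_≤ total d gs) (cong proj₁ m≡) (proj₁ (segment-least {u} {v} {m} m∈ walk′))) , m≡

    SegmentValue : Fin #V → Fin #V → List E → Set
    SegmentValue u v fs = ∃[ m ] m ∈ segment es (vertex u) (vertex v) × value (proj₂ m) ≤ total c fs

    -- The walk behind the label `m` and `fs` are both `d`-optimal, so their first components tie
    -- and lexicographic minimality bounds the leader's cost. This is where the optimistic setting
    -- enters.
    segment-complete : ∀ {u v fs} → Optimal u fs v → SegmentValue u v fs
    segment-complete {u} {v} {fs} (walk , least) = cheap (segment-exists walk)
      where
      cheap : ∃[ m ] m ∈ segment es (vertex u) (vertex v) → SegmentValue u v fs
      cheap (m , m∈) = m , m∈ , bound (segment-sound {u} {v} {m} m∈)
        where
        bound : SegmentPath u v m → value (proj₂ m) ≤ total c fs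
        bound (gs , (walk′ , _) , m≡) = proj₂ (segment-least {u} {v} {m} m∈ walk)
          (subst (total d fs ≤_) (cong proj₁ (sym m≡)) (least gs walk′))

    starts⁺ : ∀ {k u ps} → Good s k u ps → vertex u ∈ segmentStarts (vertex s) es
    starts⁺ start                   = here refl
    starts⁺ (extend {e = e} _ _ _) =
      there (∈-gather⁺ (λ (u , v , l , w) → v ∷ []) (edges⁺ e) (here refl))

    leaderArc : ⟦ V ⟧ → E → ⟦ W ⟧ → ⟦ Arc ⟧
    leaderArc u e m = u , vertex (target e) , ([] , add (proj₂ m) (proj₂ (wt e)))

    arcsThrough⁺ : ∀ {u e m} → e ∈ₛ Eˡ → m ∈ segment es u (vertex (source e)) →
                   leaderArc u e m ∈ arcsThrough es u (edgeOf e)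
    arcsThrough⁺ {u} {e} {m} e∈ m∈ = subst (λ l → leaderArc u e m ∈ (if l then arcs else []))
      (sym ([]=⇒lookup e∈)) (∈-gather⁺ (λ m → leaderArc u e m ∷ []) m∈ (here refl))
      where
      arcs : ⟦ list Arc ⟧
      arcs = gather (λ m → leaderArc u e m ∷ []) (segment es u (vertex (source e)))

    LeaderArcFrom : ⟦ V ⟧ → ⟦ Arc ⟧ → E → Set
    LeaderArcFrom u a e = e ∈ₛ Eˡ × ∃[ m ] m ∈ segment es u (vertex (source e)) × a ≡ leaderArc u e m

    arcsThrough⁻ : ∀ {u e a} → a ∈ arcsThrough es u (edgeOf e) → LeaderArcFrom u a e
    arcsThrough⁻ {u} {e} {a} a∈ = go (lookup Eˡ e) refl a∈
      where
      ms : List ⟦ W ⟧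
      ms = segment es u (vertex (source e))
      go : ∀ l → lookup Eˡ e ≡ l → a ∈ (if l then gather (λ m → leaderArc u e m ∷ []) ms else []) →
           LeaderArcFrom u a e
      go true eq a∈ = found (∈-gather⁻ (λ m → leaderArc u e m ∷ []) ms a∈)
        where
        found : ∃[ m ] m ∈ ms × a ∈ leaderArc u e m ∷ [] → LeaderArcFrom u a e
        found (m , m∈ , here a≡) = lookup⇒[]= e Eˡ eq , m , m∈ , a≡

    compositeArcs⁻ : ∀ {a} → a ∈ compositeArcs es (vertex s) → ∃[ u ] ∃[ e ] LeaderArcFrom u a e
    compositeArcs⁻ {a} a∈ =
      let u , _ , a∈₁ = ∈-gather⁻ (λ u → gather (arcsThrough es u) es) (segmentStarts (vertex s) es) a∈
          x , x∈ , a∈₂ = ∈-gather⁻ (arcsThrough es u) es a∈₁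
          e , x≡ = edges⁻ x∈
      in u , e , arcsThrough⁻ {u} {e} {a} (subst (λ x → a ∈ arcsThrough es u x) x≡ a∈₂)

    compositeArcs⁺ : ∀ {k u ps e m} → Good s k u ps → e ∈ₛ Eˡ → m ∈ segment es (vertex u) (vertex (source e)) →
                     leaderArc (vertex u) e m ∈ compositeArcs es (vertex s)
    compositeArcs⁺ {u = u} {e = e} {m} good e∈ m∈ =
      ∈-gather⁺ (λ u → gather (arcsThrough es u) es) (starts⁺ good)
        (∈-gather⁺ (arcsThrough es (vertex u)) (edges⁺ e) (arcsThrough⁺ {vertex u} {e} {m} e∈ m∈))

    wvalue-leaderArc : ∀ u e m → wvalue (proj₂ (proj₂ (leaderArc u e m))) ≡ (0 , value (proj₂ m) + c e)
    wvalue-leaderArc u e m = cong (0 ,_) (value-add (proj₂ m) (proj₂ (wt e)))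

    total-extend : ∀ ps fs e → total c (ps ++ fs ++ e ∷ []) ≡ total c ps + (total c fs + c e)
    total-extend ps fs e = trans (total-++ c ps (fs ++ e ∷ []))
      (cong (total c ps +_) (trans (total-++ c fs (e ∷ [])) (cong (total c fs +_) (+-identityʳ (c e)))))

    GoodReached : ⟦ V ⟧ → ℕ × ℕ → Set
    GoodReached y x = ∃[ k ] ∃[ u ] ∃[ ps ] y ≡ vertex u × Good s k u ps × x ≡ (0 , total c ps)

    composite-snoc : ∀ {u₀ x} e m → GoodReached u₀ x → e ∈ₛ Eˡ → m ∈ segment es u₀ (vertex (source e)) →
                     GoodReached (vertex (target e)) (x +ₗ wvalue (proj₂ (proj₂ (leaderArc u₀ e m))))
    composite-snoc {u₀} {x} e m (k , u , ps , u≡ , good , x≡) e∈ m∈ =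
      let fs , opt , m≡ = segment-sound {u} {source e} {m}
                            (subst (λ u → m ∈ segment es u (vertex (source e))) u≡ m∈)
      in suc k , target e , ps ++ fs ++ e ∷ [] , refl , extend good opt e∈ ,
         trans (cong₂ _+ₗ_ x≡ (trans (wvalue-leaderArc u₀ e m) (cong (λ n → 0 , n + c e) (cong proj₂ m≡))))
               (cong (0 ,_) (sym (total-extend ps fs e)))

    composite-sound : ∀ {k y x} → Walk (compositeArcs es (vertex s)) (vertex s) k y x → GoodReached y x
    composite-sound start = 0 , s , [] , refl , start , refl
    composite-sound (extend {u = u₀} {y} {w} {x} walk a∈) =
      let u , e , e∈ , m , m∈ , a≡ = compositeArcs⁻ a∈
          u₀≡ = cong proj₁ a≡
      in subst₂ (λ y w → GoodReached y (x +ₗ wvalue w))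
           (sym (cong (λ a → proj₁ (proj₂ a)) a≡)) (sym (cong (λ a → proj₂ (proj₂ a)) a≡))
           (composite-snoc e m (composite-sound walk) e∈
             (subst (λ u → m ∈ segment es u (vertex (source e))) (sym u₀≡) m∈))

    CompositeWalk : ℕ → Fin #V → List E → Set
    CompositeWalk k u ps =
      ∃[ n ] Walk (compositeArcs es (vertex s)) (vertex s) k (vertex u) (0 , n) × n ≤ total c ps

    -- Each segment of `ps` is replaced by a cheapest one among the `d`-optimal ones, hence an
    -- inequality.
    composite-complete : ∀ {k u ps} → Good s k u ps → CompositeWalk k u ps
    composite-complete start = 0 , start , z≤n
    composite-complete (extend {u = u} {ps} {fs} {e} good opt e∈) =
      let n , walk , n≤ = composite-complete good
          m , m∈ , m≤   = segment-complete {u} {source e} {fs} opt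
      in n + (value (proj₂ m) + c e) ,
         relabel refl (cong ((0 , n) +ₗ_) (wvalue-leaderArc (vertex u) e m))
           (extend walk (compositeArcs⁺ {e = e} {m} good e∈ m∈)) ,
         ≤-trans (+-mono-≤ n≤ (+-monoˡ-≤ (c e) m≤)) (≤-reflexive (sym (total-extend ps fs e)))

    good-short : ∀ {k u ps} → Good s k u ps → k ≤ length es
    good-short good = ≤-trans (good-length good) (≤-trans (walk-short acyclic (good-walk good)) long)

    Attainable : ℕ → Set
    Attainable n = ∃[ k ] ∃[ u ] ∃[ ps ] ∃[ fs ]
                   Good s k u ps × Optimal u fs t × total c (ps ++ fs) ≤ n

    module _ (T : List Bool) where

      test : ⟦ W ⟧ → ⟦ W ⟧ → List ⊤
      test m m′ = guard (leq (add (proj₂ m) (proj₂ m′)) T) tt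

      tests : ⟦ V ⟧ → ⟦ W ⟧ → List ⊤
      tests u m = gather (test m) (segment es u (vertex t))

      composites : ⟦ V ⟧ → List ⟦ W ⟧
      composites = distance (compositeArcs es (vertex s)) (vertex s) es

      accept-sound : accept es (vertex s) (vertex t) T ≡ true → Attainable (value T)
      accept-sound eq =
        let _ , x∈ = nonempty⁻ (gather (accepting es (vertex s) (vertex t) T) (segmentStarts (vertex s) es)) eq
            u , _ , x∈₁ = ∈-gather⁻ (accepting es (vertex s) (vertex t) T) (segmentStarts (vertex s) es) x∈
            m , m∈ , x∈₂ = ∈-gather⁻ (tests u) (composites u) x∈₁
            m′ , m′∈ , x∈₃ = ∈-gather⁻ (test m) (segment es u (vertex t)) x∈₂
            _ , walk = distance-walk (compositeArcs es (vertex s)) (vertex s) es {u} {m} m∈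
            k , v , ps , u≡ , good , m≡ = composite-sound walk
            fs , opt , m′≡ = segment-sound {v} {t} {m′} (subst (λ u → m′ ∈ segment es u (vertex t)) u≡ m′∈)
        in k , v , ps , fs , good , opt , (begin
          total c (ps ++ fs)                     ≡⟨ total-++ c ps fs ⟩
          total c ps + total c fs                ≡⟨ cong₂ _+_ (cong proj₂ m≡) (cong proj₂ m′≡) ⟨
          value (proj₂ m) + value (proj₂ m′)     ≡⟨ value-add (proj₂ m) (proj₂ m′) ⟨
          value (add (proj₂ m) (proj₂ m′))       ≤⟨ proj₁ (leq-decides (add (proj₂ m) (proj₂ m′)) T)
                                                      (proj₁ (∈-guard⁻ (leq (add (proj₂ m) (proj₂ m′)) T) x∈₃)) ⟩
          value T                                ∎)
        where open ≤-Reasoning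

      accept-complete : Attainable (value T) → accept es (vertex s) (vertex t) T ≡ true
      accept-complete (k , u , ps , fs , good , opt , le) =
        let n , walk , n≤   = composite-complete good
            m′ , m′∈ , m′≤  = segment-complete {u} {t} {fs} opt
            m , m∈ = distance-exists (compositeArcs es (vertex s)) (vertex s) es walk (good-short good)
            m≤ = distance-least (compositeArcs es (vertex s)) (vertex s) es {m = m} m∈ walk (good-short good)
            cheap : value (add (proj₂ m) (proj₂ m′)) ≤ value T
            cheap = begin
              value (add (proj₂ m) (proj₂ m′))     ≡⟨ value-add (proj₂ m) (proj₂ m′) ⟩
              -- The label of a composite walk has first component 0, so the tie condition holds by
              -- `z≤n`.
              value (proj₂ m) + value (proj₂ m′)   ≤⟨ +-mono-≤ (≤-trans (proj₂ m≤ z≤n) n≤) m′≤ ⟩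
              total c ps + total c fs              ≡⟨ total-++ c ps fs ⟨
              total c (ps ++ fs)                   ≤⟨ le ⟩
              value T                              ∎
        in nonempty⁺ (∈-gather⁺ (accepting es (vertex s) (vertex t) T) (starts⁺ good)
             (∈-gather⁺ (tests (vertex u)) {m} {tt} {composites (vertex u)} m∈
               (∈-gather⁺ (test m) {m′} {tt} {segment es (vertex u) (vertex t)} m′∈
                 (∈-guard⁺ (proj₂ (leq-decides (add (proj₂ m) (proj₂ m′)) T) cheap)))))
        where open ≤-Reasoning

-- Rational weights

sumℚ : ∀ {A : Set} → (A → ℚ) → List A → ℚ
sumℚ f = foldr (λ e q → f e ℚ.+ q) 0ℚ

-- Induction on the list: the summand of its head `x` is split off, and the indicator `b′` for the
-- tail is `b` switched off at `x`.
sum-restrict : ∀ {n} (f : Fin n → ℚ) (b : Fin n → Bool) {es} → Unique es →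
               (∀ {e} → b e ≡ true → e ∈ es) → (∀ {e} → e ∈ es → b e ≡ true) →
               sum (λ e → if b e then f e else 0ℚ) ≡ sumℚ f es
sum-restrict {n} f b {[]} _ sound _ = trans (sum-cong-≗ vanish) (sum-replicate-zero n)
  where
  vanish : ∀ e → (if b e then f e else 0ℚ) ≡ 0ℚ
  vanish e with b e in eq
  ... | false = refl
  ... | true  = contradiction (sound eq) λ ()
sum-restrict {suc n} f b {x ∷ xs} (x∉ ∷ unique) sound complete = begin
  sum g                                 ≡⟨ sum-remove {i = x} g ⟩
  g x ℚ.+ sum (g ∘ punchIn x)           ≡⟨ cong₂ ℚ._+_ gx≡ (sum-cong-≗ (λ j → sym (g′-punchIn j))) ⟩
  f x ℚ.+ sum (g′ ∘ punchIn x)          ≡⟨ cong (f x ℚ.+_) (ℚ.+-identityˡ _) ⟨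
  f x ℚ.+ (0ℚ ℚ.+ sum (g′ ∘ punchIn x)) ≡⟨ cong (λ q → f x ℚ.+ (q ℚ.+ sum (g′ ∘ punchIn x))) g′x≡ ⟨
  f x ℚ.+ (g′ x ℚ.+ sum (g′ ∘ punchIn x)) ≡⟨ cong (f x ℚ.+_) (sum-remove {i = x} g′) ⟨
  f x ℚ.+ sum g′                        ≡⟨ cong (f x ℚ.+_) (sum-restrict f b′ unique sound′ complete′) ⟩
  f x ℚ.+ sumℚ f xs                     ∎
  where
  open ≡-Reasoning
  b′ : Fin (suc n) → Bool
  b′ e = if does (e Fin.≟ x) then false else b e
  g g′ : Fin (suc n) → ℚ
  g  e = if b e then f e else 0ℚ
  g′ e = if b′ e then f e else 0ℚ
  gx≡ : g x ≡ f x
  gx≡ rewrite complete (here refl) = refl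
  g′x≡ : g′ x ≡ 0ℚ
  g′x≡ with x Fin.≟ x
  ... | yes _  = refl
  ... | no x≢x = contradiction refl x≢x
  g′-punchIn : ∀ j → g′ (punchIn x j) ≡ g (punchIn x j)
  g′-punchIn j with punchIn x j Fin.≟ x
  ... | yes eq = contradiction eq (Fin.punchInᵢ≢i x j)
  ... | no _   = refl
  sound′ : ∀ {e} → b′ e ≡ true → e ∈ xs
  sound′ {e} eq with e Fin.≟ x
  ... | no e≢x with sound eq
  ...   | here e≡x  = contradiction e≡x e≢x
  ...   | there e∈  = e∈
  complete′ : ∀ {e} → e ∈ xs → b′ e ≡ true
  complete′ {e} e∈ with e Fin.≟ x
  ... | yes refl = contradiction refl (All.lookup x∉ e∈)
  ... | no _     = complete (there e∈)

weightOf : ∀ {n} → (Fin n → ℚ) → Subset n → ℚ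
weightOf f Z = sum (λ e → if lookup Z e then f e else 0ℚ)

weight-list : ∀ {n} (f : Fin n → ℚ) {Z es} → Unique es →
              (∀ {e} → e ∈ₛ Z → e ∈ es) → (∀ {e} → e ∈ es → e ∈ₛ Z) → weightOf f Z ≡ sumℚ f es
weight-list f {Z} unique sound complete = sum-restrict f (lookup Z) unique
  (λ {e} eq → sound (lookup⇒[]= e Z eq)) (λ e∈ → []=⇒lookup (complete e∈))

weight-∪ : ∀ {n} (f : Fin n → ℚ) X Y → (∀ {e} → e ∈ₛ X → e ∉ₛ Y) →
           weightOf f (X ∪ Y) ≡ weightOf f X ℚ.+ weightOf f Y
weight-∪ f X Y disjoint = trans (sum-cong-≗ pointwise)
  (∑-distrib-+ (λ e → if lookup X e then f e else 0ℚ) (λ e → if lookup Y e then f e else 0ℚ))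
  where
  pointwise : ∀ e → (if lookup (X ∪ Y) e then f e else 0ℚ) ≡
              (if lookup X e then f e else 0ℚ) ℚ.+ (if lookup Y e then f e else 0ℚ)
  pointwise e rewrite lookup-zipWith _∨_ e X Y with lookup X e in eqX | lookup Y e in eqY
  ... | true  | true  = contradiction (lookup⇒[]= e Y eqY) (disjoint (lookup⇒[]= e X eqX))
  ... | true  | false = sym (ℚ.+-identityʳ (f e))
  ... | false | true  = sym (ℚ.+-identityˡ (f e))
  ... | false | false = refl

+ℚ-cancelˡ-≤ : ∀ p {q r} → p ℚ.+ q ℚ.≤ p ℚ.+ r → q ℚ.≤ r
+ℚ-cancelˡ-≤ p {q} {r} le = subst₂ ℚ._≤_ (undo q) (undo r) (ℚ.+-monoʳ-≤ (ℚ.- p) le)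
  where
  undo : ∀ q → ℚ.- p ℚ.+ (p ℚ.+ q) ≡ q
  undo q = trans (sym (ℚ.+-assoc (ℚ.- p) p q))
    (trans (cong (ℚ._+ q) (ℚ.+-inverseˡ p)) (ℚ.+-identityˡ q))

-- q = n / suc k
Scaled : ℕ → ℚ → ℕ → Set
Scaled k q n = ℚ.toℚᵘ q ℚᵘ.≃ mkℚᵘ (ℤ.+ n) k

Scaled-+ : ∀ {k p q m n} → Scaled k p m → Scaled k q n → Scaled k (p ℚ.+ q) (m + n)
Scaled-+ {k} {p} {q} {m} {n} p≃ q≃ =
  ℚᵘ.≃-trans (ℚ.toℚᵘ-homo-+ p q) (ℚᵘ.≃-trans (ℚᵘ.+-cong p≃ q≃) (*≡* (begin
    (ℤ.+ m ℤ.* D ℤ.+ ℤ.+ n ℤ.* D) ℤ.* D   ≡⟨ lemma (ℤ.+ m) (ℤ.+ n) D ⟩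
    (ℤ.+ m ℤ.+ ℤ.+ n) ℤ.* (D ℤ.* D)       ≡⟨ cong₂ ℤ._*_ (ℤ.pos-+ m n) (ℤ.pos-* (suc k) (suc k)) ⟨
    ℤ.+ (m + n) ℤ.* ℤ.+ (suc k * suc k)   ∎)))
  where
  open ≡-Reasoning
  D = ℤ.+ suc k
  lemma : ∀ m n D → (m ℤ.* D ℤ.+ n ℤ.* D) ℤ.* D ≡ (m ℤ.+ n) ℤ.* (D ℤ.* D)
  lemma = ℤ.solve-∀

Scaled-sum : ∀ {k} {A : Set} {f : A → ℚ} {w : A → ℕ} → (∀ e → Scaled k (f e) (w e)) →
             ∀ es → Scaled k (sumℚ f es) (total w es)
Scaled-sum scaled []       = *≡* refl
Scaled-sum scaled (e ∷ es) = Scaled-+ (scaled e) (Scaled-sum scaled es)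

Scaled-≤⁺ : ∀ {k p q m n} → Scaled k p m → Scaled k q n → p ℚ.≤ q → m ≤ n
Scaled-≤⁺ {k} {m = m} {n} p≃ q≃ p≤q = ℤ.drop‿+≤+ (ℤ.*-cancelʳ-≤-pos (ℤ.+ m) (ℤ.+ n) (ℤ.+ suc k)
  (ℚᵘ.drop-*≤* (ℚᵘ.≤-respˡ-≃ p≃ (ℚᵘ.≤-respʳ-≃ q≃ (ℚ.toℚᵘ-mono-≤ p≤q)))))

Scaled-≤⁻ : ∀ {k p q m n} → Scaled k p m → Scaled k q n → m ≤ n → p ℚ.≤ q
Scaled-≤⁻ {k} p≃ q≃ m≤n = ℚ.toℚᵘ-cancel-≤
  (ℚᵘ.≤-respˡ-≃ (ℚᵘ.≃-sym p≃) (ℚᵘ.≤-respʳ-≃ (ℚᵘ.≃-sym q≃)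
    (ℚᵘ.*≤* (ℤ.*-monoʳ-≤-nonNeg (ℤ.+ suc k) (ℤ.+≤+ m≤n)))))

scaled-fraction : ∀ {k m} q → 0ℚ ℚ.≤ q → m * ℚ.↧ₙ q ≡ ℤ.∣ ℚ.↥ q ∣ * suc k → Scaled k q m
scaled-fraction {k} {m} q@(ℚ.mkℚ n d-1 _) q≥0 eq = *≡* (begin
  n ℤ.* ℤ.+ suc k                 ≡⟨ cong (ℤ._* ℤ.+ suc k) (ℤ.0≤i⇒+∣i∣≡i n≥0) ⟨
  ℤ.+ ℤ.∣ n ∣ ℤ.* ℤ.+ suc k       ≡⟨ ℤ.pos-* ℤ.∣ n ∣ (suc k) ⟨
  ℤ.+ (ℤ.∣ n ∣ * suc k)           ≡⟨ cong ℤ.+_ eq ⟨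
  ℤ.+ (m * suc d-1)               ≡⟨ ℤ.pos-* m (suc d-1) ⟩
  ℤ.+ m ℤ.* ℤ.+ suc d-1           ∎)
  where
  open ≡-Reasoning
  n≥0 : ℤ.0ℤ ℤ.≤ n
  n≥0 = subst (ℤ.0ℤ ℤ.≤_) (ℤ.*-identityʳ n) (ℚ.drop-*≤* q≥0)

-- Encodings of numbers

bitOf : Bit → Bool
bitOf zero    = false
bitOf (suc _) = true

encodeList-map : ∀ {A B : Set} {f : A → Tree} {g : B → Tree} {h : A → B} → (∀ x → g (h x) ≡ f x) →
                 ∀ xs → encodeList g (map h xs) ≡ encodeList f xs
encodeList-map eq []       = refl
encodeList-map eq (x ∷ xs) = cong₂ _∙_ (eq x) (encodeList-map eq xs)

opaque

  binary : ℕ → List Bool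
  binary n = map bitOf (proj₁ (toDigits 2 n))

  value-binary : ∀ n → value (binary n) ≡ n
  value-binary n = trans (go (proj₁ (toDigits 2 n))) (proj₂ (toDigits 2 n))
    where
    bit-toℕ : ∀ b → bit (bitOf b) ≡ toℕ b
    bit-toℕ zero       = refl
    bit-toℕ (suc zero) = refl
    go : ∀ ds → value (map bitOf ds) ≡ fromDigits ds
    go []       = refl
    go (b ∷ ds) = cong₂ _+_ (bit-toℕ b) (trans (cong (2 *_) (go ds)) (*-comm 2 (fromDigits ds)))

  enc-binary : ∀ n → enc bits (binary n) ≡ encodeBinary n
  enc-binary n = encodeList-map encode-bit (proj₁ (toDigits 2 n))
    where
    encode-bit : ∀ b → encodeBool (bitOf b) ≡ encodeBit b
    encode-bit zero    = refl
    encode-bit (suc _) = refl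

enc-unary : ∀ n → enc V (List.replicate n tt) ≡ encodeUnary n
enc-unary zero    = refl
enc-unary (suc n) = cong (nil ∙_) (enc-unary n)

least : ∀ {P : ℕ → Set} → (∀ n → Dec (P n)) → ∀ n → P n → ∃[ m ] m ≤ n × P m × (∀ {k} → P k → m ≤ k)
least P? n Pn with P? 0
... | yes P0 = 0 , z≤n , P0 , λ _ → z≤n
least P? zero    Pn | no ¬P0 = contradiction Pn ¬P0
least {P} P? (suc n) Pn | no ¬P0 with least (P? ∘ suc) n Pn
... | m , m≤n , Pm , lower = suc m , s≤s m≤n , Pm , λ { {zero} P0 → contradiction P0 ¬P0 ; {suc k} Pk → s≤s (lower Pk) }

fraction : ℚ → ⟦ Frac ⟧
fraction q = binary ℤ.∣ ℚ.↥ q ∣ , binary (ℚ.↧ₙ q)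

enc-fraction : ∀ q → enc Frac (fraction q) ≡ encodeℚ≥0 q
enc-fraction q = cong₂ _∙_ (enc-binary ℤ.∣ ℚ.↥ q ∣) (enc-binary (ℚ.↧ₙ q))

denominator>0 : ∀ q → 0 < value (binary (ℚ.↧ₙ q))
denominator>0 q = subst (0 <_) (sym (value-binary (ℚ.↧ₙ q))) (s≤s z≤n)

length-gather-singleton : ∀ {A B : Set} (f : A → B) xs → length (gather (λ x → f x ∷ []) xs) ≡ length xs
length-gather-singleton {B = B} f xs = trans (go xs []) (+-identityʳ _)
  where
  go : ∀ xs (acc : List B) → length (foldl (λ acc x → f x ∷ acc) acc xs) ≡ length xs + length acc
  go []       acc = refl
  go (x ∷ xs) acc = trans (go xs (f x ∷ acc)) (+-suc (length xs) (length acc))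

productOf>0 : ∀ ds → (∀ {d} → d ∈ ds → 0 < value d) → 0 < productOf ds
productOf>0 []       _   = s≤s z≤n
productOf>0 (d ∷ ds) pos = *-mono-≤ (pos (here refl)) (productOf>0 ds (pos ∘ there))

decides⇒Dec : ∀ {b P} → b decides P → Dec P
decides⇒Dec {true}  (sound , _)    = yes (sound refl)
decides⇒Dec {false} (_ , complete) = no λ p → contradiction (complete p) λ ()

decides⇒Reflects : ∀ {b P} → b decides P → Reflects P b
decides⇒Reflects {true}  (sound , _)    = ofʸ (sound refl)
decides⇒Reflects {false} (_ , complete) = ofⁿ λ p → contradiction (complete p) λ ()

-- From instances to walks with scaled weights

module Reduction (I : Instance) (acyclic : Instance.Acyclic I) (T : Threshold) where

  open Instance I hiding (V)
  open Walks graph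
  open Leaders Eˡ
  open DecMembership (Fin._≟_ {#E}) using () renaming (_∈?_ to _∈ᴱ?_)

  rawEdge : E → ⟦ RawEdge ⟧
  rawEdge e = vertex (source e) , vertex (target e) , lookup Eˡ e , fraction (c e) , fraction (d e)

  rawEdges : ⟦ list RawEdge ⟧
  rawEdges = map rawEdge (allFin #E)

  input : ⟦ InputTy ⟧
  input = (List.replicate #V tt , rawEdges , vertex s , vertex t) , fraction (Threshold.value T)

  enc-input : enc InputTy input ≡ DecisionProblem.encode BSP-Strong-Dir (I , T)
  enc-input = cong₂ _∙_
    (cong₂ _∙_ (enc-unary #V) (cong₂ _∙_ (encodeList-map enc-edge (allFin #E))
      (cong₂ _∙_ (enc-unary (toℕ s)) (enc-unary (toℕ t)))))
    (enc-fraction (Threshold.value T))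
    where
    enc-edge : ∀ e → enc RawEdge (rawEdge e) ≡
               encodeVertex (source e) ∙ encodeVertex (target e) ∙ encodeBool (lookup Eˡ e) ∙
               encodeℚ≥0 (c e) ∙ encodeℚ≥0 (d e)
    enc-edge e = cong₂ _∙_ (enc-unary (toℕ (source e))) (cong₂ _∙_ (enc-unary (toℕ (target e)))
      (cong (encodeBool (lookup Eˡ e) ∙_) (cong₂ _∙_ (enc-fraction (c e)) (enc-fraction (d e)))))

  dens : List (List Bool)
  dens = denominators rawEdges (fraction (Threshold.value T))

  edgeDenominators : ⟦ RawEdge ⟧ → List (List Bool)
  edgeDenominators (u , v , l , p , q) = proj₂ p ∷ proj₂ q ∷ []

  weights : E → ⟦ W ⟧
  weights e = scale dens (fraction (d e)) , scale dens (fraction (c e))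

  es : ⟦ list Edge ⟧
  es = scaleEdges dens rawEdges

  module C = Correctness graph acyclic Eˡ s t weights es
  open Bilevel C.d

  edges⁺ : ∀ e → C.edgeOf e ∈ es
  edges⁺ e = ∈-gather⁺ (λ r → scaleEdge dens r ∷ []) (∈-map⁺ rawEdge (∈-allFin e)) (here refl)

  edges⁻ : ∀ {x} → x ∈ es → ∃[ e ] x ≡ C.edgeOf e
  edges⁻ {x} x∈ = let r , r∈ , x∈′ = ∈-gather⁻ (λ r → scaleEdge dens r ∷ []) rawEdges x∈
                      e , _ , r≡ = ∈-map⁻ rawEdge r∈
                  in e , singleton (subst (λ r → x ∈ scaleEdge dens r ∷ []) r≡ x∈′)
    where
    singleton : ∀ {y} → x ∈ y ∷ [] → x ≡ y
    singleton (here eq) = eq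

  long : #E ≤ length es
  long = ≤-reflexive (sym (trans (length-gather-singleton (scaleEdge dens) rawEdges)
    (trans (length-map rawEdge (allFin #E)) (length-tabulate id))))

  dens>0 : ∀ {x} → x ∈ dens → 0 < value x
  dens>0 (here refl) = denominator>0 (Threshold.value T)
  dens>0 {x} (there x∈) = let r , r∈ , x∈′ = ∈-gather⁻ edgeDenominators rawEdges x∈
                              e , _ , r≡ = ∈-map⁻ rawEdge r∈
                          in edge e (subst (λ r → x ∈ edgeDenominators r) r≡ x∈′)
    where
    edge : ∀ e → x ∈ edgeDenominators (rawEdge e) → 0 < value x
    edge e (here refl)         = denominator>0 (c e)
    edge e (there (here refl)) = denominator>0 (d e)

  -- `Scaled k` refers to the denominator `suc k`, here the product of all denominators.
  k : ℕ
  k = pred (productOf dens)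

  product≡ : productOf dens ≡ suc k
  product≡ = sym (suc-pred (productOf dens) {{>-nonZero (productOf>0 dens dens>0)}})

  scaled : ∀ q → 0ℚ ℚ.≤ q → binary (ℚ.↧ₙ q) ∈ dens → Scaled k q (value (scale dens (fraction q)))
  scaled q q≥0 q∈ = scaled-fraction q q≥0 (begin
    value (scale dens (fraction q)) * ℚ.↧ₙ q
      ≡⟨ cong (value (scale dens (fraction q)) *_) (value-binary (ℚ.↧ₙ q)) ⟨
    value (scale dens (fraction q)) * value (binary (ℚ.↧ₙ q))
      ≡⟨ value-scale {proj₁ (fraction q)} q∈ ⟩
    value (binary ℤ.∣ ℚ.↥ q ∣) * productOf dens
      ≡⟨ cong₂ _*_ (value-binary ℤ.∣ ℚ.↥ q ∣) product≡ ⟩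
    ℤ.∣ ℚ.↥ q ∣ * suc k ∎)
    where open ≡-Reasoning

  scaled-c : ∀ e → Scaled k (c e) (C.c e)
  scaled-c e = scaled (c e) (c≥0 e)
    (there (∈-gather⁺ edgeDenominators (∈-map⁺ rawEdge (∈-allFin e)) (here refl)))

  scaled-d : ∀ e → Scaled k (d e) (C.d e)
  scaled-d e = scaled (d e) (d≥0 e)
    (there (∈-gather⁺ edgeDenominators (∈-map⁺ rawEdge (∈-allFin e)) (there (here refl))))

  bound : List Bool
  bound = scale dens (fraction (Threshold.value T))

  scaled-T : Scaled k (Threshold.value T) (value bound)
  scaled-T = scaled (Threshold.value T) (Threshold.value≥0 T) (here refl)

  toSubset : List E → Subset #E
  toSubset zs = tabulate (λ e → does (e ∈ᴱ? zs))

  toSubset⁺ : ∀ {e zs} → e ∈ zs → e ∈ₛ toSubset zs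
  toSubset⁺ {e} {zs} e∈ = lookup⇒[]= e _
    (trans (lookup∘tabulate (λ e → does (e ∈ᴱ? zs)) e) (dec-true (e ∈ᴱ? zs) e∈))

  toSubset⁻ : ∀ {e zs} → e ∈ₛ toSubset zs → e ∈ zs
  toSubset⁻ {e} {zs} e∈ with e ∈ᴱ? zs
    | trans (sym (lookup∘tabulate (λ e → does (e ∈ᴱ? zs)) e)) ([]=⇒lookup e∈)
  ... | yes e∈zs | _ = e∈zs
  ... | no _     | ()

  leaderPart followerPart : List E → Subset #E
  leaderPart zs   = toSubset zs ∩ Eˡ
  followerPart zs = toSubset zs ∩ Eᶠ

  record Traces (X Y : Subset #E) (zs : List E) : Set where
    field
      X⊆Eˡ     : ∀ {e} → e ∈ₛ X → e ∈ₛ Eˡ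
      Y⊆Eᶠ     : ∀ {e} → e ∈ₛ Y → e ∈ₛ Eᶠ
      walk     : IsWalk s zs t
      sound    : ∀ {e} → e ∈ₛ X ∪ Y → e ∈ zs
      complete : ∀ {e} → e ∈ zs → e ∈ₛ X ∪ Y

    leader∈X : ∀ {e} → e ∈ₛ Eˡ → e ∈ zs → e ∈ₛ X
    leader∈X e∈L e∈ with x∈p∪q⁻ X Y (complete e∈)
    ... | inj₁ e∈X = e∈X
    ... | inj₂ e∈Y = contradiction e∈L (x∈∁p⇒x∉p (Y⊆Eᶠ e∈Y))

    X∈ : ∀ {e} → e ∈ₛ X → e ∈ zs
    X∈ e∈X = sound (x∈p∪q⁺ (inj₁ e∈X))

    path : IsPath s t (X ∪ Y)
    path = zs , walk , walk-simple acyclic walk , λ _ → mk⇔ sound complete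

    weight-sum : ∀ f → weight f (X ∪ Y) ≡ sumℚ f zs
    weight-sum f = weight-list f (walk-unique acyclic walk) sound complete

    weight-split : ∀ f → sumℚ f zs ≡ weight f X ℚ.+ weight f Y
    weight-split f = trans (sym (weight-sum f))
      (weight-∪ f X Y (λ e∈X e∈Y → x∈∁p⇒x∉p (Y⊆Eᶠ e∈Y) (X⊆Eˡ e∈X)))

  open Traces

  traces : ∀ {X Y} → (∀ {e} → e ∈ₛ X → e ∈ₛ Eˡ) → FollowerFeasible X Y → ∃[ zs ] Traces X Y zs
  traces X⊆ (Y⊆ , zs , p , _ , iff) = zs , record
    { X⊆Eˡ = X⊆ ; Y⊆Eᶠ = Y⊆ ; walk = p
    ; sound = λ {e} → Equivalence.to (iff e) ; complete = λ {e} → Equivalence.from (iff e) }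

  traces-walk : ∀ {X zs} → IsWalk s zs t → (∀ {e} → e ∈ₛ X → e ∈ₛ Eˡ) →
                (∀ {e} → e ∈ₛ X → e ∈ zs) → (∀ {e} → e ∈ₛ Eˡ → e ∈ zs → e ∈ₛ X) →
                Traces X (followerPart zs) zs
  traces-walk {X} {zs} p X⊆ X⇒ ⇒X = record
    { X⊆Eˡ = X⊆ ; Y⊆Eᶠ = λ e∈ → proj₂ (x∈p∩q⁻ (toSubset zs) Eᶠ e∈) ; walk = p
    ; sound = λ e∈ → [ X⇒ , (λ e∈Y → toSubset⁻ (proj₁ (x∈p∩q⁻ (toSubset zs) Eᶠ e∈Y))) ]
                       (x∈p∪q⁻ X (followerPart zs) e∈)
    ; complete = complete′ }
    where
    complete′ : ∀ {e} → e ∈ zs → e ∈ₛ X ∪ followerPart zs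
    complete′ {e} e∈ with e ∈? Eˡ
    ... | yes e∈L = x∈p∪q⁺ (inj₁ (⇒X e∈L e∈))
    ... | no e∉L  = x∈p∪q⁺ (inj₂ (x∈p∩q⁺ (toSubset⁺ e∈ , x∉p⇒x∈∁p e∉L)))

  -- The `d`-weight of a whole path exceeds that of its response by `weight d X`, which is common to
  -- both paths.
  weight≤⇒total≤ : ∀ {X Y Y′ zs zs′} → Traces X Y zs → Traces X Y′ zs′ →
                   weight d Y ℚ.≤ weight d Y′ → total C.d zs ≤ total C.d zs′
  weight≤⇒total≤ {X} {zs = zs} {zs′} τ τ′ le =
    Scaled-≤⁺ (Scaled-sum scaled-d zs) (Scaled-sum scaled-d zs′)
      (subst₂ ℚ._≤_ (sym (weight-split τ d)) (sym (weight-split τ′ d)) (ℚ.+-monoʳ-≤ (weight d X) le))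

  total≤⇒weight≤ : ∀ {X Y Y′ zs zs′} → Traces X Y zs → Traces X Y′ zs′ →
                   total C.d zs ≤ total C.d zs′ → weight d Y ℚ.≤ weight d Y′
  total≤⇒weight≤ {X} {zs = zs} {zs′} τ τ′ le = +ℚ-cancelˡ-≤ (weight d X)
    (subst₂ ℚ._≤_ (weight-split τ d) (weight-split τ′ d)
      (Scaled-≤⁻ (Scaled-sum scaled-d zs) (Scaled-sum scaled-d zs′) le))

  feasible⇒optimal : ∀ {X Y} → Feasible X Y → ∃[ zs ] Traces X Y zs × ResponseOptimal s t zs
  feasible⇒optimal {X} {Y} (X⊆ , feasible , optimal) = zs , τ , respond
    where
    zs : List E
    zs = proj₁ (traces X⊆ feasible)
    τ : Traces X Y zs
    τ = proj₂ (traces X⊆ feasible)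
    respond : ResponseOptimal s t zs
    respond zs′ p′ same = weight≤⇒total≤ τ τ′ (optimal (followerPart zs′) (Y⊆Eᶠ τ′ , path τ′))
      where
      via : ∀ {xs ys} → leaders xs ≡ leaders ys → ∀ {e} → e ∈ₛ Eˡ → e ∈ xs → e ∈ ys
      via eq e∈L e∈ = proj₁ (∈-filter⁻ (_∈? Eˡ) (subst (_ ∈_) eq (∈-filter⁺ (_∈? Eˡ) e∈ e∈L)))
      τ′ : Traces X (followerPart zs′) zs′
      τ′ = traces-walk p′ X⊆ (λ e∈X → via (sym same) (X⊆ e∈X) (X∈ τ e∈X))
             (λ e∈L e∈ → leader∈X τ e∈L (via same e∈L e∈))

  -- A competing response `Y′` is only known to complete the same set of leader edges. By
  -- `leaders-determined` its path also meets them in the same order, so that the optimality of `zs`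
  -- applies to it.
  optimal⇒feasible : ∀ {zs} → IsWalk s zs t → ResponseOptimal s t zs →
                     Feasible (leaderPart zs) (followerPart zs) × Traces (leaderPart zs) (followerPart zs) zs
  optimal⇒feasible {zs} p optimal = (X⊆Eˡ τ , (Y⊆Eᶠ τ , path τ) , respond) , τ
    where
    τ : Traces (leaderPart zs) (followerPart zs) zs
    τ = traces-walk p (λ e∈ → proj₂ (x∈p∩q⁻ (toSubset zs) Eˡ e∈))
          (λ e∈ → toSubset⁻ (proj₁ (x∈p∩q⁻ (toSubset zs) Eˡ e∈)))
          (λ e∈L e∈ → x∈p∩q⁺ (toSubset⁺ e∈ , e∈L))
    respond : ∀ Y′ → FollowerFeasible (leaderPart zs) Y′ → weight d (followerPart zs) ℚ.≤ weight d Y′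
    respond Y′ feasible =
      let zs′ , τ′ = traces (X⊆Eˡ τ) feasible
      in total≤⇒weight≤ τ τ′ (optimal zs′ (walk τ′)
           (leaders-determined acyclic (walk τ′) p
             (λ e∈L e∈ → X∈ τ (leader∈X τ′ e∈L e∈)) (λ e∈L e∈ → X∈ τ′ (leader∈X τ e∈L e∈))))

  Attainable : ℕ → Set
  Attainable = C.Attainable edges⁺ edges⁻ long

  optimal⇒attainable : ∀ {zs} → IsWalk s zs t → ResponseOptimal s t zs → Attainable (total C.c zs)
  optimal⇒attainable p optimal =
    let k , u , ps , fs , good , opt , eq = decompose p optimal
    in k , u , ps , fs , good , opt , ≤-reflexive (cong (total C.c) eq)

  attainable⇒optimal : ∀ {n} → Attainable n → ∃[ zs ] IsWalk s zs t × ResponseOptimal s t zs × total C.c zs ≤ n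
  attainable⇒optimal (k , u , ps , fs , good , opt , le) =
    ps ++ fs , ++-walk (good-walk good) (proj₁ (proj₁ opt)) , recompose good opt , le

  accept-decides : ∀ B → accept es (vertex s) (vertex t) B decides Attainable (value B)
  accept-decides B = C.accept-sound edges⁺ edges⁻ long B , C.accept-complete edges⁺ edges⁻ long B

  -- The algorithm is run on the scaled edges with `n` as its threshold.
  attainable? : ∀ n → Dec (Attainable n)
  attainable? n = subst (Dec ∘ Attainable) (value-binary n) (decides⇒Dec (accept-decides (binary n)))

  feasible⇒attainable : ∀ {X Y} → Feasible X Y →
                        ∃[ n ] Attainable n × Scaled k (weight c (X ∪ Y)) n
  feasible⇒attainable feasible =
    let zs , τ , optimal = feasible⇒optimal feasible
    in total C.c zs , optimal⇒attainable (walk τ) optimal ,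
       subst (λ q → Scaled k q (total C.c zs)) (sym (weight-sum τ c)) (Scaled-sum scaled-c zs)

  Yes : Set
  Yes = DecisionProblem.Yes BSP-Strong-Dir (I , T)

  attainable⇒yes : Attainable (value bound) → Yes
  attainable⇒yes attainable =
    -- The existence of the optimum has to be shown. The search for the least attainable number can
    -- stop at `value bound`, which is attainable by assumption.
    let n , n≤ , attainableₙ , minimal = least attainable? (value bound) attainable
        zs , p , optimal , total≤n = attainable⇒optimal attainableₙ
        feasible , τ = optimal⇒feasible p optimal
        X = leaderPart zs
        Y = followerPart zs
        scaled-v : Scaled k (weight c (X ∪ Y)) (total C.c zs)
        scaled-v = subst (λ q → Scaled k q (total C.c zs)) (sym (weight-sum τ c)) (Scaled-sum scaled-c zs)
        lower : ∀ X′ Y′ → Feasible X′ Y′ → weight c (X ∪ Y) ℚ.≤ weight c (X′ ∪ Y′)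
        lower X′ Y′ feasible′ =
          let m , attainableₘ , scaled-m = feasible⇒attainable feasible′
          in Scaled-≤⁻ scaled-v scaled-m (≤-trans total≤n (minimal attainableₘ))
    in weight c (X ∪ Y) , ((X , Y , feasible , refl) , lower) ,
       Scaled-≤⁻ scaled-v scaled-T (≤-trans total≤n n≤)

  yes⇒attainable : Yes → Attainable (value bound)
  yes⇒attainable (v , ((X , Y , feasible , v≡) , _) , v≤T) =
    let n , (j , u , ps , fs , good , opt , le) , scaled-n = feasible⇒attainable feasible
        n≤ = Scaled-≤⁺ scaled-n scaled-T (subst (ℚ._≤ Threshold.value T) (sym v≡) v≤T)
    in j , u , ps , fs , good , opt , ≤-trans le n≤

  decide-correct : decide input decides Yes
  decide-correct = attainable⇒yes ∘ proj₁ (accept-decides bound) , proj₂ (accept-decides bound) ∘ yes⇒attainable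

-- From computed functions to decision problems

polyTime⇒solvable : ∀ {Π a f} → PolyTime a bool f → (input : DecisionProblem.Input Π → ⟦ a ⟧) →
                    (∀ x → enc a (input x) ≡ DecisionProblem.encode Π x) →
                    (∀ x → f (input x) decides DecisionProblem.Yes Π x) →
                    SolvableInPolynomialTime Π
polyTime⇒solvable {Π} {a} {f} F input enc-input correct =
  record { body = code F } , coefficients (time F) , λ x →
    let τ , run , τ≤ = subst (λ i → ⟨ code F ⟩ i ↦ encodeBool (f (input x)) within time F at size i)
                         (enc-input x) (runs F (input x))
    in f (input x) , τ , (_ , run , refl) ,
       ≤-trans τ≤ (≤-reflexive (sym (evalPoly-coefficients (time F) _))) ,
       decides⇒Reflects (correct x)

theorem4p7 : SolvableInPolynomialTime (BSP-Strong-Dir restrictedTo OnDAG)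
theorem4p7 = polyTime⇒solvable {BSP-Strong-Dir restrictedTo OnDAG} decideP
  (λ ((I , T) , acyclic) → Reduction.input I acyclic T)
  (λ ((I , T) , acyclic) → Reduction.enc-input I acyclic T)
  (λ ((I , T) , acyclic) → Reduction.decide-correct I acyclic T)
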